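{- Let $E_2(q)=1-24\sum_{n\ge1}\frac{nq^n}{1-q^n}$ and $\mathscr P=E_2(q^5)$. Let $A,B$ be as in the context. Then $$q\frac{dA}{dq}=\frac{1}{60}A\left(-5A^{10}-66A^5B^5+7B^{10}+5\mathscr P\right),\qquad q\frac{dB}{dq}=\frac{1}{60}B\left(-5B^{10}+66A^5B^5+7A^{10}+5\mathscr P\right),$$ $$q\frac{d\mathscr P}{dq}=\frac{5}{12}\left(\mathscr P^2-B^{20}+12B^{15}A^5-14B^{10}A^{10}-12B^5A^{15}-A^{20}\right).$$
   Context: $|q|<1$, $(a;q)_\infty=\prod_{j\ge0}(1-aq^j)$, $(a_1,\dots,a_r;q)_\infty=\prod_i(a_i;q)_\infty$. The functions $A,B$ are defined by $A^5=q\frac{(q;q)_\infty^2}{(q^2,q^3;q^5)_\infty^5}$ and $B^5=\frac{(q;q)_\infty^2}{(q,q^4;q^5)_\infty^5}$, i.e. $A=q^{1/5}\frac{(q;q)_\infty^{2/5}}{(q^2,q^3;q^5)_\infty}$ and $B=\frac{(q;q)_\infty^{2/5}}{(q,q^4;q^5)_\infty}$ (fifth roots normalized to have leading coefficient $1$). -}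

module Defs where

-- Formal power series in q over ℚ, represented by their coefficient sequences.
-- All q-series in the statement are convergent for |q|<1 and identities between
-- them are equivalent to identities of coefficients.

open import Data.Nat as ℕ using (ℕ; zero; suc; _∸_)
open import Data.Nat.Divisibility using (_∣?_)
open import Data.Integer using (ℤ; +_; -[1+_])
open import Data.Rational using (ℚ; 0ℚ; 1ℚ; _+_; _*_; -_; _/_)
open import Relation.Nullary using (yes; no)
open import Relation.Binary.PropositionalEquality using (_≡_)

FPS : Set
FPS = ℕ → ℚ

infix 4 _≐_
_≐_ : FPS → FPS → Set
f ≐ g = ∀ n → f n ≡ g n

ℕ→ℚ : ℕ → ℚ
ℕ→ℚ n = (+ n) / 1

sumTo : ℕ → (ℕ → ℚ) → ℚ
sumTo zero f = f 0
sumTo (suc n) f = sumTo n f + f (suc n)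

infixl 6 _⊕_
infixl 7 _⊛_ _·_

_⊕_ : FPS → FPS → FPS
(f ⊕ g) n = f n + g n

_·_ : ℚ → FPS → FPS
(c · f) n = c * f n

_⊛_ : FPS → FPS → FPS
(f ⊛ g) n = sumTo n (λ k → f k * g (n ∸ k))

one : FPS
one zero = 1ℚ
one (suc n) = 0ℚ

qpow : ℕ → FPS
qpow zero zero = 1ℚ
qpow zero (suc n) = 0ℚ
qpow (suc k) zero = 0ℚ
qpow (suc k) (suc n) = qpow k n

pow : FPS → ℕ → FPS
pow f zero = one
pow f (suc k) = f ⊛ pow f k

θ : FPS → FPS
θ f n = ℕ→ℚ n * f n

pochFin : ℕ → ℕ → ℕ → FPS
pochFin r m zero = one
pochFin r m (suc N) = pochFin r m N ⊛ (one ⊕ ((- 1ℚ) · qpow (m ℕ.* N ℕ.+ r)))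

-- (q^r ; q^m)_∞ = ∏_{j≥0} (1 - q^(m j + r)), for r ≥ 1, m ≥ 1:
-- the factors with j ≥ n do not affect the coefficient of q^n.
qPoch : ℕ → ℕ → FPS
qPoch r m n = pochFin r m (suc n) n

-- Lambert series  Σ_{n≥1} n q^n / (1 - q^n) = Σ_{n≥1} Σ_{k≥1} n q^(n k);
-- its coefficient of q^N is Σ_{1≤n≤N, n ∣ N} n.
lambert : FPS
lambert N = sumTo N (λ n → term n)
  where
  term : ℕ → ℚ
  term zero = 0ℚ
  term (suc n) with suc n ∣? N
  ... | yes _ = ℕ→ℚ (suc n)
  ... | no _ = 0ℚ

E₂ : FPS
E₂ = one ⊕ ((- ((+ 24) / 1)) · lambert)

sub5 : FPS → FPS
sub5 f n with 5 ∣? n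
... | yes _ = f (n ℕ./ 5)
... | no _ = 0ℚ

𝒫 : FPS
𝒫 = sub5 E₂

ℤ→ℚ : ℤ → ℚ
ℤ→ℚ z = z / 1

{-# OPTIONS --safe #-}
-- With A⁵ = U and B⁵ = V, both U and V are weight-one Eisenstein series of level 5:
-- U = f₁ - 3f₂ and V = 1 + 3f₁ + f₂, where fⱼ counts the divisors ≡ j minus those ≡ -j mod 5.
-- The logarithmic derivatives of the products defining U and V are divisor sums
-- ℓ₀, ℓ₁, ℓ₂ of weight two, so everything reduces to five quadratic relations between the
-- series fⱼ, ℓⱼ and their derivatives.  Comparing coefficients of qⁿ, a product of two such
-- series is a sum of h(a, b) over ax + by = n.  Applying one step of Euclid's algorithm to
-- (x, y) on one side and to (a, b) on the other gives, for p symmetric and even on triples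
-- (a, b, -a-b),
--   Σ_{ax+by=n} (p(a, b) - p(a, -b)) = Σ_{d∣n} (Σ_{k+l=d} p(k, l) - (n/d - 1) p(d, -d)),
-- and each relation comes from a suitable p depending on a, b mod 5 and, polynomially, on a, b.
-- Since a linear differential equation determines a power series, U and V agree with the
-- products, and the theorem follows by eliminating the ℓⱼ.
module Submission where

open import Defs
open import Algebra.Bundles using (CommutativeRing)
import Algebra.Properties.Semiring.Sum as SemiringSum
import Algebra.Solver.Ring as RingSolver
open import Algebra.Solver.Ring.AlmostCommutativeRing using (AlmostCommutativeRing; fromCommutativeRing; _-Raw-AlmostCommutative⟶_)
open import Data.Bool.Base using (if_then_else_)
open import Data.Fin.Base using (Fin; toℕ; fromℕ<)
open import Data.Fin.Patterns
import Data.Fin.Properties as Finₚ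
open import Data.Integer as ℤ using (ℤ; 0ℤ; 1ℤ; -1ℤ; -[1+_])
import Data.Integer.Properties as ℤₚ
import Data.Integer.Solver as ℤSolver
open import Data.List.Base using (List; []; _∷_)
open import Data.Maybe.Base using (Maybe; just; nothing)
open import Data.Nat as ℕ using (ℕ; zero; suc; _∸_; z≤n; s≤s; _≤_; _<_)
open import Data.Nat.Divisibility using (_∣_; _∣?_; divides)
import Data.Nat.DivMod as ℕₘ
import Data.Nat.Induction as ℕᵢ
import Data.Nat.Properties as ℕₚ
import Data.Nat.Tactic.RingSolver as ℕSolver
open import Data.Product using (_×_; _,_; proj₁; proj₂)
open import Data.Rational using (ℚ; 0ℚ; 1ℚ; _+_; _*_; -_; _/_; toℚᵘ)
import Data.Rational.Properties as ℚₚ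
open import Data.Rational.Solver using (module +-*-Solver)
import Data.Rational.Unnormalised as ℚᵘ
import Data.Rational.Unnormalised.Properties as ℚᵘₚ
open import Data.Sum using (_⊎_; inj₁; inj₂)
open import Data.Vec.Base as Vec using (Vec; []; _∷_; lookup)
import Data.Vec.Properties as Vecₚ
open import Function using (_∘_)
open import Level using (0ℓ)
open import Relation.Binary.PropositionalEquality
import Relation.Binary.Reasoning.Setoid as SetoidReasoning
open import Relation.Nullary using (¬_; Dec; yes; no; does; contradiction)
open import Relation.Nullary.Decidable using (_×-dec_; toWitness)

open ≡-Reasoning
open +-*-Solver using (solve; _:+_; _:*_; _:=_; con; :-_)

-- The fractional power is removed by writing A = q^(1/5) a and B = b. Then q dA/dq is q^(1/5) (a/5
-- + θa), and on the right A and B occur, apart from one outer factor, only through A⁵ = q a⁵ and B⁵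
-- = b⁵. That the products agree with U and V is not seen by expanding them. Logarithmic
-- differentiation of a product gives an equation θX = G X with G a linear combination of 1 and the
-- ℓⱼ, and the same equation for U and V is again a relation of the Euclidean kind. The degree of p
-- governs the weight. Degree 0 gives two relations between the products fᵢ fⱼ and the ℓⱼ, degree 1
-- the equations for θU and θV, degree 2 one relation between the products ℓᵢ ℓⱼ and derivatives of
-- the ℓⱼ. There are three ℓⱼ, and three series U² + V², V² - U² - 11UV and 𝒫 that are affine in
-- them; this is why the ℓⱼ can be eliminated, and the coefficients of the first two equations are
-- those of this change of basis.

toℚᵘ-ℤ→ℚ : ∀ z → toℚᵘ (ℤ→ℚ z) ℚᵘ.≃ ℚᵘ.mkℚᵘ z 0
toℚᵘ-ℤ→ℚ z = ℚₚ.toℚᵘ-fromℚᵘ (ℚᵘ.mkℚᵘ z 0)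

ℤ→ℚ-+ : ∀ x y → ℤ→ℚ (x ℤ.+ y) ≡ ℤ→ℚ x + ℤ→ℚ y
ℤ→ℚ-+ x y = ℚₚ.toℚᵘ-injective (ℚᵘₚ.≃-trans (toℚᵘ-ℤ→ℚ (x ℤ.+ y)) (ℚᵘₚ.≃-trans (ℚᵘ.*≡* lem)
  (ℚᵘₚ.≃-sym (ℚᵘₚ.≃-trans (ℚₚ.toℚᵘ-homo-+ (ℤ→ℚ x) (ℤ→ℚ y)) (ℚᵘₚ.+-cong (toℚᵘ-ℤ→ℚ x) (toℚᵘ-ℤ→ℚ y))))))
  where
  lem : (x ℤ.+ y) ℤ.* 1ℤ ≡ (x ℤ.* 1ℤ ℤ.+ y ℤ.* 1ℤ) ℤ.* 1ℤ
  lem = cong (ℤ._* 1ℤ) (cong₂ ℤ._+_ (sym (ℤₚ.*-identityʳ x)) (sym (ℤₚ.*-identityʳ y)))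

ℤ→ℚ-* : ∀ x y → ℤ→ℚ (x ℤ.* y) ≡ ℤ→ℚ x * ℤ→ℚ y
ℤ→ℚ-* x y = ℚₚ.toℚᵘ-injective (ℚᵘₚ.≃-trans (toℚᵘ-ℤ→ℚ (x ℤ.* y)) (ℚᵘₚ.≃-sym
  (ℚᵘₚ.≃-trans (ℚₚ.toℚᵘ-homo-* (ℤ→ℚ x) (ℤ→ℚ y)) (ℚᵘₚ.*-cong (toℚᵘ-ℤ→ℚ x) (toℚᵘ-ℤ→ℚ y)))))

-- Formal power series form a commutative ring

module Sumℚ = SemiringSum (CommutativeRing.semiring ℚₚ.+-*-commutativeRing)

opaque
  Σ< : ℕ → (ℕ → ℚ) → ℚ
  Σ< n f = Sumℚ.sum {n} (f ∘ toℕ)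

  Σ<-zero : ∀ f → Σ< 0 f ≡ 0ℚ
  Σ<-zero f = refl

  Σ<-suc : ∀ n f → Σ< (suc n) f ≡ f 0 + Σ< n (f ∘ suc)
  Σ<-suc n f = refl

  Σ<-cong : ∀ n {f g : ℕ → ℚ} → (∀ k → k < n → f k ≡ g k) → Σ< n f ≡ Σ< n g
  Σ<-cong n f≗g = Sumℚ.sum-cong-≗ {n} (λ i → f≗g (toℕ i) (Finₚ.toℕ<n i))

  Σ<-0 : ∀ n {f : ℕ → ℚ} → (∀ k → k < n → f k ≡ 0ℚ) → Σ< n f ≡ 0ℚ
  Σ<-0 n f≗0 = trans (Σ<-cong n f≗0) (Sumℚ.sum-replicate-zero n)

  Σ<-+ : ∀ n (f g : ℕ → ℚ) → Σ< n (λ k → f k + g k) ≡ Σ< n f + Σ< n g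
  Σ<-+ n f g = Sumℚ.∑-distrib-+ {n} (f ∘ toℕ) (g ∘ toℕ)

  Σ<-*ˡ : ∀ n c (f : ℕ → ℚ) → Σ< n (λ k → c * f k) ≡ c * Σ< n f
  Σ<-*ˡ n c f = sym (Sumℚ.*-distribˡ-sum {n} c (f ∘ toℕ))

  Σ<-*ʳ : ∀ n c (f : ℕ → ℚ) → Σ< n (λ k → f k * c) ≡ Σ< n f * c
  Σ<-*ʳ n c f = sym (Sumℚ.*-distribʳ-sum {n} c (f ∘ toℕ))

  Σ<-comm : ∀ m n (f : ℕ → ℕ → ℚ) → Σ< m (λ i → Σ< n (f i)) ≡ Σ< n (λ j → Σ< m (λ i → f i j))
  Σ<-comm m n f = Sumℚ.∑-comm {m} {n} (λ i j → f (toℕ i) (toℕ j))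

Σ<-++ : ∀ m n (f : ℕ → ℚ) → Σ< (m ℕ.+ n) f ≡ Σ< m f + Σ< n (λ k → f (m ℕ.+ k))
Σ<-++ zero    n f = sym (trans (cong (_+ Σ< n f) (Σ<-zero f)) (ℚₚ.+-identityˡ (Σ< n f)))
Σ<-++ (suc m) n f = begin
  Σ< (suc m ℕ.+ n) f                                  ≡⟨ Σ<-suc (m ℕ.+ n) f ⟩
  f 0 + Σ< (m ℕ.+ n) (f ∘ suc)                        ≡⟨ cong (f 0 +_) (Σ<-++ m n (f ∘ suc)) ⟩
  f 0 + (Σ< m (f ∘ suc) + Σ< n (λ k → f (suc m ℕ.+ k))) ≡⟨ ℚₚ.+-assoc (f 0) _ _ ⟨
  f 0 + Σ< m (f ∘ suc) + Σ< n (λ k → f (suc m ℕ.+ k)) ≡⟨ cong (_+ Σ< n (λ k → f (suc m ℕ.+ k))) (Σ<-suc m f) ⟨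
  Σ< (suc m) f + Σ< n (λ k → f (suc m ℕ.+ k)) ∎

Σ<-1 : ∀ f → Σ< 1 f ≡ f 0
Σ<-1 f = trans (Σ<-suc 0 f) (trans (cong (f 0 +_) (Σ<-zero (f ∘ suc))) (ℚₚ.+-identityʳ (f 0)))

Σ<-snoc : ∀ n (f : ℕ → ℚ) → Σ< (suc n) f ≡ Σ< n f + f n
Σ<-snoc n f = begin
  Σ< (suc n) f                    ≡⟨ cong (λ m → Σ< m f) (ℕₚ.+-comm 1 n) ⟩
  Σ< (n ℕ.+ 1) f                  ≡⟨ Σ<-++ n 1 f ⟩
  Σ< n f + Σ< 1 (λ k → f (n ℕ.+ k)) ≡⟨ cong (Σ< n f +_) (trans (Σ<-1 _) (cong f (ℕₚ.+-identityʳ n))) ⟩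
  Σ< n f + f n ∎

sumTo≡Σ< : ∀ n (f : ℕ → ℚ) → sumTo n f ≡ Σ< (suc n) f
sumTo≡Σ< zero    f = sym (Σ<-1 f)
sumTo≡Σ< (suc n) f = trans (cong (_+ f (suc n)) (sumTo≡Σ< n f)) (sym (Σ<-snoc (suc n) f))

sumTo-cong : ∀ n {f g : ℕ → ℚ} → (∀ k → k ≤ n → f k ≡ g k) → sumTo n f ≡ sumTo n g
sumTo-cong zero    f≗g = f≗g 0 z≤n
sumTo-cong (suc n) f≗g =
  cong₂ _+_ (sumTo-cong n (λ k k≤n → f≗g k (ℕₚ.m≤n⇒m≤1+n k≤n))) (f≗g (suc n) ℕₚ.≤-refl)

⊛≡Σ< : ∀ f g n → (f ⊛ g) n ≡ Σ< (suc n) (λ k → f k * g (n ∸ k))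
⊛≡Σ< f g n = sumTo≡Σ< n _

tail : FPS → FPS
tail f n = f (suc n)

⊛-sucˡ : ∀ f g n → (f ⊛ g) (suc n) ≡ f 0 * g (suc n) + (tail f ⊛ g) n
⊛-sucˡ f g n = begin
  (f ⊛ g) (suc n)                                            ≡⟨ ⊛≡Σ< f g (suc n) ⟩
  Σ< (suc (suc n)) (λ k → f k * g (suc n ∸ k))               ≡⟨ Σ<-suc (suc n) _ ⟩
  f 0 * g (suc n) + Σ< (suc n) (λ k → tail f k * g (n ∸ k))  ≡⟨ cong (f 0 * g (suc n) +_) (⊛≡Σ< (tail f) g n) ⟨
  f 0 * g (suc n) + (tail f ⊛ g) n ∎

⊛-sucʳ : ∀ f g n → (f ⊛ g) (suc n) ≡ (f ⊛ tail g) n + f (suc n) * g 0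
⊛-sucʳ f g n = cong₂ _+_
  (sumTo-cong n (λ k k≤n → cong (λ i → f k * g i) (ℕₚ.+-∸-assoc 1 k≤n)))
  (cong (λ i → f (suc n) * g i) (ℕₚ.n∸n≡0 n))

⊛-congₙ : ∀ {f f′ g g′} n → (∀ k → k ≤ n → f k ≡ f′ k) → (∀ k → k ≤ n → g k ≡ g′ k)
  → (f ⊛ g) n ≡ (f′ ⊛ g′) n
⊛-congₙ n f≗f′ g≗g′ = sumTo-cong n (λ k k≤n → cong₂ _*_ (f≗f′ k k≤n) (g≗g′ (n ∸ k) (ℕₚ.m∸n≤m n k)))

⊛-cong : ∀ {f f′ g g′} → f ≐ f′ → g ≐ g′ → f ⊛ g ≐ f′ ⊛ g′
⊛-cong f≐f′ g≐g′ n = ⊛-congₙ n (λ k _ → f≐f′ k) (λ k _ → g≐g′ k)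

⊛-comm : ∀ f g → f ⊛ g ≐ g ⊛ f
⊛-comm f g zero    = ℚₚ.*-comm (f 0) (g 0)
⊛-comm f g (suc n) = begin
  (f ⊛ g) (suc n)                 ≡⟨ ⊛-sucˡ f g n ⟩
  f 0 * g (suc n) + (tail f ⊛ g) n ≡⟨ cong₂ _+_ (ℚₚ.*-comm (f 0) _) (⊛-comm (tail f) g n) ⟩
  g (suc n) * f 0 + (g ⊛ tail f) n ≡⟨ ℚₚ.+-comm (g (suc n) * f 0) _ ⟩
  (g ⊛ tail f) n + g (suc n) * f 0 ≡⟨ ⊛-sucʳ g f n ⟨
  (g ⊛ f) (suc n) ∎

⊛-distribʳ : ∀ h f g → (f ⊕ g) ⊛ h ≐ f ⊛ h ⊕ g ⊛ h
⊛-distribʳ h f g n = begin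
  ((f ⊕ g) ⊛ h) n                                                       ≡⟨ ⊛≡Σ< (f ⊕ g) h n ⟩
  Σ< (suc n) (λ k → (f k + g k) * h (n ∸ k))
    ≡⟨ Σ<-cong (suc n) (λ k _ → ℚₚ.*-distribʳ-+ (h (n ∸ k)) (f k) (g k)) ⟩
  Σ< (suc n) (λ k → f k * h (n ∸ k) + g k * h (n ∸ k))                   ≡⟨ Σ<-+ (suc n) (λ k → f k * h (n ∸ k)) (λ k → g k * h (n ∸ k)) ⟩
  Σ< (suc n) (λ k → f k * h (n ∸ k)) + Σ< (suc n) (λ k → g k * h (n ∸ k))
    ≡⟨ cong₂ _+_ (⊛≡Σ< f h n) (⊛≡Σ< g h n) ⟨
  (f ⊛ h ⊕ g ⊛ h) n ∎

·-⊛ : ∀ c f g → (c · f) ⊛ g ≐ c · (f ⊛ g)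
·-⊛ c f g n = begin
  ((c · f) ⊛ g) n                              ≡⟨ ⊛≡Σ< (c · f) g n ⟩
  Σ< (suc n) (λ k → c * f k * g (n ∸ k))       ≡⟨ Σ<-cong (suc n) (λ k _ → ℚₚ.*-assoc c (f k) (g (n ∸ k))) ⟩
  Σ< (suc n) (λ k → c * (f k * g (n ∸ k)))     ≡⟨ Σ<-*ˡ (suc n) c (λ k → f k * g (n ∸ k)) ⟩
  c * Σ< (suc n) (λ k → f k * g (n ∸ k))       ≡⟨ cong (c *_) (⊛≡Σ< f g n) ⟨
  (c · (f ⊛ g)) n ∎

⊛-assoc : ∀ f g h → (f ⊛ g) ⊛ h ≐ f ⊛ (g ⊛ h)
⊛-assoc f g h zero    = ℚₚ.*-assoc (f 0) (g 0) (h 0)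
⊛-assoc f g h (suc n) = begin
  ((f ⊛ g) ⊛ h) (suc n)
    ≡⟨ ⊛-sucˡ (f ⊛ g) h n ⟩
  f 0 * g 0 * h (suc n) + (tail (f ⊛ g) ⊛ h) n
    ≡⟨ cong (f 0 * g 0 * h (suc n) +_) (⊛-cong {g = h} {h} (⊛-sucˡ f g) (λ _ → refl) n) ⟩
  f 0 * g 0 * h (suc n) + ((f 0 · tail g ⊕ tail f ⊛ g) ⊛ h) n
    ≡⟨ cong (f 0 * g 0 * h (suc n) +_) (⊛-distribʳ h (f 0 · tail g) (tail f ⊛ g) n) ⟩
  f 0 * g 0 * h (suc n) + (((f 0 · tail g) ⊛ h) n + ((tail f ⊛ g) ⊛ h) n)
    ≡⟨ cong (f 0 * g 0 * h (suc n) +_) (cong₂ _+_ (·-⊛ (f 0) (tail g) h n) (⊛-assoc (tail f) g h n)) ⟩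
  f 0 * g 0 * h (suc n) + (f 0 * (tail g ⊛ h) n + (tail f ⊛ (g ⊛ h)) n)
    ≡⟨ solve 5 (λ a b c d e → a :* b :* c :+ (a :* d :+ e) := a :* (b :* c :+ d) :+ e) refl
         (f 0) (g 0) (h (suc n)) ((tail g ⊛ h) n) ((tail f ⊛ (g ⊛ h)) n) ⟩
  f 0 * (g 0 * h (suc n) + (tail g ⊛ h) n) + (tail f ⊛ (g ⊛ h)) n
    ≡⟨ cong (λ x → f 0 * x + (tail f ⊛ (g ⊛ h)) n) (⊛-sucˡ g h n) ⟨
  f 0 * (g ⊛ h) (suc n) + (tail f ⊛ (g ⊛ h)) n
    ≡⟨ ⊛-sucˡ f (g ⊛ h) n ⟨
  (f ⊛ (g ⊛ h)) (suc n) ∎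

𝟘 : FPS
𝟘 _ = 0ℚ

infix 8 ⊝_
⊝_ : FPS → FPS
(⊝ f) n = - f n

𝟘-⊛ : ∀ f → 𝟘 ⊛ f ≐ 𝟘
𝟘-⊛ f n = trans (⊛≡Σ< 𝟘 f n) (Σ<-0 (suc n) (λ k _ → ℚₚ.*-zeroˡ (f (n ∸ k))))

one-⊛ : ∀ f → one ⊛ f ≐ f
one-⊛ f zero    = ℚₚ.*-identityˡ (f 0)
one-⊛ f (suc n) = begin
  (one ⊛ f) (suc n)          ≡⟨ ⊛-sucˡ one f n ⟩
  1ℚ * f (suc n) + (𝟘 ⊛ f) n ≡⟨ cong₂ _+_ (ℚₚ.*-identityˡ (f (suc n))) (𝟘-⊛ f n) ⟩
  f (suc n) + 0ℚ             ≡⟨ ℚₚ.+-identityʳ _ ⟩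
  f (suc n) ∎

⊛-identityʳ : ∀ f → f ⊛ one ≐ f
⊛-identityʳ f n = trans (⊛-comm f one n) (one-⊛ f n)

⊛-distribˡ : ∀ h f g → h ⊛ (f ⊕ g) ≐ h ⊛ f ⊕ h ⊛ g
⊛-distribˡ h f g n = trans (⊛-comm h (f ⊕ g) n)
  (trans (⊛-distribʳ h f g n) (cong₂ _+_ (⊛-comm f h n) (⊛-comm g h n)))

FPS-commutativeRing : CommutativeRing 0ℓ 0ℓ
FPS-commutativeRing = record
  { Carrier = FPS ; _≈_ = _≐_ ; _+_ = _⊕_ ; _*_ = _⊛_ ; -_ = ⊝_ ; 0# = 𝟘 ; 1# = one
  ; isCommutativeRing = record
    { isRing = record
      { +-isAbelianGroup = record
        { isGroup = record
          { isMonoid = record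
            { isSemigroup = record
              { isMagma = record
                { isEquivalence = record
                  { refl = λ _ → refl
                  ; sym = λ p n → sym (p n)
                  ; trans = λ p q n → trans (p n) (q n) }
                ; ∙-cong = λ p q n → cong₂ _+_ (p n) (q n) }
              ; assoc = λ f g h n → ℚₚ.+-assoc (f n) (g n) (h n) }
            ; identity = (λ f n → ℚₚ.+-identityˡ (f n)) , (λ f n → ℚₚ.+-identityʳ (f n)) }
          ; inverse = (λ f n → ℚₚ.+-inverseˡ (f n)) , (λ f n → ℚₚ.+-inverseʳ (f n))
          ; ⁻¹-cong = λ p n → cong -_ (p n) }
        ; comm = λ f g n → ℚₚ.+-comm (f n) (g n) }
      ; *-cong = λ {f} {f′} {g} {g′} → ⊛-cong {f} {f′} {g} {g′}
      ; *-assoc = ⊛-assoc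
      ; *-identity = one-⊛ , ⊛-identityʳ
      ; distrib = ⊛-distribˡ , ⊛-distribʳ }
    ; *-comm = ⊛-comm } }

module FPSRing = CommutativeRing FPS-commutativeRing

FPS-ring : AlmostCommutativeRing 0ℓ 0ℓ
FPS-ring = fromCommutativeRing FPS-commutativeRing

constant : ℚ → FPS
constant c = c · one

·≐constant-⊛ : ∀ c f → c · f ≐ constant c ⊛ f
·≐constant-⊛ c f n = sym (trans (·-⊛ c one f n) (cong (c *_) (one-⊛ f n)))

ℚ⟶FPS : CommutativeRing.rawRing ℚₚ.+-*-commutativeRing -Raw-AlmostCommutative⟶ FPS-ring
ℚ⟶FPS = record
  { ⟦_⟧    = constant
  ; +-homo = λ c d n → ℚₚ.*-distribʳ-+ (one n) c d
  ; *-homo = λ c d n → trans (ℚₚ.*-assoc c d (one n)) (·≐constant-⊛ c (constant d) n)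
  ; -‿homo = λ c n → sym (ℚₚ.neg-distribˡ-* c (one n))
  ; 0-homo = λ n → ℚₚ.*-zeroˡ (one n)
  ; 1-homo = λ n → ℚₚ.*-identityˡ (one n)
  }

constant-≟ : ∀ c d → Maybe (constant c ≐ constant d)
constant-≟ c d with c ℚₚ.≟ d
... | yes refl = just (λ _ → refl)
... | no _     = nothing

module F =
  RingSolver (CommutativeRing.rawRing ℚₚ.+-*-commutativeRing) FPS-ring ℚ⟶FPS constant-≟

-- Derivations and linear differential equations

module ≐-Reasoning = SetoidReasoning FPSRing.setoid
open ≐-Reasoning using (step-≈-⟩; step-≈-⟨)
  renaming (begin_ to infix 1 ≐begin_; _∎ to infix 3 _≐∎)

ℕ→ℚ-+ : ∀ m n → ℕ→ℚ (m ℕ.+ n) ≡ ℕ→ℚ m + ℕ→ℚ n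
ℕ→ℚ-+ m n = ℤ→ℚ-+ (ℤ.+ m) (ℤ.+ n)

ℕ→ℚ-* : ∀ m n → ℕ→ℚ (m ℕ.* n) ≡ ℕ→ℚ m * ℕ→ℚ n
ℕ→ℚ-* m n = trans (cong ℤ→ℚ (ℤₚ.pos-* m n)) (ℤ→ℚ-* (ℤ.+ m) (ℤ.+ n))

recip-* : ∀ n → (ℤ.+ 1 / suc n) * ℕ→ℚ (suc n) ≡ 1ℚ
recip-* n = ℚₚ.toℚᵘ-injective (ℚᵘₚ.≃-trans (ℚₚ.toℚᵘ-homo-* (ℤ.+ 1 / suc n) (ℕ→ℚ (suc n)))
  (ℚᵘₚ.≃-trans (ℚᵘₚ.*-cong (ℚₚ.toℚᵘ-fromℚᵘ (ℚᵘ.mkℚᵘ (ℤ.+ 1) n)) (toℚᵘ-ℤ→ℚ (ℤ.+ suc n)))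
    (ℚᵘ.*≡* (trans (ℤₚ.*-identityʳ (ℤ.+ 1 ℤ.* ℤ.+ suc n))
      (cong (ℤ.+ 1 ℤ.*_) (sym (ℤₚ.*-identityʳ (ℤ.+ suc n))))))))

ℕ→ℚ-suc-cancel : ∀ n x → ℕ→ℚ (suc n) * x ≡ 0ℚ → x ≡ 0ℚ
ℕ→ℚ-suc-cancel n x nx≡0 = begin
  x                                     ≡⟨ ℚₚ.*-identityˡ x ⟨
  1ℚ * x                                ≡⟨ cong (_* x) (recip-* n) ⟨
  (ℤ.+ 1 / suc n) * ℕ→ℚ (suc n) * x     ≡⟨ ℚₚ.*-assoc (ℤ.+ 1 / suc n) (ℕ→ℚ (suc n)) x ⟩
  (ℤ.+ 1 / suc n) * (ℕ→ℚ (suc n) * x)   ≡⟨ cong ((ℤ.+ 1 / suc n) *_) nx≡0 ⟩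
  (ℤ.+ 1 / suc n) * 0ℚ                  ≡⟨ ℚₚ.*-zeroʳ (ℤ.+ 1 / suc n) ⟩
  0ℚ ∎

θ-cong : ∀ {f g} → f ≐ g → θ f ≐ θ g
θ-cong f≐g n = cong (ℕ→ℚ n *_) (f≐g n)

θ-⊕ : ∀ f g → θ (f ⊕ g) ≐ θ f ⊕ θ g
θ-⊕ f g n = ℚₚ.*-distribˡ-+ (ℕ→ℚ n) (f n) (g n)

θ-· : ∀ c f → θ (c · f) ≐ c · θ f
θ-· c f n = solve 3 (λ m c x → m :* (c :* x) := c :* (m :* x)) refl (ℕ→ℚ n) c (f n)

θ-one : θ one ≐ 𝟘
θ-one zero    = ℚₚ.*-zeroˡ 1ℚ
θ-one (suc n) = ℚₚ.*-zeroʳ (ℕ→ℚ (suc n))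

θ-⊛ : ∀ f g → θ (f ⊛ g) ≐ θ f ⊛ g ⊕ f ⊛ θ g
θ-⊛ f g n = begin
  ℕ→ℚ n * (f ⊛ g) n
    ≡⟨ cong (ℕ→ℚ n *_) (⊛≡Σ< f g n) ⟩
  ℕ→ℚ n * Σ< (suc n) (λ k → f k * g (n ∸ k))
    ≡⟨ Σ<-*ˡ (suc n) (ℕ→ℚ n) (λ k → f k * g (n ∸ k)) ⟨
  Σ< (suc n) (λ k → ℕ→ℚ n * (f k * g (n ∸ k)))
    ≡⟨ Σ<-cong (suc n) (λ { k (s≤s k≤n) → step k k≤n }) ⟩
  Σ< (suc n) (λ k → θ f k * g (n ∸ k) + f k * θ g (n ∸ k))
    ≡⟨ Σ<-+ (suc n) (λ k → θ f k * g (n ∸ k)) (λ k → f k * θ g (n ∸ k)) ⟩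
  Σ< (suc n) (λ k → θ f k * g (n ∸ k)) + Σ< (suc n) (λ k → f k * θ g (n ∸ k))
    ≡⟨ cong₂ _+_ (⊛≡Σ< (θ f) g n) (⊛≡Σ< f (θ g) n) ⟨
  (θ f ⊛ g ⊕ f ⊛ θ g) n ∎
  where
  step : ∀ k → k ≤ n → ℕ→ℚ n * (f k * g (n ∸ k)) ≡ θ f k * g (n ∸ k) + f k * θ g (n ∸ k)
  step k k≤n = begin
    ℕ→ℚ n * (f k * g (n ∸ k))
      ≡⟨ cong (λ m → ℕ→ℚ m * (f k * g (n ∸ k))) (ℕₚ.m+[n∸m]≡n k≤n) ⟨
    ℕ→ℚ (k ℕ.+ (n ∸ k)) * (f k * g (n ∸ k))
      ≡⟨ cong (_* (f k * g (n ∸ k))) (ℕ→ℚ-+ k (n ∸ k)) ⟩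
    (ℕ→ℚ k + ℕ→ℚ (n ∸ k)) * (f k * g (n ∸ k))
      ≡⟨ solve 4 (λ a b x y → (a :+ b) :* (x :* y) := a :* x :* y :+ x :* (b :* y)) refl
           (ℕ→ℚ k) (ℕ→ℚ (n ∸ k)) (f k) (g (n ∸ k)) ⟩
    θ f k * g (n ∸ k) + f k * θ g (n ∸ k) ∎

pow-+ : ∀ f m n → pow f (m ℕ.+ n) ≐ pow f m ⊛ pow f n
pow-+ f zero    n = FPSRing.sym (one-⊛ (pow f n))
pow-+ f (suc m) n = FPSRing.trans (FPSRing.*-congˡ {f} (pow-+ f m n)) (FPSRing.sym (⊛-assoc f (pow f m) (pow f n)))

qpow-refl : ∀ k → qpow k k ≡ 1ℚ
qpow-refl zero    = refl
qpow-refl (suc k) = qpow-refl k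

qpow-≢ : ∀ k n → k ≢ n → qpow k n ≡ 0ℚ
qpow-≢ zero    zero    k≢n = contradiction refl k≢n
qpow-≢ zero    (suc n) k≢n = refl
qpow-≢ (suc k) zero    k≢n = refl
qpow-≢ (suc k) (suc n) k≢n = qpow-≢ k n (k≢n ∘ cong suc)

qpow-zero : qpow 0 ≐ one
qpow-zero zero    = refl
qpow-zero (suc n) = refl

qpow-suc-⊛ : ∀ k f n → (qpow (suc k) ⊛ f) (suc n) ≡ (qpow k ⊛ f) n
qpow-suc-⊛ k f n = trans (⊛-sucˡ (qpow (suc k)) f n)
  (trans (cong (_+ (qpow k ⊛ f) n) (ℚₚ.*-zeroˡ (f (suc n)))) (ℚₚ.+-identityˡ _))

qpow-+ : ∀ k l → qpow k ⊛ qpow l ≐ qpow (k ℕ.+ l)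
qpow-+ zero    l n       = trans (⊛-cong {g = qpow l} {qpow l} qpow-zero (λ _ → refl) n) (one-⊛ (qpow l) n)
qpow-+ (suc k) l zero    = ℚₚ.*-zeroˡ (qpow l 0)
qpow-+ (suc k) l (suc n) = trans (qpow-suc-⊛ k (qpow l) n) (qpow-+ k l n)

θ-qpow : ∀ k → θ (qpow k) ≐ ℕ→ℚ k · qpow k
θ-qpow k n with k ℕₚ.≟ n
... | yes refl = refl
... | no k≢n   = trans (cong (ℕ→ℚ n *_) (qpow-≢ k n k≢n))
  (trans (ℚₚ.*-zeroʳ (ℕ→ℚ n)) (sym (trans (cong (ℕ→ℚ k *_) (qpow-≢ k n k≢n)) (ℚₚ.*-zeroʳ (ℕ→ℚ k)))))

⊛-leading : ∀ f g n → (∀ k → k < n → f k ≡ 0ℚ) → (f ⊛ g) n ≡ f n * g 0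
⊛-leading f g zero    f<n≡0 = refl
⊛-leading f g (suc n) f<n≡0 = begin
  (f ⊛ g) (suc n)                 ≡⟨ ⊛-sucʳ f g n ⟩
  (f ⊛ tail g) n + f (suc n) * g 0
    ≡⟨ cong (_+ f (suc n) * g 0) (⊛-congₙ {g = tail g} n (λ k k≤n → f<n≡0 k (s≤s k≤n)) (λ _ _ → refl)) ⟩
  (𝟘 ⊛ tail g) n + f (suc n) * g 0 ≡⟨ cong (_+ f (suc n) * g 0) (𝟘-⊛ (tail g) n) ⟩
  0ℚ + f (suc n) * g 0            ≡⟨ ℚₚ.+-identityˡ (f (suc n) * g 0) ⟩
  f (suc n) * g 0 ∎

vanishing : ∀ (f : FPS) → (∀ n → (∀ k → k < n → f k ≡ 0ℚ) → f n ≡ 0ℚ) → f ≐ 𝟘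
vanishing f step = ℕᵢ.<-rec _ (λ n rec → step n (λ k k<n → rec {k} k<n))

⊝-zero : ∀ f g → f ⊕ ⊝ g ≐ 𝟘 → f ≐ g
⊝-zero f g f-g≐0 n = begin
  f n               ≡⟨ solve 2 (λ x y → x := x :+ :- y :+ y) refl (f n) (g n) ⟩
  f n + - g n + g n ≡⟨ cong (_+ g n) (f-g≐0 n) ⟩
  0ℚ + g n          ≡⟨ ℚₚ.+-identityˡ (g n) ⟩
  g n ∎

-- The lowest nonzero coefficient of f - g survives multiplication by h, whose constant term is 1.
-- This replaces division by h.
⊛-cancelʳ : ∀ f g h → h 0 ≡ 1ℚ → f ⊛ h ≐ g ⊛ h → f ≐ g
⊛-cancelʳ f g h h₀≡1 fh≐gh = ⊝-zero f g (vanishing d (λ n d<n≡0 → begin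
  d n        ≡⟨ ℚₚ.*-identityʳ (d n) ⟨
  d n * 1ℚ   ≡⟨ cong (d n *_) h₀≡1 ⟨
  d n * h 0  ≡⟨ ⊛-leading d h n d<n≡0 ⟨
  (d ⊛ h) n  ≡⟨ dh≐0 n ⟩
  0ℚ ∎))
  where
  d : FPS
  d = f ⊕ ⊝ g
  dh≐0 : d ⊛ h ≐ 𝟘
  dh≐0 n = begin
    (d ⊛ h) n                 ≡⟨ F.solve 3 (λ f g h → ((f F.:- g) F.:* h) F.:= (f F.:* h F.:- g F.:* h)) (λ _ → refl) f g h n ⟩
    (f ⊛ h) n + - (g ⊛ h) n   ≡⟨ cong (_+ - (g ⊛ h) n) (fh≐gh n) ⟩
    (g ⊛ h) n + - (g ⊛ h) n   ≡⟨ ℚₚ.+-inverseʳ ((g ⊛ h) n) ⟩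
    0ℚ ∎

-- For n > m the coefficient of qⁿ reads (n - m) fₙ = Σ_{k<n} fₖ gₙ₋ₖ.
linearODE-vanishing : ∀ g f m → g 0 ≡ ℕ→ℚ m → (∀ k → k ≤ m → f k ≡ 0ℚ) → θ f ≐ g ⊛ f → f ≐ 𝟘
linearODE-vanishing g f m g₀≡m f≤m≡0 θf≐gf = vanishing f step
  where
  step : ∀ n → (∀ k → k < n → f k ≡ 0ℚ) → f n ≡ 0ℚ
  step n f<n≡0 with n ℕₚ.≤? m
  ... | yes n≤m = f≤m≡0 n n≤m
  ... | no n≰m with ℕₚ.m≤n⇒∃[o]m+o≡n (ℕₚ.≰⇒> n≰m)
  ...   | j , refl = ℕ→ℚ-suc-cancel j (f n) (begin
    ℕ→ℚ (suc j) * f n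
      ≡⟨ solve 3 (λ x y z → x :* z := (x :+ y) :* z :+ :- (z :* y)) refl (ℕ→ℚ (suc j)) (ℕ→ℚ m) (f n) ⟩
    (ℕ→ℚ (suc j) + ℕ→ℚ m) * f n + - (f n * ℕ→ℚ m)
      ≡⟨ cong₂ (λ x y → x * f n + - (f n * y))
           (trans (sym (ℕ→ℚ-+ (suc j) m)) (cong (ℕ→ℚ ∘ suc) (ℕₚ.+-comm j m))) (sym g₀≡m) ⟩
    θ f n + - (f n * g 0)
      ≡⟨ cong (λ x → θ f n + - x) (trans (⊛-comm g f n) (⊛-leading f g n f<n≡0)) ⟨
    θ f n + - (g ⊛ f) n
      ≡⟨ cong (λ x → x + - (g ⊛ f) n) (θf≐gf n) ⟩
    (g ⊛ f) n + - (g ⊛ f) n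
      ≡⟨ ℚₚ.+-inverseʳ ((g ⊛ f) n) ⟩
    0ℚ ∎)

-- At n = m the recursion for the coefficients degenerates and leaves the coefficient of q^m free,
-- so the initial data reach up to index m. The case m = 0 serves V; m = 1 serves U, which begins
-- with q.
linearODE-unique : ∀ g f f′ m → g 0 ≡ ℕ→ℚ m → (∀ k → k ≤ m → f k ≡ f′ k)
  → θ f ≐ g ⊛ f → θ f′ ≐ g ⊛ f′ → f ≐ f′
linearODE-unique g f f′ m g₀≡m f≗f′ θf θf′ = ⊝-zero f f′ (linearODE-vanishing g (f ⊕ ⊝ f′) m g₀≡m
  (λ k k≤m → trans (cong (_+ - f′ k) (f≗f′ k k≤m)) (ℚₚ.+-inverseʳ (f′ k)))
  (λ n → begin
    ℕ→ℚ n * (f n + - f′ n)   ≡⟨ solve 3 (λ m x y → m :* (x :+ :- y) := m :* x :+ :- (m :* y)) refl (ℕ→ℚ n) (f n) (f′ n) ⟩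
    θ f n + - θ f′ n         ≡⟨ cong₂ (λ x y → x + - y) (θf n) (θf′ n) ⟩
    (g ⊛ f) n + - (g ⊛ f′) n ≡⟨ F.solve 3 (λ g f h → (g F.:* f F.:- g F.:* h) F.:= (g F.:* (f F.:- h))) (λ _ → refl) g f f′ n ⟩
    (g ⊛ (f ⊕ ⊝ f′)) n ∎))

-- Divisor sums and the Euclidean step

Σ<-extend : ∀ {m n} (f : ℕ → ℚ) → m ≤ n → (∀ k → m ≤ k → f k ≡ 0ℚ) → Σ< n f ≡ Σ< m f
Σ<-extend {m} {n} f m≤n f≥m≡0 = begin
  Σ< n f                                      ≡⟨ cong (λ k → Σ< k f) (ℕₚ.m+[n∸m]≡n m≤n) ⟨
  Σ< (m ℕ.+ (n ∸ m)) f                        ≡⟨ Σ<-++ m (n ∸ m) f ⟩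
  Σ< m f + Σ< (n ∸ m) (λ k → f (m ℕ.+ k))
    ≡⟨ cong (Σ< m f +_) (Σ<-0 (n ∸ m) (λ k _ → f≥m≡0 (m ℕ.+ k) (ℕₚ.m≤m+n m k))) ⟩
  Σ< m f + 0ℚ                                 ≡⟨ ℚₚ.+-identityʳ (Σ< m f) ⟩
  Σ< m f ∎

Σ<-const : ∀ n c → Σ< n (λ _ → c) ≡ ℕ→ℚ n * c
Σ<-const zero    c = trans (Σ<-zero _) (sym (ℚₚ.*-zeroˡ c))
Σ<-const (suc n) c = begin
  Σ< (suc n) (λ _ → c)  ≡⟨ Σ<-suc n (λ _ → c) ⟩
  c + Σ< n (λ _ → c)    ≡⟨ cong₂ _+_ (sym (ℚₚ.*-identityˡ c)) (Σ<-const n c) ⟩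
  1ℚ * c + ℕ→ℚ n * c    ≡⟨ ℚₚ.*-distribʳ-+ c 1ℚ (ℕ→ℚ n) ⟨
  (1ℚ + ℕ→ℚ n) * c      ≡⟨ cong (_* c) (ℕ→ℚ-+ 1 n) ⟨
  ℕ→ℚ (suc n) * c ∎

Σ<-triangle-∸ : ∀ n (f : ℕ → ℕ → ℚ)
  → Σ< n (λ i → Σ< i (f i)) ≡ Σ< n (λ j → Σ< (n ∸ suc j) (λ k → f (suc (j ℕ.+ k)) j))
Σ<-triangle-∸ zero    f = trans (Σ<-zero _) (sym (Σ<-zero _))
Σ<-triangle-∸ (suc n) f = begin
  Σ< (suc n) (λ i → Σ< i (f i))
    ≡⟨ Σ<-suc n _ ⟩
  Σ< 0 (f 0) + Σ< n (λ i → Σ< (suc i) (f (suc i)))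
    ≡⟨ cong₂ _+_ (Σ<-zero (f 0)) (Σ<-cong n (λ i _ → Σ<-suc i (f (suc i)))) ⟩
  0ℚ + Σ< n (λ i → f (suc i) 0 + Σ< i (f (suc i) ∘ suc))
    ≡⟨ ℚₚ.+-identityˡ _ ⟩
  Σ< n (λ i → f (suc i) 0 + Σ< i (f (suc i) ∘ suc))
    ≡⟨ Σ<-+ n (λ i → f (suc i) 0) (λ i → Σ< i (f (suc i) ∘ suc)) ⟩
  Σ< n (λ i → f (suc i) 0) + Σ< n (λ i → Σ< i (f (suc i) ∘ suc))
    ≡⟨ cong (Σ< n (λ i → f (suc i) 0) +_) (Σ<-triangle-∸ n (λ i j → f (suc i) (suc j))) ⟩
  Σ< n (λ k → f (suc k) 0) + Σ< n (λ j → Σ< (n ∸ suc j) (λ k → f (suc (suc (j ℕ.+ k))) (suc j)))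
    ≡⟨ Σ<-suc n (λ j → Σ< (suc n ∸ suc j) (λ k → f (suc (j ℕ.+ k)) j)) ⟨
  Σ< (suc n) (λ j → Σ< (suc n ∸ suc j) (λ k → f (suc (j ℕ.+ k)) j)) ∎

Σ<-triangle : ∀ n (f : ℕ → ℕ → ℚ) → (∀ i j → n ≤ i → f i j ≡ 0ℚ)
  → Σ< n (λ j → Σ< n (λ k → f (suc (j ℕ.+ k)) j)) ≡ Σ< n (λ i → Σ< i (f i))
Σ<-triangle n f f≡0 = trans
  (Σ<-cong n (λ j j<n → Σ<-extend _ (ℕₚ.m∸n≤m n (suc j)) (λ k n∸j≤k → f≡0 _ j
    (ℕₚ.≤-trans (ℕₚ.m≤n+m∸n n (suc j)) (ℕₚ.+-monoʳ-≤ (suc j) n∸j≤k)))))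
  (sym (Σ<-triangle-∸ n f))

-- Since f vanishes outside the square, both triangles can be reindexed by the difference of the
-- indices and still be summed over the full square. A Euclidean step thus leads from a quadruple
-- sum to quadruple sums of the same shape.
Σ<-trichotomy : ∀ n (f : ℕ → ℕ → ℚ) → (∀ i j → n ≤ i → f i j ≡ 0ℚ) → (∀ i j → n ≤ j → f i j ≡ 0ℚ)
  → Σ< n (λ i → Σ< n (f i))
    ≡ Σ< n (λ i → Σ< n (λ j → f (suc (i ℕ.+ j)) i))
      + (Σ< n (λ i → f i i) + Σ< n (λ i → Σ< n (λ j → f i (suc (i ℕ.+ j)))))
Σ<-trichotomy n f zeroₗ zeroᵣ = begin
  Σ< n (λ i → Σ< n (f i))
    ≡⟨ Σ<-cong n (λ i i<n → row i) ⟩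
  Σ< n (λ i → Σ< i (f i) + (f i i + Σ< n (λ j → f i (suc (i ℕ.+ j)))))
    ≡⟨ Σ<-+ n (λ i → Σ< i (f i)) (λ i → f i i + Σ< n (λ j → f i (suc (i ℕ.+ j)))) ⟩
  Σ< n (λ i → Σ< i (f i)) + Σ< n (λ i → f i i + Σ< n (λ j → f i (suc (i ℕ.+ j))))
    ≡⟨ cong₂ _+_ (sym (Σ<-triangle n f zeroₗ)) (Σ<-+ n (λ i → f i i) (λ i → Σ< n (λ j → f i (suc (i ℕ.+ j))))) ⟩
  _ ∎
  where
  row : ∀ i → Σ< n (f i) ≡ Σ< i (f i) + (f i i + Σ< n (λ j → f i (suc (i ℕ.+ j))))
  row i = begin
    Σ< n (f i)
      ≡⟨ Σ<-extend (f i) (ℕₚ.m≤n+m n (suc i)) (λ j → zeroᵣ i j) ⟨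
    Σ< (suc i ℕ.+ n) (f i)
      ≡⟨ cong (λ m → Σ< m (f i)) (ℕₚ.+-suc i n) ⟨
    Σ< (i ℕ.+ suc n) (f i)
      ≡⟨ Σ<-++ i (suc n) (f i) ⟩
    Σ< i (f i) + Σ< (suc n) (λ j → f i (i ℕ.+ j))
      ≡⟨ cong (Σ< i (f i) +_) (Σ<-suc n (λ j → f i (i ℕ.+ j))) ⟩
    Σ< i (f i) + (f i (i ℕ.+ 0) + Σ< n (λ j → f i (i ℕ.+ suc j)))
      ≡⟨ cong (Σ< i (f i) +_) (cong₂ _+_ (cong (f i) (ℕₚ.+-identityʳ i))
           (Σ<-cong n (λ j _ → cong (f i) (ℕₚ.+-suc i j)))) ⟩
    Σ< i (f i) + (f i i + Σ< n (λ j → f i (suc (i ℕ.+ j)))) ∎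

-- The series Σ w(d) q^(dx) over d, x ≥ 1. Indices are shifted by one and cut off at n, since the
-- exponent exceeds n as soon as a ≥ n or x ≥ n. The cutoff varies with the coefficient, so products
-- first need `Lam-extend` to reach a common one.
Lam : (ℕ → ℚ) → FPS
Lam w n = Σ< n (λ a → Σ< n (λ x → w (suc a) * qpow (suc a ℕ.* suc x) n))

*qpow-< : ∀ c m n → n < m → c * qpow m n ≡ 0ℚ
*qpow-< c m n n<m = trans (cong (c *_) (qpow-≢ m n (λ m≡n → ℕₚ.<-irrefl (sym m≡n) n<m))) (ℚₚ.*-zeroʳ c)

<suc*suc : ∀ {n} a x → n ≤ a ⊎ n ≤ x → n < suc a ℕ.* suc x
<suc*suc a x (inj₁ n≤a) = ℕₚ.≤-trans (s≤s n≤a) (ℕₚ.m≤m*n (suc a) (suc x))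
<suc*suc a x (inj₂ n≤x) = ℕₚ.≤-trans (s≤s n≤x) (ℕₚ.m≤n*m (suc x) (suc a))

Lam-extend : ∀ w n M N → n ≤ M → n ≤ N
  → Lam w n ≡ Σ< M (λ a → Σ< N (λ x → w (suc a) * qpow (suc a ℕ.* suc x) n))
Lam-extend w n M N n≤M n≤N = begin
  Lam w n
    ≡⟨ Σ<-extend _ n≤M (λ a n≤a → Σ<-0 n (λ x _ → *qpow-< (w (suc a)) _ n (<suc*suc a x (inj₁ n≤a)))) ⟨
  Σ< M (λ a → Σ< n (λ x → w (suc a) * qpow (suc a ℕ.* suc x) n))
    ≡⟨ Σ<-cong M (λ a _ → Σ<-extend _ n≤N (λ x n≤x → *qpow-< (w (suc a)) _ n (<suc*suc a x (inj₂ n≤x)))) ⟨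
  Σ< M (λ a → Σ< N (λ x → w (suc a) * qpow (suc a ℕ.* suc x) n)) ∎

Lam-cong : ∀ v w → (∀ d → v (suc d) ≡ w (suc d)) → Lam v ≐ Lam w
Lam-cong v w v≗w n = Σ<-cong n (λ a _ → Σ<-cong n (λ x _ → cong (_* qpow (suc a ℕ.* suc x) n) (v≗w a)))

Lam-+ : ∀ v w → Lam (λ d → v d + w d) ≐ Lam v ⊕ Lam w
Lam-+ v w n = trans
  (Σ<-cong n (λ a _ → trans (Σ<-cong n (λ x _ → ℚₚ.*-distribʳ-+ (qpow (suc a ℕ.* suc x) n) (v (suc a)) (w (suc a))))
    (Σ<-+ n _ _)))
  (Σ<-+ n _ _)

Lam-· : ∀ c w → Lam (λ d → c * w d) ≐ c · Lam w
Lam-· c w n = trans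
  (Σ<-cong n (λ a _ → trans (Σ<-cong n (λ x _ → ℚₚ.*-assoc c (w (suc a)) (qpow (suc a ℕ.* suc x) n)))
    (Σ<-*ˡ n c _)))
  (Σ<-*ˡ n c _)

Quad : (ℕ → ℕ → ℚ) → FPS
Quad h n = Σ< n λ a → Σ< n λ b → Σ< n λ x → Σ< n λ y →
  h (suc a) (suc b) * qpow (suc a ℕ.* suc x ℕ.+ suc b ℕ.* suc y) n

Quad-cong : ∀ h h′ → (∀ a b → h (suc a) (suc b) ≡ h′ (suc a) (suc b)) → Quad h ≐ Quad h′
Quad-cong h h′ h≗h′ n = Σ<-cong n λ a _ → Σ<-cong n λ b _ → Σ<-cong n λ x _ → Σ<-cong n λ y _ →
  cong (_* qpow (suc a ℕ.* suc x ℕ.+ suc b ℕ.* suc y) n) (h≗h′ a b)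

Quad-+ : ∀ h h′ → Quad (λ a b → h a b + h′ a b) ≐ Quad h ⊕ Quad h′
Quad-+ h h′ n = trans (Σ<-cong n λ a _ → trans (Σ<-cong n λ b _ → trans (Σ<-cong n λ x _ → trans (Σ<-cong n λ y _ →
  ℚₚ.*-distribʳ-+ (qpow (suc a ℕ.* suc x ℕ.+ suc b ℕ.* suc y) n) (h (suc a) (suc b)) (h′ (suc a) (suc b)))
  (Σ<-+ n _ _)) (Σ<-+ n _ _)) (Σ<-+ n _ _)) (Σ<-+ n _ _)

Quad-· : ∀ c h → Quad (λ a b → c * h a b) ≐ c · Quad h
Quad-· c h n = trans (Σ<-cong n λ a _ → trans (Σ<-cong n λ b _ → trans (Σ<-cong n λ x _ → trans (Σ<-cong n λ y _ →
  ℚₚ.*-assoc c (h (suc a) (suc b)) (qpow (suc a ℕ.* suc x ℕ.+ suc b ℕ.* suc y) n))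
  (Σ<-*ˡ n c _)) (Σ<-*ˡ n c _)) (Σ<-*ˡ n c _)) (Σ<-*ˡ n c _)

Σ<-⊛ : ∀ N (F : ℕ → FPS) g n → ((λ k → Σ< N (λ a → F a k)) ⊛ g) n ≡ Σ< N (λ a → (F a ⊛ g) n)
Σ<-⊛ N F g n = begin
  ((λ k → Σ< N (λ a → F a k)) ⊛ g) n                             ≡⟨ ⊛≡Σ< (λ k → Σ< N (λ a → F a k)) g n ⟩
  Σ< (suc n) (λ k → Σ< N (λ a → F a k) * g (n ∸ k))
    ≡⟨ Σ<-cong (suc n) (λ k _ → Σ<-*ʳ N (g (n ∸ k)) (λ a → F a k)) ⟨
  Σ< (suc n) (λ k → Σ< N (λ a → F a k * g (n ∸ k)))              ≡⟨ Σ<-comm (suc n) N _ ⟩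
  Σ< N (λ a → Σ< (suc n) (λ k → F a k * g (n ∸ k)))              ≡⟨ Σ<-cong N (λ a _ → ⊛≡Σ< (F a) g n) ⟨
  Σ< N (λ a → (F a ⊛ g) n) ∎

⊛-Σ< : ∀ N f (G : ℕ → FPS) n → (f ⊛ (λ k → Σ< N (λ a → G a k))) n ≡ Σ< N (λ a → (f ⊛ G a) n)
⊛-Σ< N f G n = trans (⊛-comm f (λ k → Σ< N (λ a → G a k)) n) (trans (Σ<-⊛ N G f n) (Σ<-cong N (λ a _ → ⊛-comm (G a) f n)))

⊛-· : ∀ c f g → f ⊛ (c · g) ≐ c · (f ⊛ g)
⊛-· c f g n = trans (⊛-comm f (c · g) n) (trans (·-⊛ c g f n) (cong (c *_) (⊛-comm g f n)))

Lam-⊛-Lam : ∀ v w → Lam v ⊛ Lam w ≐ Quad (λ a b → v a * w b)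
Lam-⊛-Lam v w n = begin
  (Lam v ⊛ Lam w) n
    ≡⟨ ⊛-congₙ n (λ k k≤n → Lam-extend v k n n k≤n k≤n) (λ k k≤n → Lam-extend w k n n k≤n k≤n) ⟩
  ((λ k → Σ< n λ a → V′ a k) ⊛ (λ k → Σ< n λ b → W′ b k)) n
    ≡⟨ trans (Σ<-⊛ n V′ (λ k → Σ< n λ b → W′ b k) n) (Σ<-cong n λ a _ → ⊛-Σ< n (V′ a) W′ n) ⟩
  (Σ< n λ a → Σ< n λ b → (V′ a ⊛ W′ b) n)
    ≡⟨ (Σ<-cong n λ a _ → Σ<-cong n λ b _ →
         trans (Σ<-⊛ n (V a) (W′ b) n) (Σ<-cong n λ x _ → ⊛-Σ< n (V a x) (W b) n)) ⟩
  (Σ< n λ a → Σ< n λ b → Σ< n λ x → Σ< n λ y → (V a x ⊛ W b y) n)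
    ≡⟨ (Σ<-cong n λ a _ → Σ<-cong n λ b _ → Σ<-cong n λ x _ → Σ<-cong n λ y _ → monomials a b x y) ⟩
  Quad (λ a b → v a * w b) n ∎
  where
  V W : ℕ → ℕ → FPS
  V a x = v (suc a) · qpow (suc a ℕ.* suc x)
  W b y = w (suc b) · qpow (suc b ℕ.* suc y)
  V′ W′ : ℕ → FPS
  V′ a k = Σ< n λ x → V a x k
  W′ b k = Σ< n λ y → W b y k
  monomials : ∀ a b x y → (V a x ⊛ W b y) n
    ≡ v (suc a) * w (suc b) * qpow (suc a ℕ.* suc x ℕ.+ suc b ℕ.* suc y) n
  monomials a b x y = begin
    (V a x ⊛ W b y) n
      ≡⟨ ·-⊛ (v (suc a)) (qpow (suc a ℕ.* suc x)) (W b y) n ⟩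
    v (suc a) * (qpow (suc a ℕ.* suc x) ⊛ W b y) n
      ≡⟨ cong (v (suc a) *_) (⊛-· (w (suc b)) (qpow (suc a ℕ.* suc x)) (qpow (suc b ℕ.* suc y)) n) ⟩
    v (suc a) * (w (suc b) * (qpow (suc a ℕ.* suc x) ⊛ qpow (suc b ℕ.* suc y)) n)
      ≡⟨ cong (λ c → v (suc a) * (w (suc b) * c)) (qpow-+ (suc a ℕ.* suc x) (suc b ℕ.* suc y) n) ⟩
    v (suc a) * (w (suc b) * qpow (suc a ℕ.* suc x ℕ.+ suc b ℕ.* suc y) n)
      ≡⟨ ℚₚ.*-assoc (v (suc a)) (w (suc b)) _ ⟨
    v (suc a) * w (suc b) * qpow (suc a ℕ.* suc x ℕ.+ suc b ℕ.* suc y) n ∎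

conv : (ℕ → ℕ → ℚ) → ℕ → ℚ
conv h d = Σ< (d ∸ 1) (λ k → h (suc k) (d ∸ suc k))

Σ<-comm₂₂ : ∀ n (f : ℕ → ℕ → ℕ → ℕ → ℚ)
  → (Σ< n λ a → Σ< n λ b → Σ< n λ x → Σ< n λ y → f a b x y)
    ≡ (Σ< n λ x → Σ< n λ y → Σ< n λ a → Σ< n λ b → f a b x y)
Σ<-comm₂₂ n f = begin
  (Σ< n λ a → Σ< n λ b → Σ< n λ x → Σ< n λ y → f a b x y)
    ≡⟨ (Σ<-cong n λ a _ → Σ<-comm n n λ b x → Σ< n λ y → f a b x y) ⟩
  (Σ< n λ a → Σ< n λ x → Σ< n λ b → Σ< n λ y → f a b x y)
    ≡⟨ Σ<-comm n n (λ a x → Σ< n λ b → Σ< n λ y → f a b x y) ⟩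
  (Σ< n λ x → Σ< n λ a → Σ< n λ b → Σ< n λ y → f a b x y)
    ≡⟨ (Σ<-cong n λ x _ → Σ<-cong n λ a _ → Σ<-comm n n λ b y → f a b x y) ⟩
  (Σ< n λ x → Σ< n λ a → Σ< n λ y → Σ< n λ b → f a b x y)
    ≡⟨ (Σ<-cong n λ x _ → Σ<-comm n n λ a y → Σ< n λ b → f a b x y) ⟩
  (Σ< n λ x → Σ< n λ y → Σ< n λ a → Σ< n λ b → f a b x y) ∎

-- (x, y) ↦ (x - y, y) or (x, y - x) for h⁺ and the same step on (a, b) for h⁻ produce the same
-- off-diagonal terms S₁ and S₂.
module Euclid (h⁺ h⁻ : ℕ → ℕ → ℚ)
  (stepʳ : ∀ a b → h⁻ (suc a) (suc (suc (a ℕ.+ b))) ≡ h⁺ (suc a) (suc b))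
  (stepˡ : ∀ a b → h⁻ (suc (suc (a ℕ.+ b))) (suc a) ≡ h⁺ (suc b) (suc a))
  (n : ℕ)
  where

  term : ℚ → ℕ → ℚ
  term c m = c * qpow m n

  D⁺ D⁻ S₁ S₂ : ℚ
  D⁺ = Σ< n λ a → Σ< n λ b → Σ< n λ x → term (h⁺ (suc a) (suc b)) (suc (suc (a ℕ.+ b)) ℕ.* suc x)
  D⁻ = Σ< n λ a → Σ< n λ x → Σ< n λ y → term (h⁻ (suc a) (suc a)) (suc a ℕ.* suc (suc (x ℕ.+ y)))
  S₁ = Σ< n λ a → Σ< n λ b → Σ< n λ x → Σ< n λ y →
    term (h⁺ (suc a) (suc b)) (suc a ℕ.* suc x ℕ.+ suc (suc (a ℕ.+ b)) ℕ.* suc y)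
  S₂ = Σ< n λ a → Σ< n λ b → Σ< n λ x → Σ< n λ y →
    term (h⁺ (suc a) (suc b)) (suc (suc (a ℕ.+ b)) ℕ.* suc x ℕ.+ suc b ℕ.* suc y)

  vanishˡ : ∀ c a b x y → n ≤ a ⊎ n ≤ x → term c (suc a ℕ.* suc x ℕ.+ suc b ℕ.* suc y) ≡ 0ℚ
  vanishˡ c a b x y p = *qpow-< c _ n (ℕₚ.≤-trans (<suc*suc a x p) (ℕₚ.m≤m+n _ _))

  vanishʳ : ∀ c a b x y → n ≤ b ⊎ n ≤ y → term c (suc a ℕ.* suc x ℕ.+ suc b ℕ.* suc y) ≡ 0ℚ
  vanishʳ c a b x y p = *qpow-< c _ n (ℕₚ.≤-trans (<suc*suc b y p) (ℕₚ.m≤n+m _ (suc a ℕ.* suc x)))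

  split⁺ : Quad h⁺ n ≡ S₁ + (D⁺ + S₂)
  split⁺ = begin
    Quad h⁺ n
      ≡⟨ (Σ<-cong n λ a _ → Σ<-cong n λ b _ → inner a b) ⟩
    (Σ< n λ a → Σ< n λ b → s₁ a b + (d⁺ a b + s₂ a b))
      ≡⟨ (Σ<-cong n λ a _ → trans (Σ<-+ n (s₁ a) (λ b → d⁺ a b + s₂ a b)) (cong (Σ< n (s₁ a) +_) (Σ<-+ n (d⁺ a) (s₂ a)))) ⟩
    (Σ< n λ a → Σ< n (s₁ a) + (Σ< n (d⁺ a) + Σ< n (s₂ a)))
      ≡⟨ trans (Σ<-+ n (λ a → Σ< n (s₁ a)) (λ a → Σ< n (d⁺ a) + Σ< n (s₂ a))) (cong (S₁ +_) (Σ<-+ n (λ a → Σ< n (d⁺ a)) (λ a → Σ< n (s₂ a)))) ⟩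
    S₁ + (D⁺ + S₂) ∎
    where
    s₁ d⁺ s₂ : ℕ → ℕ → ℚ
    s₁ a b = Σ< n λ x → Σ< n λ y → term (h⁺ (suc a) (suc b)) (suc a ℕ.* suc x ℕ.+ suc (suc (a ℕ.+ b)) ℕ.* suc y)
    d⁺ a b = Σ< n λ x → term (h⁺ (suc a) (suc b)) (suc (suc (a ℕ.+ b)) ℕ.* suc x)
    s₂ a b = Σ< n λ x → Σ< n λ y → term (h⁺ (suc a) (suc b)) (suc (suc (a ℕ.+ b)) ℕ.* suc x ℕ.+ suc b ℕ.* suc y)
    e₁ : ∀ a b x y → suc a ℕ.* suc (suc (y ℕ.+ x)) ℕ.+ suc b ℕ.* suc y ≡ suc a ℕ.* suc x ℕ.+ suc (suc (a ℕ.+ b)) ℕ.* suc y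
    e₁ = ℕSolver.solve-∀
    e₂ : ∀ a b x → suc a ℕ.* suc x ℕ.+ suc b ℕ.* suc x ≡ suc (suc (a ℕ.+ b)) ℕ.* suc x
    e₂ = ℕSolver.solve-∀
    e₃ : ∀ a b x y → suc a ℕ.* suc x ℕ.+ suc b ℕ.* suc (suc (x ℕ.+ y)) ≡ suc (suc (a ℕ.+ b)) ℕ.* suc x ℕ.+ suc b ℕ.* suc y
    e₃ = ℕSolver.solve-∀
    inner : ∀ a b → (Σ< n λ x → Σ< n λ y → term (h⁺ (suc a) (suc b)) (suc a ℕ.* suc x ℕ.+ suc b ℕ.* suc y))
      ≡ s₁ a b + (d⁺ a b + s₂ a b)
    inner a b = trans
      (Σ<-trichotomy n (λ x y → term c (suc a ℕ.* suc x ℕ.+ suc b ℕ.* suc y))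
        (λ x y n≤x → vanishˡ c a b x y (inj₂ n≤x)) (λ x y n≤y → vanishʳ c a b x y (inj₂ n≤y)))
      (cong₂ _+_
        (trans (Σ<-comm n n _) (Σ<-cong n λ x _ → Σ<-cong n λ y _ → cong (term c) (e₁ a b x y)))
        (cong₂ _+_ (Σ<-cong n λ x _ → cong (term c) (e₂ a b x))
          (Σ<-cong n λ x _ → Σ<-cong n λ y _ → cong (term c) (e₃ a b x y))))
      where
      c : ℚ
      c = h⁺ (suc a) (suc b)

  split⁻ : Quad h⁻ n ≡ S₂ + (D⁻ + S₁)
  split⁻ = begin
    Quad h⁻ n
      -- Here the Euclidean step acts on (a, b) for fixed (x, y), so the multiplicities are moved
      -- outermost.
      ≡⟨ Σ<-comm₂₂ n (λ a b x y → term (h⁻ (suc a) (suc b)) (suc a ℕ.* suc x ℕ.+ suc b ℕ.* suc y)) ⟩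
    (Σ< n λ x → Σ< n λ y → Σ< n λ a → Σ< n λ b → term (h⁻ (suc a) (suc b)) (suc a ℕ.* suc x ℕ.+ suc b ℕ.* suc y))
      ≡⟨ (Σ<-cong n λ x _ → Σ<-cong n λ y _ → inner x y) ⟩
    (Σ< n λ x → Σ< n λ y → s₂ x y + (d⁻ x y + s₁ x y))
      ≡⟨ (Σ<-cong n λ x _ → trans (Σ<-+ n (s₂ x) (λ y → d⁻ x y + s₁ x y)) (cong (Σ< n (s₂ x) +_) (Σ<-+ n (d⁻ x) (s₁ x)))) ⟩
    (Σ< n λ x → Σ< n (s₂ x) + (Σ< n (d⁻ x) + Σ< n (s₁ x)))
      ≡⟨ trans (Σ<-+ n (λ x → Σ< n (s₂ x)) (λ x → Σ< n (d⁻ x) + Σ< n (s₁ x)))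
           (cong ((Σ< n λ x → Σ< n (s₂ x)) +_) (Σ<-+ n (λ x → Σ< n (d⁻ x)) (λ x → Σ< n (s₁ x)))) ⟩
    (Σ< n λ x → Σ< n (s₂ x)) + ((Σ< n λ x → Σ< n (d⁻ x)) + (Σ< n λ x → Σ< n (s₁ x)))
      ≡⟨ cong₂ _+_ (Σ<-comm₂₂ n _) (cong₂ _+_
           (trans (Σ<-cong n λ x _ → Σ<-comm n n _) (Σ<-comm n n _)) (Σ<-comm₂₂ n _)) ⟩
    S₂ + (D⁻ + S₁) ∎
    where
    s₁ d⁻ s₂ : ℕ → ℕ → ℚ
    s₁ x y = Σ< n λ a → Σ< n λ b → term (h⁺ (suc a) (suc b)) (suc a ℕ.* suc x ℕ.+ suc (suc (a ℕ.+ b)) ℕ.* suc y)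
    d⁻ x y = Σ< n λ a → term (h⁻ (suc a) (suc a)) (suc a ℕ.* suc (suc (x ℕ.+ y)))
    s₂ x y = Σ< n λ a → Σ< n λ b → term (h⁺ (suc a) (suc b)) (suc (suc (a ℕ.+ b)) ℕ.* suc x ℕ.+ suc b ℕ.* suc y)
    e₁ : ∀ a b x y → suc (suc (b ℕ.+ a)) ℕ.* suc x ℕ.+ suc b ℕ.* suc y ≡ suc (suc (a ℕ.+ b)) ℕ.* suc x ℕ.+ suc b ℕ.* suc y
    e₁ = ℕSolver.solve-∀
    e₂ : ∀ a x y → suc a ℕ.* suc x ℕ.+ suc a ℕ.* suc y ≡ suc a ℕ.* suc (suc (x ℕ.+ y))
    e₂ = ℕSolver.solve-∀
    inner : ∀ x y → (Σ< n λ a → Σ< n λ b → term (h⁻ (suc a) (suc b)) (suc a ℕ.* suc x ℕ.+ suc b ℕ.* suc y))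
      ≡ s₂ x y + (d⁻ x y + s₁ x y)
    inner x y = trans
      (Σ<-trichotomy n (λ a b → term (h⁻ (suc a) (suc b)) (suc a ℕ.* suc x ℕ.+ suc b ℕ.* suc y))
        (λ a b n≤a → vanishˡ (h⁻ (suc a) (suc b)) a b x y (inj₁ n≤a))
        (λ a b n≤b → vanishʳ (h⁻ (suc a) (suc b)) a b x y (inj₁ n≤b)))
      (cong₂ _+_
        (trans (Σ<-comm n n _) (Σ<-cong n λ a _ → Σ<-cong n λ b _ → cong₂ term (stepˡ b a) (e₁ a b x y)))
        (cong₂ _+_ (Σ<-cong n λ a _ → cong (term (h⁻ (suc a) (suc a))) (e₂ a x y))
          (Σ<-cong n λ a _ → Σ<-cong n λ b _ → cong (λ c → term c (suc a ℕ.* suc x ℕ.+ suc (suc (a ℕ.+ b)) ℕ.* suc y)) (stepʳ a b))))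

  difference : Quad h⁺ n + D⁻ ≡ Quad h⁻ n + D⁺
  difference = begin
    Quad h⁺ n + D⁻            ≡⟨ cong (_+ D⁻) split⁺ ⟩
    S₁ + (D⁺ + S₂) + D⁻       ≡⟨ solve 4 (λ s t d e → s :+ (d :+ t) :+ e := t :+ (e :+ s) :+ d) refl S₁ S₂ D⁺ D⁻ ⟩
    S₂ + (D⁻ + S₁) + D⁺       ≡⟨ cong (_+ D⁺) split⁻ ⟨
    Quad h⁻ n + D⁺ ∎

  diagonal⁺ : D⁺ ≡ Lam (conv h⁺) n
  diagonal⁺ = begin
    D⁺
      ≡⟨ (Σ<-cong n λ a _ → Σ<-cong n λ b _ → Σ<-cong n λ x _ →
           cong (λ i → term (h⁺ (suc a) i) (suc (suc (a ℕ.+ b)) ℕ.* suc x)) (sym (minus a b))) ⟩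
    (Σ< n λ a → Σ< n λ b → G (suc (a ℕ.+ b)) a)
      ≡⟨ Σ<-triangle n G (λ c a n≤c → Σ<-0 n λ x _ → *qpow-< (h⁺ (suc a) (c ∸ a)) _ n (<suc*suc c x (inj₁ n≤c))) ⟩
    (Σ< n λ c → Σ< c λ a → Σ< n λ x → term (h⁺ (suc a) (c ∸ a)) (suc c ℕ.* suc x))
      ≡⟨ (Σ<-cong n λ c _ → Σ<-comm c n _) ⟩
    (Σ< n λ c → Σ< n λ x → Σ< c λ a → term (h⁺ (suc a) (c ∸ a)) (suc c ℕ.* suc x))
      ≡⟨ (Σ<-cong n λ c _ → Σ<-cong n λ x _ → Σ<-*ʳ c (qpow (suc c ℕ.* suc x) n) (λ a → h⁺ (suc a) (c ∸ a))) ⟩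
    Lam (conv h⁺) n ∎
    where
    G : ℕ → ℕ → ℚ
    G c a = Σ< n λ x → term (h⁺ (suc a) (c ∸ a)) (suc c ℕ.* suc x)
    minus : ∀ a b → suc (a ℕ.+ b) ∸ a ≡ suc b
    minus a b = trans (cong (_∸ a) (sym (ℕₚ.+-suc a b))) (ℕₚ.m+n∸m≡n a (suc b))

  -- A cofactor z = n/a has z - 1 decompositions into two positive parts. The weight aκ(a) turns
  -- this count into (az - a)κ(a) = nκ(a) - aκ(a), and the factor n is exactly what `θ` produces.
  diagonal⁻ : ∀ (κ : ℕ → ℚ) → (∀ d → h⁻ (suc d) (suc d) ≡ ℕ→ℚ (suc d) * κ (suc d))
    → D⁻ ≡ (θ (Lam κ) ⊕ ⊝ Lam (λ d → ℕ→ℚ d * κ d)) n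
  diagonal⁻ κ h⁻≡dκ = begin
    D⁻
      ≡⟨ (Σ<-cong n λ a _ → Σ<-triangle n (G a) λ z x n≤z → *qpow-< (h⁻ (suc a) (suc a)) _ n (<suc*suc a z (inj₂ n≤z))) ⟩
    (Σ< n λ a → Σ< n λ z → Σ< z λ x → term (h⁻ (suc a) (suc a)) (suc a ℕ.* suc z))
      ≡⟨ (Σ<-cong n λ a _ → Σ<-cong n λ z _ → summand a z) ⟩
    (Σ< n λ a → Σ< n λ z → ℕ→ℚ n * t₁ a z + (- 1ℚ) * t₂ a z)
      ≡⟨ trans (Σ<-cong n λ a _ → Σ<-+ n (λ z → ℕ→ℚ n * t₁ a z) (λ z → (- 1ℚ) * t₂ a z)) (Σ<-+ n _ _) ⟩
    (Σ< n λ a → Σ< n λ z → ℕ→ℚ n * t₁ a z) + (Σ< n λ a → Σ< n λ z → (- 1ℚ) * t₂ a z)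
      ≡⟨ cong₂ _+_
           (trans (Σ<-cong n λ a _ → Σ<-*ˡ n (ℕ→ℚ n) (t₁ a)) (Σ<-*ˡ n (ℕ→ℚ n) (λ a → Σ< n (t₁ a))))
           (trans (Σ<-cong n λ a _ → Σ<-*ˡ n (- 1ℚ) (t₂ a)) (Σ<-*ˡ n (- 1ℚ) (λ a → Σ< n (t₂ a)))) ⟩
    ℕ→ℚ n * Lam κ n + (- 1ℚ) * Lam (λ d → ℕ→ℚ d * κ d) n
      ≡⟨ cong (ℕ→ℚ n * Lam κ n +_) (trans (sym (ℚₚ.neg-distribˡ-* 1ℚ (Lam (λ d → ℕ→ℚ d * κ d) n))) (cong -_ (ℚₚ.*-identityˡ (Lam (λ d → ℕ→ℚ d * κ d) n)))) ⟩
    (θ (Lam κ) ⊕ ⊝ Lam (λ d → ℕ→ℚ d * κ d)) n ∎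
    where
    G : ℕ → ℕ → ℕ → ℚ
    G a z x = term (h⁻ (suc a) (suc a)) (suc a ℕ.* suc z)
    t₁ t₂ : ℕ → ℕ → ℚ
    t₁ a z = term (κ (suc a)) (suc a ℕ.* suc z)
    t₂ a z = term (ℕ→ℚ (suc a) * κ (suc a)) (suc a ℕ.* suc z)
    on-support : ∀ m → ℕ→ℚ m * qpow m n ≡ ℕ→ℚ n * qpow m n
    on-support m = sym (θ-qpow m n)
    summand : ∀ a z → (Σ< z λ x → term (h⁻ (suc a) (suc a)) (suc a ℕ.* suc z))
      ≡ ℕ→ℚ n * t₁ a z + (- 1ℚ) * t₂ a z
    summand a z = begin
      (Σ< z λ x → term (h⁻ (suc a) (suc a)) (suc a ℕ.* suc z))
        ≡⟨ Σ<-const z (term (h⁻ (suc a) (suc a)) m) ⟩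
      ℕ→ℚ z * (h⁻ (suc a) (suc a) * qpow m n)
        ≡⟨ cong (λ c → ℕ→ℚ z * (c * qpow m n)) (h⁻≡dκ a) ⟩
      ℕ→ℚ z * (A * κ (suc a) * qpow m n)
        ≡⟨ solve 4 (λ z a k q → z :* (a :* k :* q) := k :* (a :* (con 1ℚ :+ z) :* q) :+ con (- 1ℚ) :* (a :* k :* q)) refl
             (ℕ→ℚ z) A (κ (suc a)) (qpow m n) ⟩
      κ (suc a) * (A * (1ℚ + ℕ→ℚ z) * qpow m n) + (- 1ℚ) * (A * κ (suc a) * qpow m n)
        ≡⟨ cong (λ c → κ (suc a) * c + (- 1ℚ) * (A * κ (suc a) * qpow m n)) (trans
             (cong (_* qpow m n) (trans (cong (A *_) (sym (ℕ→ℚ-+ 1 z))) (sym (ℕ→ℚ-* (suc a) (suc z)))))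
             (on-support m)) ⟩
      κ (suc a) * (ℕ→ℚ n * qpow m n) + (- 1ℚ) * (A * κ (suc a) * qpow m n)
        ≡⟨ cong (_+ (- 1ℚ) * (A * κ (suc a) * qpow m n))
             (solve 3 (λ k n q → k :* (n :* q) := n :* (k :* q)) refl (κ (suc a)) (ℕ→ℚ n) (qpow m n)) ⟩
      ℕ→ℚ n * (κ (suc a) * qpow m n) + (- 1ℚ) * (A * κ (suc a) * qpow m n) ∎
      where
      m : ℕ
      m = suc a ℕ.* suc z
      A : ℚ
      A = ℕ→ℚ (suc a)

-- Quasi-polynomials modulo 5

module Z = ℤSolver.+-*-Solver

-- Recursion in steps of five makes `res (5 + n)` and `res n` definitionally equal, so that a
-- difference with step 5 acts on the polynomial of a residue class alone.
res : ℕ → Fin 5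
res 0 = 0F
res 1 = 1F
res 2 = 2F
res 3 = 3F
res 4 = 4F
res (suc (suc (suc (suc (suc n))))) = res n

infixl 6 _⊞_
_⊞_ : Fin 5 → Fin 5 → Fin 5
x ⊞ y = res (toℕ x ℕ.+ toℕ y)

neg : Fin 5 → Fin 5
neg x = res (5 ∸ toℕ x)

res-+ˡ : ∀ m n → res (m ℕ.+ n) ≡ res (toℕ (res m) ℕ.+ n)
res-+ˡ 0 n = refl
res-+ˡ 1 n = refl
res-+ˡ 2 n = refl
res-+ˡ 3 n = refl
res-+ˡ 4 n = refl
res-+ˡ (suc (suc (suc (suc (suc m))))) n = res-+ˡ m n

res-+ : ∀ m n → res (m ℕ.+ n) ≡ res m ⊞ res n
res-+ m n = begin
  res (m ℕ.+ n)                 ≡⟨ res-+ˡ m n ⟩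
  res (toℕ (res m) ℕ.+ n)       ≡⟨ cong res (ℕₚ.+-comm (toℕ (res m)) n) ⟩
  res (n ℕ.+ toℕ (res m))       ≡⟨ res-+ˡ n (toℕ (res m)) ⟩
  res (toℕ (res n) ℕ.+ toℕ (res m)) ≡⟨ cong res (ℕₚ.+-comm (toℕ (res n)) (toℕ (res m))) ⟩
  res m ⊞ res n ∎

-- The coefficients of 1, a, b, a², ab, b².
Form : Set
Form = Vec ℤ 6

⟦_⟧ : Form → ℤ → ℤ → ℤ
⟦ c ∷ c₁ ∷ c₂ ∷ c₁₁ ∷ c₁₂ ∷ c₂₂ ∷ [] ⟧ a b =
  c ℤ.+ c₁ ℤ.* a ℤ.+ c₂ ℤ.* b ℤ.+ c₁₁ ℤ.* (a ℤ.* a) ℤ.+ c₁₂ ℤ.* (a ℤ.* b) ℤ.+ c₂₂ ℤ.* (b ℤ.* b)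

formₚ : ∀ {n} → (c c₁ c₂ c₁₁ c₁₂ c₂₂ a b : Z.Polynomial n) → Z.Polynomial n
formₚ c c₁ c₂ c₁₁ c₁₂ c₂₂ a b =
  c Z.:+ c₁ Z.:* a Z.:+ c₂ Z.:* b Z.:+ c₁₁ Z.:* (a Z.:* a) Z.:+ c₁₂ Z.:* (a Z.:* b) Z.:+ c₂₂ Z.:* (b Z.:* b)

infixl 6 _+ᶠ_
infixl 7 _*ᶠ_
_+ᶠ_ : Form → Form → Form
_+ᶠ_ = Vec.zipWith ℤ._+_

_*ᶠ_ : ℤ → Form → Form
k *ᶠ f = Vec.map (k ℤ.*_) f

0ᶠ : Form
0ᶠ = Vec.replicate 6 ℤ.0ℤ

⟦0ᶠ⟧ : ∀ a b → ⟦ 0ᶠ ⟧ a b ≡ ℤ.0ℤ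
⟦0ᶠ⟧ a b = Z.solve 2 (λ a b → formₚ 𝟎 𝟎 𝟎 𝟎 𝟎 𝟎 a b Z.:= 𝟎) refl a b
  where
  𝟎 : Z.Polynomial 2
  𝟎 = Z.con ℤ.0ℤ

⟦+ᶠ⟧ : ∀ f g a b → ⟦ f +ᶠ g ⟧ a b ≡ ⟦ f ⟧ a b ℤ.+ ⟦ g ⟧ a b
⟦+ᶠ⟧ (c ∷ c₁ ∷ c₂ ∷ c₁₁ ∷ c₁₂ ∷ c₂₂ ∷ []) (d ∷ d₁ ∷ d₂ ∷ d₁₁ ∷ d₁₂ ∷ d₂₂ ∷ []) a b =
  Z.solve 14 (λ c c₁ c₂ c₁₁ c₁₂ c₂₂ d d₁ d₂ d₁₁ d₁₂ d₂₂ a b →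
    formₚ (c Z.:+ d) (c₁ Z.:+ d₁) (c₂ Z.:+ d₂) (c₁₁ Z.:+ d₁₁) (c₁₂ Z.:+ d₁₂) (c₂₂ Z.:+ d₂₂) a b
    Z.:= (formₚ c c₁ c₂ c₁₁ c₁₂ c₂₂ a b Z.:+ formₚ d d₁ d₂ d₁₁ d₁₂ d₂₂ a b)) refl
    c c₁ c₂ c₁₁ c₁₂ c₂₂ d d₁ d₂ d₁₁ d₁₂ d₂₂ a b

⟦*ᶠ⟧ : ∀ k f a b → ⟦ k *ᶠ f ⟧ a b ≡ k ℤ.* ⟦ f ⟧ a b
⟦*ᶠ⟧ k (c ∷ c₁ ∷ c₂ ∷ c₁₁ ∷ c₁₂ ∷ c₂₂ ∷ []) a b =
  Z.solve 9 (λ k c c₁ c₂ c₁₁ c₁₂ c₂₂ a b →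
    formₚ (k Z.:* c) (k Z.:* c₁) (k Z.:* c₂) (k Z.:* c₁₁) (k Z.:* c₁₂) (k Z.:* c₂₂) a b
    Z.:= k Z.:* formₚ c c₁ c₂ c₁₁ c₁₂ c₂₂ a b) refl k c c₁ c₂ c₁₁ c₁₂ c₂₂ a b

-- Substitutions carried out on coefficient vectors: b ↦ -b, b ↦ -(a + b) and (a, b) ↦ (a + b, -b).
-- Symmetries of p thereby become decidable equalities of vectors. `Δ₁` and `Δ₂` are the differences
-- with step 5 in either variable; each lowers the degree.
reflect shearʳ shearˡ Δ₁ Δ₂ : Form → Form
reflect (c ∷ c₁ ∷ c₂ ∷ c₁₁ ∷ c₁₂ ∷ c₂₂ ∷ []) = c ∷ c₁ ∷ ℤ.- c₂ ∷ c₁₁ ∷ ℤ.- c₁₂ ∷ c₂₂ ∷ []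
shearʳ (c ∷ c₁ ∷ c₂ ∷ c₁₁ ∷ c₁₂ ∷ c₂₂ ∷ []) =
  c ∷ c₁ ℤ.- c₂ ∷ ℤ.- c₂ ∷ c₁₁ ℤ.- c₁₂ ℤ.+ c₂₂ ∷ c₂₂ ℤ.+ c₂₂ ℤ.- c₁₂ ∷ c₂₂ ∷ []
shearˡ (c ∷ c₁ ∷ c₂ ∷ c₁₁ ∷ c₁₂ ∷ c₂₂ ∷ []) =
  c ∷ c₁ ∷ c₁ ℤ.- c₂ ∷ c₁₁ ∷ c₁₁ ℤ.+ c₁₁ ℤ.- c₁₂ ∷ c₁₁ ℤ.- c₁₂ ℤ.+ c₂₂ ∷ []
Δ₁ (c ∷ c₁ ∷ c₂ ∷ c₁₁ ∷ c₁₂ ∷ c₂₂ ∷ []) =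
  ℤ.+ 5 ℤ.* c₁ ℤ.+ ℤ.+ 25 ℤ.* c₁₁ ∷ ℤ.+ 10 ℤ.* c₁₁ ∷ ℤ.+ 5 ℤ.* c₁₂ ∷ ℤ.0ℤ ∷ ℤ.0ℤ ∷ ℤ.0ℤ ∷ []
Δ₂ (c ∷ c₁ ∷ c₂ ∷ c₁₁ ∷ c₁₂ ∷ c₂₂ ∷ []) =
  ℤ.+ 5 ℤ.* c₂ ℤ.+ ℤ.+ 25 ℤ.* c₂₂ ∷ ℤ.+ 5 ℤ.* c₁₂ ∷ ℤ.+ 10 ℤ.* c₂₂ ∷ ℤ.0ℤ ∷ ℤ.0ℤ ∷ ℤ.0ℤ ∷ []

⟦reflect⟧ : ∀ f a b → ⟦ reflect f ⟧ a b ≡ ⟦ f ⟧ a (ℤ.- b)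
⟦reflect⟧ (c ∷ c₁ ∷ c₂ ∷ c₁₁ ∷ c₁₂ ∷ c₂₂ ∷ []) a b =
  Z.solve 8 (λ c c₁ c₂ c₁₁ c₁₂ c₂₂ a b →
    formₚ c c₁ (Z.:- c₂) c₁₁ (Z.:- c₁₂) c₂₂ a b Z.:= formₚ c c₁ c₂ c₁₁ c₁₂ c₂₂ a (Z.:- b))
    refl c c₁ c₂ c₁₁ c₁₂ c₂₂ a b

⟦shearʳ⟧ : ∀ f a b → ⟦ shearʳ f ⟧ a b ≡ ⟦ f ⟧ a (ℤ.- (a ℤ.+ b))
⟦shearʳ⟧ (c ∷ c₁ ∷ c₂ ∷ c₁₁ ∷ c₁₂ ∷ c₂₂ ∷ []) a b =
  Z.solve 8 (λ c c₁ c₂ c₁₁ c₁₂ c₂₂ a b →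
    formₚ c (c₁ Z.:- c₂) (Z.:- c₂) (c₁₁ Z.:- c₁₂ Z.:+ c₂₂) (c₂₂ Z.:+ c₂₂ Z.:- c₁₂) c₂₂ a b
    Z.:= formₚ c c₁ c₂ c₁₁ c₁₂ c₂₂ a (Z.:- (a Z.:+ b)))
    refl c c₁ c₂ c₁₁ c₁₂ c₂₂ a b

⟦shearˡ⟧ : ∀ f a b → ⟦ shearˡ f ⟧ a b ≡ ⟦ f ⟧ (a ℤ.+ b) (ℤ.- b)
⟦shearˡ⟧ (c ∷ c₁ ∷ c₂ ∷ c₁₁ ∷ c₁₂ ∷ c₂₂ ∷ []) a b =
  Z.solve 8 (λ c c₁ c₂ c₁₁ c₁₂ c₂₂ a b →
    formₚ c c₁ (c₁ Z.:- c₂) c₁₁ (c₁₁ Z.:+ c₁₁ Z.:- c₁₂) (c₁₁ Z.:- c₁₂ Z.:+ c₂₂) a b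
    Z.:= formₚ c c₁ c₂ c₁₁ c₁₂ c₂₂ (a Z.:+ b) (Z.:- b))
    refl c c₁ c₂ c₁₁ c₁₂ c₂₂ a b

⟦Δ₁⟧ : ∀ f a b → ⟦ Δ₁ f ⟧ a b ≡ ⟦ f ⟧ (ℤ.+ 5 ℤ.+ a) b ℤ.- ⟦ f ⟧ a b
⟦Δ₁⟧ (c ∷ c₁ ∷ c₂ ∷ c₁₁ ∷ c₁₂ ∷ c₂₂ ∷ []) a b =
  Z.solve 8 (λ c c₁ c₂ c₁₁ c₁₂ c₂₂ a b →
    formₚ (Z.con (ℤ.+ 5) Z.:* c₁ Z.:+ Z.con (ℤ.+ 25) Z.:* c₁₁) (Z.con (ℤ.+ 10) Z.:* c₁₁) (Z.con (ℤ.+ 5) Z.:* c₁₂)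
      (Z.con ℤ.0ℤ) (Z.con ℤ.0ℤ) (Z.con ℤ.0ℤ) a b
    Z.:= (formₚ c c₁ c₂ c₁₁ c₁₂ c₂₂ (Z.con (ℤ.+ 5) Z.:+ a) b Z.:- formₚ c c₁ c₂ c₁₁ c₁₂ c₂₂ a b))
    refl c c₁ c₂ c₁₁ c₁₂ c₂₂ a b

⟦Δ₂⟧ : ∀ f a b → ⟦ Δ₂ f ⟧ a b ≡ ⟦ f ⟧ a (ℤ.+ 5 ℤ.+ b) ℤ.- ⟦ f ⟧ a b
⟦Δ₂⟧ (c ∷ c₁ ∷ c₂ ∷ c₁₁ ∷ c₁₂ ∷ c₂₂ ∷ []) a b =
  Z.solve 8 (λ c c₁ c₂ c₁₁ c₁₂ c₂₂ a b →
    formₚ (Z.con (ℤ.+ 5) Z.:* c₂ Z.:+ Z.con (ℤ.+ 25) Z.:* c₂₂) (Z.con (ℤ.+ 5) Z.:* c₁₂) (Z.con (ℤ.+ 10) Z.:* c₂₂)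
      (Z.con ℤ.0ℤ) (Z.con ℤ.0ℤ) (Z.con ℤ.0ℤ) a b
    Z.:= (formₚ c c₁ c₂ c₁₁ c₁₂ c₂₂ a (Z.con (ℤ.+ 5) Z.:+ b) Z.:- formₚ c c₁ c₂ c₁₁ c₁₂ c₂₂ a b))
    refl c c₁ c₂ c₁₁ c₁₂ c₂₂ a b

Δ₁³ : ∀ f a b → ⟦ Δ₁ (Δ₁ (Δ₁ f)) ⟧ a b ≡ ℤ.0ℤ
Δ₁³ (c ∷ c₁ ∷ c₂ ∷ c₁₁ ∷ c₁₂ ∷ c₂₂ ∷ []) a b = ⟦0ᶠ⟧ a b

Δ₂³ : ∀ f a b → ⟦ Δ₂ (Δ₂ (Δ₂ f)) ⟧ a b ≡ ℤ.0ℤ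
Δ₂³ (c ∷ c₁ ∷ c₂ ∷ c₁₁ ∷ c₁₂ ∷ c₂₂ ∷ []) a b = ⟦0ᶠ⟧ a b

Δ⁵ : (ℕ → ℤ) → ℕ → ℤ
Δ⁵ f n = f (5 ℕ.+ n) ℤ.- f n

-- On every residue class mod 5 such a function is a polynomial of degree less than the index. The
-- formulation by iterated differences avoids exhibiting the polynomials.
data QuasiPoly : ℕ → (ℕ → ℤ) → Set where
  null : ∀ {f} → (∀ n → f n ≡ ℤ.0ℤ) → QuasiPoly 0 f
  step : ∀ {k f} → QuasiPoly k (Δ⁵ f) → QuasiPoly (suc k) f

QuasiPoly-resp : ∀ {k f g} → (∀ n → f n ≡ g n) → QuasiPoly k f → QuasiPoly k g
QuasiPoly-resp f≗g (null f≡0) = null λ n → trans (sym (f≗g n)) (f≡0 n)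
QuasiPoly-resp f≗g (step qf)  = step (QuasiPoly-resp (λ n → cong₂ ℤ._-_ (f≗g (5 ℕ.+ n)) (f≗g n)) qf)

QuasiPoly-suc : ∀ {k f} → QuasiPoly k f → QuasiPoly (suc k) f
QuasiPoly-suc (null f≡0) = step (null λ n → cong₂ ℤ._-_ (f≡0 (5 ℕ.+ n)) (f≡0 n))
QuasiPoly-suc (step qf)  = step (QuasiPoly-suc qf)

QuasiPoly-lift : ∀ j {k f} → QuasiPoly k f → QuasiPoly (j ℕ.+ k) f
QuasiPoly-lift zero    qf = qf
QuasiPoly-lift (suc j) qf = QuasiPoly-suc (QuasiPoly-lift j qf)

QuasiPoly-shift : ∀ s {k f} → QuasiPoly k f → QuasiPoly k (λ n → f (s ℕ.+ n))
QuasiPoly-shift s (null f≡0) = null λ n → f≡0 (s ℕ.+ n)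
QuasiPoly-shift s {f = f} (step qf) = step (QuasiPoly-resp
  (λ n → cong (λ m → f m ℤ.- f (s ℕ.+ n)) (shuffle n)) (QuasiPoly-shift s qf))
  where
  shuffle : ∀ n → 5 ℕ.+ (s ℕ.+ n) ≡ s ℕ.+ (5 ℕ.+ n)
  shuffle n = begin
    5 ℕ.+ (s ℕ.+ n)   ≡⟨ ℕₚ.+-assoc 5 s n ⟨
    5 ℕ.+ s ℕ.+ n     ≡⟨ cong (ℕ._+ n) (ℕₚ.+-comm 5 s) ⟩
    s ℕ.+ 5 ℕ.+ n     ≡⟨ ℕₚ.+-assoc s 5 n ⟩
    s ℕ.+ (5 ℕ.+ n) ∎

QuasiPoly-+ : ∀ {k f g} → QuasiPoly k f → QuasiPoly k g → QuasiPoly k (λ n → f n ℤ.+ g n)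
QuasiPoly-+ (null f≡0) (null g≡0) = null λ n → cong₂ ℤ._+_ (f≡0 n) (g≡0 n)
QuasiPoly-+ {f = f} {g} (step qf) (step qg) = step (QuasiPoly-resp
  (λ n → Z.solve 4 (λ a b c d → (a Z.:- b Z.:+ (c Z.:- d)) Z.:= (a Z.:+ c Z.:- (b Z.:+ d))) refl
    (f (5 ℕ.+ n)) (f n) (g (5 ℕ.+ n)) (g n))
  (QuasiPoly-+ qf qg))

-- Identities between quasi-polynomials can therefore be decided by evaluation.
QuasiPoly-vanish : ∀ {k f} → QuasiPoly k f → (∀ n → n < k ℕ.* 5 → f n ≡ ℤ.0ℤ) → ∀ n → f n ≡ ℤ.0ℤ
QuasiPoly-vanish (null f≡0) f<≡0 = f≡0
QuasiPoly-vanish {suc k} {f} (step qf) f<≡0 = go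
  where
  periodic : ∀ n → Δ⁵ f n ≡ ℤ.0ℤ
  periodic = QuasiPoly-vanish qf λ n n<5k → cong₂ ℤ._-_
    (f<≡0 (5 ℕ.+ n) (ℕₚ.+-monoʳ-< 5 n<5k)) (f<≡0 n (ℕₚ.≤-trans n<5k (ℕₚ.m≤n+m (k ℕ.* 5) 5)))
  go : ∀ n → f n ≡ ℤ.0ℤ
  go 0 = f<≡0 0 (s≤s z≤n)
  go 1 = f<≡0 1 (s≤s (s≤s z≤n))
  go 2 = f<≡0 2 (s≤s (s≤s (s≤s z≤n)))
  go 3 = f<≡0 3 (s≤s (s≤s (s≤s (s≤s z≤n))))
  go 4 = f<≡0 4 (s≤s (s≤s (s≤s (s≤s (s≤s z≤n)))))
  go (suc (suc (suc (suc (suc n))))) = trans (ℤₚ.i-j≡0⇒i≡j _ _ (periodic n)) (go n)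

Table : Set
Table = Fin 5 → Fin 5 → Form

quasi : (Fin 5 → Form) → ℤ → ℕ → ℤ
quasi F c n = ⟦ F (res n) ⟧ c (ℤ.+ n)

quasi-Δ : ∀ F c n → quasi (Δ₂ ∘ F) c n ≡ Δ⁵ (quasi F c) n
quasi-Δ F c n = ⟦Δ₂⟧ (F (res n)) c (ℤ.+ n)

quasi-QuasiPoly : ∀ F c → QuasiPoly 3 (quasi F c)
quasi-QuasiPoly F c =
  step (QuasiPoly-resp (quasi-Δ F c) (
  step (QuasiPoly-resp (quasi-Δ (Δ₂ ∘ F) c) (
  step (QuasiPoly-resp (quasi-Δ (Δ₂ ∘ Δ₂ ∘ F) c) (null λ n → Δ₂³ (F (res n)) c (ℤ.+ n)))))))

-- The sum of h(a, b) over a + b = e + 1 with a, b ≥ 1. Because the recursion shifts the first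
-- argument and leaves the second alone, passing from e to e + 5 shifts a by 5 and splits off the
-- five terms with a = 1, ..., 5.
convolve : (ℕ → ℕ → ℤ) → ℕ → ℤ
convolve h zero    = ℤ.0ℤ
convolve h (suc e) = h 1 (suc e) ℤ.+ convolve (λ a → h (suc a)) e

convolve-cong : ∀ {h h′} → (∀ a b → h a b ≡ h′ a b) → ∀ e → convolve h e ≡ convolve h′ e
convolve-cong h≗h′ zero    = refl
convolve-cong h≗h′ (suc e) = cong₂ ℤ._+_ (h≗h′ 1 (suc e)) (convolve-cong (λ a → h≗h′ (suc a)) e)

convolve-0 : ∀ {h} → (∀ a b → h a b ≡ ℤ.0ℤ) → ∀ e → convolve h e ≡ ℤ.0ℤ
convolve-0 h≗0 zero    = refl
convolve-0 h≗0 (suc e) = cong₂ ℤ._+_ (h≗0 1 (suc e)) (convolve-0 (λ a → h≗0 (suc a)) e)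

convolve-- : ∀ h h′ e → convolve (λ a b → h a b ℤ.- h′ a b) e ≡ convolve h e ℤ.- convolve h′ e
convolve-- h h′ zero    = refl
convolve-- h h′ (suc e) = trans (cong (ℤ._+_ (h 1 (suc e) ℤ.- h′ 1 (suc e))) (convolve-- (λ a → h (suc a)) (λ a → h′ (suc a)) e))
  (Z.solve 4 (λ a b c d → (a Z.:- b Z.:+ (c Z.:- d)) Z.:= (a Z.:+ c Z.:- (b Z.:+ d))) refl
    (h 1 (suc e)) (h′ 1 (suc e)) (convolve (λ a → h (suc a)) e) (convolve (λ a → h′ (suc a)) e))

value : Table → ℕ → ℕ → ℤ
value T a b = ⟦ T (res a) (res b) ⟧ (ℤ.+ a) (ℤ.+ b)

convolve-QuasiPoly-step : ∀ k T → QuasiPoly (k ℕ.+ 3) (convolve (value (λ x y → Δ₁ (T x y))))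
  → QuasiPoly (suc k ℕ.+ 3) (convolve (value T))
convolve-QuasiPoly-step k T qΔ = step (QuasiPoly-resp difference
  (QuasiPoly-+ qΔ (QuasiPoly-+ (boundary 1 5) (QuasiPoly-+ (boundary 2 4)
    (QuasiPoly-+ (boundary 3 3) (QuasiPoly-+ (boundary 4 2) (boundary 5 1)))))))
  where
  boundary : ∀ a s → QuasiPoly (k ℕ.+ 3) (λ e → value T a (s ℕ.+ e))
  boundary a s = QuasiPoly-lift k (QuasiPoly-shift s (quasi-QuasiPoly (T (res a)) (ℤ.+ a)))
  difference : ∀ e → convolve (value (λ x y → Δ₁ (T x y))) e ℤ.+ (value T 1 (5 ℕ.+ e) ℤ.+
      (value T 2 (4 ℕ.+ e) ℤ.+ (value T 3 (3 ℕ.+ e) ℤ.+ (value T 4 (2 ℕ.+ e) ℤ.+ value T 5 (1 ℕ.+ e)))))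
    ≡ Δ⁵ (convolve (value T)) e
  difference e = trans
    (cong (λ z → z ℤ.+ (value T 1 (5 ℕ.+ e) ℤ.+
      (value T 2 (4 ℕ.+ e) ℤ.+ (value T 3 (3 ℕ.+ e) ℤ.+ (value T 4 (2 ℕ.+ e) ℤ.+ value T 5 (1 ℕ.+ e))))))
      (trans (convolve-cong (λ a b → ⟦Δ₁⟧ (T (res a) (res b)) (ℤ.+ a) (ℤ.+ b)) e)
        (convolve-- (λ a → value T (5 ℕ.+ a)) (value T) e)))
    (Z.solve 7 (λ u v a b c d e → (u Z.:- v Z.:+ (a Z.:+ (b Z.:+ (c Z.:+ (d Z.:+ e)))))
        Z.:= (a Z.:+ (b Z.:+ (c Z.:+ (d Z.:+ (e Z.:+ u)))) Z.:- v)) refl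
      (convolve (λ a → value T (5 ℕ.+ a)) e) (convolve (value T) e) (value T 1 (5 ℕ.+ e))
      (value T 2 (4 ℕ.+ e)) (value T 3 (3 ℕ.+ e)) (value T 4 (2 ℕ.+ e)) (value T 5 (1 ℕ.+ e)))

-- The boundary terms are quadratic in e on each class, hence of order 3. Three differences in a
-- annihilate a quadratic form, and each summation over a raises the order by one: 3 + 3 = 6, whence
-- 6 · 5 = 30 values to be checked.
convolve-QuasiPoly : ∀ T → QuasiPoly 6 (convolve (value T))
convolve-QuasiPoly T =
  convolve-QuasiPoly-step 2 T (
  convolve-QuasiPoly-step 1 (λ x y → Δ₁ (T x y)) (
  convolve-QuasiPoly-step 0 (λ x y → Δ₁ (Δ₁ (T x y))) (
  QuasiPoly-lift 3 (null (convolve-0 λ a b → Δ₁³ (T (res a) (res b)) (ℤ.+ a) (ℤ.+ b))))))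

-- Quadratic relations between divisor sums

-- g₁ and g₂ are the odd functions supported on ±1 and ±2 mod 5;
-- dᵢ is d ↦ d restricted to d ≡ ±i mod 5.
data Weight : Set where
  g₁ g₂ d₀ d₁ d₂ : Weight

coeffs : Weight → Fin 5 → ℤ × ℤ
coeffs g₁ 1F = 1ℤ , 0ℤ
coeffs g₁ 4F = -1ℤ , 0ℤ
coeffs g₂ 2F = 1ℤ , 0ℤ
coeffs g₂ 3F = -1ℤ , 0ℤ
coeffs d₀ 0F = 0ℤ , 1ℤ
coeffs d₁ 1F = 0ℤ , 1ℤ
coeffs d₁ 4F = 0ℤ , 1ℤ
coeffs d₂ 2F = 0ℤ , 1ℤ
coeffs d₂ 3F = 0ℤ , 1ℤ
coeffs _  _  = 0ℤ , 0ℤ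

affine : ℤ × ℤ → ℤ → ℤ
affine (c , c′) a = c ℤ.+ c′ ℤ.* a

weight : Weight → ℕ → ℤ
weight w n = affine (coeffs w (res n)) (ℤ.+ n)

series : Weight → FPS
series w = Lam (ℤ→ℚ ∘ weight w)

_⊗_ : ℤ × ℤ → ℤ × ℤ → Form
(c , c′) ⊗ (d , d′) = c ℤ.* d ∷ c′ ℤ.* d ∷ c ℤ.* d′ ∷ 0ℤ ∷ c′ ℤ.* d′ ∷ 0ℤ ∷ []

⟦⊗⟧ : ∀ p q a b → ⟦ p ⊗ q ⟧ a b ≡ affine p a ℤ.* affine q b
⟦⊗⟧ (c , c′) (d , d′) a b = Z.solve 6 (λ c c′ d d′ a b →
  formₚ (c Z.:* d) (c′ Z.:* d) (c Z.:* d′) (Z.con 0ℤ) (c′ Z.:* d′) (Z.con 0ℤ) a b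
  Z.:= ((c Z.:+ c′ Z.:* a) Z.:* (d Z.:+ d′ Z.:* b))) refl c c′ d d′ a b

Linear Bilinear : Set
Linear   = List (ℤ × Weight)
Bilinear = List (ℤ × Weight × Weight)

linear : (Weight → FPS) → Linear → FPS
linear φ []            = constant 0ℚ
linear φ ((c , w) ∷ l) = constant (ℤ→ℚ c) ⊛ φ w ⊕ linear φ l

bilinear : Bilinear → FPS
bilinear []                = constant 0ℚ
bilinear ((c , v , w) ∷ l) = constant (ℤ→ℚ c) ⊛ (series v ⊛ series w) ⊕ bilinear l

constant-0 : 𝟘 ≐ constant 0ℚ
constant-0 n = sym (ℚₚ.*-zeroˡ (one n))

θ-constant : ∀ c → θ (constant c) ≐ 𝟘
θ-constant c zero    = ℚₚ.*-zeroˡ (c * 1ℚ)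
θ-constant c (suc n) = trans (cong (ℕ→ℚ (suc n) *_) (ℚₚ.*-zeroʳ c)) (ℚₚ.*-zeroʳ (ℕ→ℚ (suc n)))

θ-constant-⊛ : ∀ c f → θ (constant c ⊛ f) ≐ constant c ⊛ θ f
θ-constant-⊛ c f n = trans (cong (ℕ→ℚ n *_) (sym (·≐constant-⊛ c f n)))
  (trans (θ-· c f n) (·≐constant-⊛ c (θ f) n))

θ-linear : ∀ l → θ (linear series l) ≐ linear (θ ∘ series) l
θ-linear []            n = trans (θ-constant 0ℚ n) (constant-0 n)
θ-linear ((c , w) ∷ l) n = trans (θ-⊕ (constant (ℤ→ℚ c) ⊛ series w) (linear series l) n)
  (cong₂ _+_ (θ-constant-⊛ (ℤ→ℚ c) (series w) n) (θ-linear l n))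

linearCoeffs : Linear → Fin 5 → ℤ × ℤ
linearCoeffs []            x = 0ℤ , 0ℤ
linearCoeffs ((c , w) ∷ l) x =
  c ℤ.* proj₁ (coeffs w x) ℤ.+ proj₁ (linearCoeffs l x) , c ℤ.* proj₂ (coeffs w x) ℤ.+ proj₂ (linearCoeffs l x)

linearWeight : Linear → ℕ → ℤ
linearWeight l n = affine (linearCoeffs l (res n)) (ℤ.+ n)

bilinearForm : Bilinear → Table
bilinearForm []                x y = 0ᶠ
bilinearForm ((c , v , w) ∷ l) x y = c *ᶠ (coeffs v x ⊗ coeffs w y) +ᶠ bilinearForm l x y

Lam-0 : ∀ w → (∀ d → w (suc d) ≡ 0ℚ) → Lam w ≐ 𝟘
Lam-0 w w≡0 n = Σ<-0 n λ a _ → Σ<-0 n λ x _ → trans (cong (_* qpow (suc a ℕ.* suc x) n) (w≡0 a)) (ℚₚ.*-zeroˡ (qpow (suc a ℕ.* suc x) n))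

Quad-0 : ∀ h → (∀ a b → h (suc a) (suc b) ≡ 0ℚ) → Quad h ≐ 𝟘
Quad-0 h h≡0 n = Σ<-0 n λ a _ → Σ<-0 n λ b _ → Σ<-0 n λ x _ → Σ<-0 n λ y _ →
  trans (cong (_* qpow (suc a ℕ.* suc x ℕ.+ suc b ℕ.* suc y) n) (h≡0 a b))
    (ℚₚ.*-zeroˡ (qpow (suc a ℕ.* suc x ℕ.+ suc b ℕ.* suc y) n))

Lam-linear : ∀ l → Lam (ℤ→ℚ ∘ linearWeight l) ≐ linear series l
Lam-linear []            = FPSRing.trans (Lam-0 (ℤ→ℚ ∘ linearWeight []) λ d → cong ℤ→ℚ (Z.solve 1 (λ a → (Z.con 0ℤ Z.:+ Z.con 0ℤ Z.:* a) Z.:= Z.con 0ℤ) refl (ℤ.+ suc d))) constant-0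
Lam-linear ((c , w) ∷ l) n = begin
  Lam (ℤ→ℚ ∘ linearWeight ((c , w) ∷ l)) n
    ≡⟨ Lam-cong (ℤ→ℚ ∘ linearWeight ((c , w) ∷ l)) (λ d → ℤ→ℚ c * ℤ→ℚ (weight w d) + ℤ→ℚ (linearWeight l d)) (λ d → trans (cong ℤ→ℚ (expand (suc d))) (trans (ℤ→ℚ-+ (c ℤ.* weight w (suc d)) _)
         (cong (_+ ℤ→ℚ (linearWeight l (suc d))) (ℤ→ℚ-* c (weight w (suc d)))))) n ⟩
  Lam (λ d → ℤ→ℚ c * ℤ→ℚ (weight w d) + ℤ→ℚ (linearWeight l d)) n
    ≡⟨ Lam-+ (λ d → ℤ→ℚ c * ℤ→ℚ (weight w d)) (ℤ→ℚ ∘ linearWeight l) n ⟩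
  Lam (λ d → ℤ→ℚ c * ℤ→ℚ (weight w d)) n + Lam (ℤ→ℚ ∘ linearWeight l) n
    ≡⟨ cong₂ _+_ (trans (Lam-· (ℤ→ℚ c) (ℤ→ℚ ∘ weight w) n) (·≐constant-⊛ (ℤ→ℚ c) (series w) n)) (Lam-linear l n) ⟩
  linear series ((c , w) ∷ l) n ∎
  where
  expand : ∀ d → linearWeight ((c , w) ∷ l) d ≡ c ℤ.* weight w d ℤ.+ linearWeight l d
  expand d = Z.solve 6 (λ c u v s t a → (c Z.:* u Z.:+ s Z.:+ (c Z.:* v Z.:+ t) Z.:* a)
      Z.:= (c Z.:* (u Z.:+ v Z.:* a) Z.:+ (s Z.:+ t Z.:* a))) refl
    c (proj₁ (coeffs w (res d))) (proj₂ (coeffs w (res d)))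
    (proj₁ (linearCoeffs l (res d))) (proj₂ (linearCoeffs l (res d))) (ℤ.+ d)

Quad-bilinear : ∀ l → Quad (λ a b → ℤ→ℚ (value (bilinearForm l) a b)) ≐ bilinear l
Quad-bilinear []                = FPSRing.trans (Quad-0 (λ a b → ℤ→ℚ (value (bilinearForm []) a b)) λ a b → cong ℤ→ℚ (⟦0ᶠ⟧ (ℤ.+ suc a) (ℤ.+ suc b))) constant-0
Quad-bilinear ((c , v , w) ∷ l) n = begin
  Quad (λ a b → ℤ→ℚ (value (bilinearForm ((c , v , w) ∷ l)) a b)) n
    ≡⟨ Quad-cong (λ a b → ℤ→ℚ (value (bilinearForm ((c , v , w) ∷ l)) a b))
         (λ a b → ℤ→ℚ c * (ℤ→ℚ (weight v a) * ℤ→ℚ (weight w b)) + rest a b) (λ a b → expand (suc a) (suc b)) n ⟩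
  Quad (λ a b → ℤ→ℚ c * (ℤ→ℚ (weight v a) * ℤ→ℚ (weight w b)) + rest a b) n
    ≡⟨ Quad-+ (λ a b → ℤ→ℚ c * (ℤ→ℚ (weight v a) * ℤ→ℚ (weight w b))) rest n ⟩
  Quad (λ a b → ℤ→ℚ c * (ℤ→ℚ (weight v a) * ℤ→ℚ (weight w b))) n + Quad rest n
    ≡⟨ cong₂ _+_ (trans (Quad-· (ℤ→ℚ c) (λ a b → ℤ→ℚ (weight v a) * ℤ→ℚ (weight w b)) n)
         (trans (cong (ℤ→ℚ c *_) (sym (Lam-⊛-Lam (ℤ→ℚ ∘ weight v) (ℤ→ℚ ∘ weight w) n))) (·≐constant-⊛ (ℤ→ℚ c) (series v ⊛ series w) n)))
         (Quad-bilinear l n) ⟩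
  bilinear ((c , v , w) ∷ l) n ∎
  where
  rest : ℕ → ℕ → ℚ
  rest a b = ℤ→ℚ (value (bilinearForm l) a b)
  expand : ∀ a b → ℤ→ℚ (value (bilinearForm ((c , v , w) ∷ l)) a b)
    ≡ ℤ→ℚ c * (ℤ→ℚ (weight v a) * ℤ→ℚ (weight w b)) + rest a b
  expand a b = begin
    ℤ→ℚ (⟦ c *ᶠ f +ᶠ bilinearForm l (res a) (res b) ⟧ (ℤ.+ a) (ℤ.+ b))
      ≡⟨ cong ℤ→ℚ (⟦+ᶠ⟧ (c *ᶠ f) (bilinearForm l (res a) (res b)) (ℤ.+ a) (ℤ.+ b)) ⟩
    ℤ→ℚ (⟦ c *ᶠ f ⟧ (ℤ.+ a) (ℤ.+ b) ℤ.+ value (bilinearForm l) a b)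
      ≡⟨ ℤ→ℚ-+ (⟦ c *ᶠ f ⟧ (ℤ.+ a) (ℤ.+ b)) (value (bilinearForm l) a b) ⟩
    ℤ→ℚ (⟦ c *ᶠ f ⟧ (ℤ.+ a) (ℤ.+ b)) + rest a b
      ≡⟨ cong (_+ rest a b) (begin
        ℤ→ℚ (⟦ c *ᶠ f ⟧ (ℤ.+ a) (ℤ.+ b))
          ≡⟨ cong ℤ→ℚ (trans (⟦*ᶠ⟧ c f (ℤ.+ a) (ℤ.+ b)) (cong (c ℤ.*_) (⟦⊗⟧ (coeffs v (res a)) (coeffs w (res b)) (ℤ.+ a) (ℤ.+ b)))) ⟩
        ℤ→ℚ (c ℤ.* (weight v a ℤ.* weight w b))
          ≡⟨ trans (ℤ→ℚ-* c (weight v a ℤ.* weight w b)) (cong (ℤ→ℚ c *_) (ℤ→ℚ-* (weight v a) (weight w b))) ⟩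
        ℤ→ℚ c * (ℤ→ℚ (weight v a) * ℤ→ℚ (weight w b)) ∎) ⟩
    ℤ→ℚ c * (ℤ→ℚ (weight v a) * ℤ→ℚ (weight w b)) + rest a b ∎
    where
    f : Form
    f = coeffs v (res a) ⊗ coeffs w (res b)

-- The coefficients of p(a, -a) in powers of a. `Valid` asks for a vanishing constant one, because
-- only a weight divisible by d turns the count n/d - 1 into a derivative.
antidiagonal : Form → Vec ℤ 3
antidiagonal (c ∷ c₁ ∷ c₂ ∷ c₁₁ ∷ c₁₂ ∷ c₂₂ ∷ []) = c ∷ c₁ ℤ.- c₂ ∷ c₁₁ ℤ.- c₁₂ ℤ.+ c₂₂ ∷ []

correction : ℤ × ℤ → ℤ × ℤ → Form
correction (k , k′) (t , t′) = ℤ.- t ∷ 0ℤ ∷ k ℤ.- t′ ∷ 0ℤ ∷ 0ℤ ∷ k′ ∷ []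

⟦antidiagonal⟧ : ∀ f k k′ a → antidiagonal f ≡ 0ℤ ∷ k ∷ k′ ∷ [] → ⟦ f ⟧ a (ℤ.- a) ≡ a ℤ.* affine (k , k′) a
⟦antidiagonal⟧ (.0ℤ ∷ c₁ ∷ c₂ ∷ c₁₁ ∷ c₁₂ ∷ c₂₂ ∷ []) _ _ a refl =
  Z.solve 6 (λ c₁ c₂ c₁₁ c₁₂ c₂₂ a → formₚ (Z.con 0ℤ) c₁ c₂ c₁₁ c₁₂ c₂₂ a (Z.:- a)
    Z.:= (a Z.:* (c₁ Z.:- c₂ Z.:+ (c₁₁ Z.:- c₁₂ Z.:+ c₂₂) Z.:* a))) refl c₁ c₂ c₁₁ c₁₂ c₂₂ a

⟦correction⟧ : ∀ κ t a → ⟦ correction κ t ⟧ 0ℤ a ≡ a ℤ.* affine κ a ℤ.- affine t a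
⟦correction⟧ (k , k′) (t , t′) a =
  Z.solve 5 (λ k k′ t t′ a →
    formₚ (Z.:- t) (Z.con 0ℤ) (k Z.:- t′) (Z.con 0ℤ) (Z.con 0ℤ) k′ (Z.con 0ℤ) a
    Z.:= (a Z.:* (k Z.:+ k′ Z.:* a) Z.:- (t Z.:+ t′ Z.:* a))) refl k k′ t t′ a

residual : Table → Linear → Linear → ℕ → ℤ
residual T κ t e = convolve (value T) e ℤ.+ quasi (λ x → correction (linearCoeffs κ x) (linearCoeffs t x)) 0ℤ (suc e)

-- T encodes p: for a, b mod 5 equal to x, y it gives p(a, b) as a polynomial.  The two shears
-- are the symmetries of p, and the third condition identifies p(a, b) - p(a, -b).  The weights
-- κ and t satisfy p(d, -d) = d κ(d) and Σ_{k+l=d} p(k, l) + d κ(d) = t(d); by quasi-polynomiality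
-- the latter has to be checked for d ≤ 30 only.
Valid : Table → Bilinear → Linear → Linear → Set
Valid T l κ t =
  (∀ x y → shearʳ (T x (neg (x ⊞ y))) ≡ T x y) ×
  (∀ x y → shearˡ (T (x ⊞ y) (neg y)) ≡ T x y) ×
  (∀ x y → T x y ≡ reflect (T x (neg y)) +ᶠ bilinearForm l x y) ×
  (∀ x → antidiagonal (T x (neg x)) ≡ 0ℤ ∷ proj₁ (linearCoeffs κ x) ∷ proj₂ (linearCoeffs κ x) ∷ []) ×
  (∀ (i : Fin 30) → residual T κ t (toℕ i) ≡ 0ℤ)

valid? : ∀ T l κ t → Dec (Valid T l κ t)
valid? T l κ t =
  (Finₚ.all? λ x → Finₚ.all? λ y → Vecₚ.≡-dec ℤ._≟_ _ _) ×-dec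
  (Finₚ.all? λ x → Finₚ.all? λ y → Vecₚ.≡-dec ℤ._≟_ _ _) ×-dec
  (Finₚ.all? λ x → Finₚ.all? λ y → Vecₚ.≡-dec ℤ._≟_ _ _) ×-dec
  (Finₚ.all? λ x → Vecₚ.≡-dec ℤ._≟_ _ _) ×-dec
  (Finₚ.all? λ i → _ ℤ.≟ _)

convolve-conv : ∀ h e → ℤ→ℚ (convolve h e) ≡ Σ< e (λ k → ℤ→ℚ (h (suc k) (e ∸ k)))
convolve-conv h zero    = sym (Σ<-zero _)
convolve-conv h (suc e) = trans (ℤ→ℚ-+ (h 1 (suc e)) (convolve (λ a → h (suc a)) e))
  (trans (cong (ℤ→ℚ (h 1 (suc e)) +_) (convolve-conv (λ a → h (suc a)) e))
    (sym (Σ<-suc e (λ k → ℤ→ℚ (h (suc k) (suc e ∸ k))))))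

-- With `h⁺` = p(a, b) and `h⁻` = p(a, -b), the two shears are the hypotheses of the Euclidean step,
-- the splitting of T identifies `Quad h⁺` - `Quad h⁻` with the products of series, and the
-- antidiagonal evaluates D⁻. The vanishing residual then combines D⁺ with the sum of dκ(d) left
-- over from D⁻.
bilinear-identity : ∀ T l κ t → Valid T l κ t
  → bilinear l ⊕ linear (θ ∘ series) κ ≐ linear series t
bilinear-identity T l κ t (inv₁ , inv₂ , split , diag , finite) n = begin
  bilinear l n + linear (θ ∘ series) κ n
    ≡⟨ cong₂ _+_ (sym (Quad-bilinear l n)) (trans (sym (θ-linear κ n)) (cong (ℕ→ℚ n *_) (sym (Lam-linear κ n)))) ⟩
  Quad (ι (bilinearForm l)) n + θ K n
    -- Inserting `Quad h⁻` and `Lam dκ` exposes the left side of `E.difference`.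
    ≡⟨ solve 4 (λ x y u v → x :+ y := (u :+ x) :+ (y :+ :- v) :+ (v :+ :- u)) refl
         (Quad (ι (bilinearForm l)) n) (θ K n) (Quad h⁻ n) (Lam dκ n) ⟩
  (Quad h⁻ n + Quad (ι (bilinearForm l)) n) + (θ K n + - Lam dκ n) + (Lam dκ n + - Quad h⁻ n)
    ≡⟨ cong (_+ (Lam dκ n + - Quad h⁻ n)) (trans (cong₂ _+_ (sym split′) (sym (E.diagonal⁻ (ℤ→ℚ ∘ linearWeight κ) diagonal)))
         E.difference) ⟩
  Quad h⁻ n + E.D⁺ + (Lam dκ n + - Quad h⁻ n)
    ≡⟨ solve 3 (λ x y z → x :+ y :+ (z :+ :- x) := y :+ z) refl (Quad h⁻ n) E.D⁺ (Lam dκ n) ⟩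
  E.D⁺ + Lam dκ n
    ≡⟨ cong (_+ Lam dκ n) E.diagonal⁺ ⟩
  Lam (conv h⁺) n + Lam dκ n
    ≡⟨ Lam-+ (conv h⁺) dκ n ⟨
  Lam (λ d → conv h⁺ d + dκ d) n
    ≡⟨ Lam-cong (λ d → conv h⁺ d + dκ d) (ℤ→ℚ ∘ linearWeight t) total n ⟩
  Lam (ℤ→ℚ ∘ linearWeight t) n
    ≡⟨ Lam-linear t n ⟩
  linear series t n ∎
  where
  ι : Table → ℕ → ℕ → ℚ
  ι T a b = ℤ→ℚ (value T a b)
  h⁺ h⁻ : ℕ → ℕ → ℚ
  h⁺ = ι T
  h⁻ a b = ℤ→ℚ (⟦ T (res a) (neg (res b)) ⟧ (ℤ.+ a) (ℤ.- (ℤ.+ b)))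
  K : FPS
  K = Lam (ℤ→ℚ ∘ linearWeight κ)
  dκ : ℕ → ℚ
  dκ d = ℕ→ℚ d * ℤ→ℚ (linearWeight κ d)
  step₁ : ∀ a b → ⟦ T (res a) (neg (res (a ℕ.+ b))) ⟧ (ℤ.+ a) (ℤ.- (ℤ.+ (a ℕ.+ b))) ≡ value T a b
  step₁ a b = begin
    ⟦ T (res a) (neg (res (a ℕ.+ b))) ⟧ (ℤ.+ a) (ℤ.- (ℤ.+ (a ℕ.+ b)))
      ≡⟨ cong (λ x → ⟦ T (res a) (neg x) ⟧ (ℤ.+ a) (ℤ.- (ℤ.+ (a ℕ.+ b)))) (res-+ a b) ⟩
    ⟦ T (res a) (neg (res a ⊞ res b)) ⟧ (ℤ.+ a) (ℤ.- (ℤ.+ a ℤ.+ ℤ.+ b))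
      ≡⟨ ⟦shearʳ⟧ (T (res a) (neg (res a ⊞ res b))) (ℤ.+ a) (ℤ.+ b) ⟨
    ⟦ shearʳ (T (res a) (neg (res a ⊞ res b))) ⟧ (ℤ.+ a) (ℤ.+ b)
      ≡⟨ cong (λ f → ⟦ f ⟧ (ℤ.+ a) (ℤ.+ b)) (inv₁ (res a) (res b)) ⟩
    value T a b ∎
  step₂ : ∀ a b → ⟦ T (res (b ℕ.+ a)) (neg (res a)) ⟧ (ℤ.+ (b ℕ.+ a)) (ℤ.- (ℤ.+ a)) ≡ value T b a
  step₂ a b = begin
    ⟦ T (res (b ℕ.+ a)) (neg (res a)) ⟧ (ℤ.+ (b ℕ.+ a)) (ℤ.- (ℤ.+ a))
      ≡⟨ cong (λ x → ⟦ T x (neg (res a)) ⟧ (ℤ.+ (b ℕ.+ a)) (ℤ.- (ℤ.+ a))) (res-+ b a) ⟩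
    ⟦ T (res b ⊞ res a) (neg (res a)) ⟧ (ℤ.+ b ℤ.+ ℤ.+ a) (ℤ.- (ℤ.+ a))
      ≡⟨ ⟦shearˡ⟧ (T (res b ⊞ res a) (neg (res a))) (ℤ.+ b) (ℤ.+ a) ⟨
    ⟦ shearˡ (T (res b ⊞ res a) (neg (res a))) ⟧ (ℤ.+ b) (ℤ.+ a)
      ≡⟨ cong (λ f → ⟦ f ⟧ (ℤ.+ b) (ℤ.+ a)) (inv₂ (res b) (res a)) ⟩
    value T b a ∎
  stepʳ : ∀ a b → h⁻ (suc a) (suc (suc (a ℕ.+ b))) ≡ h⁺ (suc a) (suc b)
  stepʳ a b = trans (cong (h⁻ (suc a) ∘ suc) (sym (ℕₚ.+-suc a b))) (cong ℤ→ℚ (step₁ (suc a) (suc b)))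
  stepˡ : ∀ a b → h⁻ (suc (suc (a ℕ.+ b))) (suc a) ≡ h⁺ (suc b) (suc a)
  stepˡ a b = trans (cong (λ m → h⁻ (suc m) (suc a)) (trans (cong suc (ℕₚ.+-comm a b)) (sym (ℕₚ.+-suc b a))))
    (cong ℤ→ℚ (step₂ (suc a) (suc b)))
  module E = Euclid h⁺ h⁻ stepʳ stepˡ n
  split′ : Quad h⁺ n ≡ Quad h⁻ n + Quad (ι (bilinearForm l)) n
  split′ = trans (Quad-cong h⁺ (λ a b → h⁻ a b + ι (bilinearForm l) a b) (λ a b → begin
      ℤ→ℚ (value T (suc a) (suc b))
        ≡⟨ cong ℤ→ℚ (trans (cong (λ f → ⟦ f ⟧ (ℤ.+ suc a) (ℤ.+ suc b)) (split (res (suc a)) (res (suc b))))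
             (trans (⟦+ᶠ⟧ (reflect (T (res (suc a)) (neg (res (suc b))))) _ (ℤ.+ suc a) (ℤ.+ suc b))
               (cong (ℤ._+ value (bilinearForm l) (suc a) (suc b)) (⟦reflect⟧ (T (res (suc a)) (neg (res (suc b)))) (ℤ.+ suc a) (ℤ.+ suc b))))) ⟩
      ℤ→ℚ (⟦ T (res (suc a)) (neg (res (suc b))) ⟧ (ℤ.+ suc a) (ℤ.- (ℤ.+ suc b)) ℤ.+ value (bilinearForm l) (suc a) (suc b))
        ≡⟨ ℤ→ℚ-+ (⟦ T (res (suc a)) (neg (res (suc b))) ⟧ (ℤ.+ suc a) (ℤ.- (ℤ.+ suc b))) _ ⟩
      h⁻ (suc a) (suc b) + ι (bilinearForm l) (suc a) (suc b) ∎) n)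
    (Quad-+ h⁻ (ι (bilinearForm l)) n)
  diagonal : ∀ d → h⁻ (suc d) (suc d) ≡ dκ (suc d)
  diagonal d = trans (cong ℤ→ℚ (⟦antidiagonal⟧ (T (res (suc d)) (neg (res (suc d)))) _ _ (ℤ.+ suc d) (diag (res (suc d)))))
    (ℤ→ℚ-* (ℤ.+ suc d) (linearWeight κ (suc d)))
  residual-QuasiPoly : QuasiPoly 6 (residual T κ t)
  residual-QuasiPoly = QuasiPoly-+ (convolve-QuasiPoly T)
    -- The convolution at e concerns d = e + 1, which accounts for the shift; the quadratic
    -- correction of order 3 is lifted to the order 6 of the convolution.
    (QuasiPoly-lift 3 (QuasiPoly-shift 1 (quasi-QuasiPoly (λ x → correction (linearCoeffs κ x) (linearCoeffs t x)) 0ℤ)))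
  residual≡0 : ∀ e → residual T κ t e ≡ 0ℤ
  residual≡0 = QuasiPoly-vanish residual-QuasiPoly λ e e<30 →
    subst (λ m → residual T κ t m ≡ 0ℤ) (Finₚ.toℕ-fromℕ< e<30) (finite (fromℕ< e<30))
  total : ∀ e → conv h⁺ (suc e) + dκ (suc e) ≡ ℤ→ℚ (linearWeight t (suc e))
  total e = begin
    conv h⁺ (suc e) + dκ (suc e)
      ≡⟨ cong₂ _+_ (sym (convolve-conv (value T) e)) (sym (ℤ→ℚ-* d (linearWeight κ (suc e)))) ⟩
    ℤ→ℚ (convolve (value T) e) + ℤ→ℚ (d ℤ.* linearWeight κ (suc e))
      ≡⟨ ℤ→ℚ-+ (convolve (value T) e) (d ℤ.* linearWeight κ (suc e)) ⟨
    ℤ→ℚ (convolve (value T) e ℤ.+ d ℤ.* linearWeight κ (suc e))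
      ≡⟨ cong ℤ→ℚ (ℤₚ.i-j≡0⇒i≡j (convolve (value T) e ℤ.+ d ℤ.* linearWeight κ (suc e)) (linearWeight t (suc e)) (trans
           (ℤₚ.+-assoc (convolve (value T) e) (d ℤ.* linearWeight κ (suc e)) (ℤ.- linearWeight t (suc e)))
           (trans (cong (λ z → convolve (value T) e ℤ.+ z) (sym (⟦correction⟧ (linearCoeffs κ (res (suc e))) (linearCoeffs t (res (suc e))) d)))
             (residual≡0 e)))) ⟩
    ℤ→ℚ (linearWeight t (suc e)) ∎
    where
    d : ℤ
    d = ℤ.+ suc e

-- Certificates for the five relations

Matrix : Set
Matrix = Vec (Vec ℤ 5) 5

_‼_,_ : Matrix → Fin 5 → Fin 5 → ℤ
M ‼ x , y = lookup (lookup M x) y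

-- The transposed entries encode p(a, b) = p(b, a): the coefficient of b on the classes (x, y) is
-- that of a on (y, x), and likewise for the squares.
constantTable linearTable : Matrix → Table
constantTable M x y = M ‼ x , y ∷ 0ℤ ∷ 0ℤ ∷ 0ℤ ∷ 0ℤ ∷ 0ℤ ∷ []
linearTable   M x y = 0ℤ ∷ M ‼ x , y ∷ M ‼ y , x ∷ 0ℤ ∷ 0ℤ ∷ 0ℤ ∷ []

quadraticTable : Matrix → Matrix → Table
quadraticTable M N x y = 0ℤ ∷ 0ℤ ∷ 0ℤ ∷ M ‼ x , y ∷ N ‼ x , y ∷ M ‼ y , x ∷ []

2ℤ 3ℤ 5ℤ 6ℤ -2ℤ -3ℤ -6ℤ : ℤ
2ℤ = ℤ.+ 2
3ℤ = ℤ.+ 3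
5ℤ = ℤ.+ 5
6ℤ = ℤ.+ 6
-2ℤ = -[1+ 1 ]
-3ℤ = -[1+ 2 ]
-6ℤ = -[1+ 5 ]

-- The tables solve the linear system expressing the conditions of `Valid` for a prescribed
-- bilinear form; the first two are 5 times the indicators of the orbits of (1, 1, 3), (1, 2, 2).
table-113 : Table
table-113 = constantTable
    ( (0ℤ ∷ 0ℤ ∷ 0ℤ ∷ 0ℤ ∷ 0ℤ ∷ [])
    ∷ (0ℤ ∷ 5ℤ ∷ 0ℤ ∷ 5ℤ ∷ 0ℤ ∷ [])
    ∷ (0ℤ ∷ 0ℤ ∷ 0ℤ ∷ 0ℤ ∷ 5ℤ ∷ [])
    ∷ (0ℤ ∷ 5ℤ ∷ 0ℤ ∷ 0ℤ ∷ 0ℤ ∷ [])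
    ∷ (0ℤ ∷ 0ℤ ∷ 5ℤ ∷ 0ℤ ∷ 5ℤ ∷ []) ∷ [])

bilinear-113 : Bilinear
bilinear-113 = (5ℤ , g₁ , g₁) ∷ (-[1+ 4 ] , g₁ , g₂) ∷ (-[1+ 4 ] , g₂ , g₁) ∷ []

-- No derivative occurs, since the orbit contains no pair (x, -x) and p therefore vanishes on the
-- antidiagonal. The same holds for the orbit of (1, 2, 2).
κ-113 t-113 : Linear
κ-113 = []
t-113 = (2ℤ , d₁) ∷ (1ℤ , d₂) ∷ (-2ℤ , g₁) ∷ (3ℤ , g₂) ∷ []

identity-113 : bilinear bilinear-113 ⊕ linear (θ ∘ series) κ-113 ≐ linear series t-113
identity-113 = bilinear-identity table-113 bilinear-113 κ-113 t-113 (toWitness {a? = valid? table-113 bilinear-113 κ-113 t-113} _)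

table-122 : Table
table-122 = constantTable
    ( (0ℤ ∷ 0ℤ ∷ 0ℤ ∷ 0ℤ ∷ 0ℤ ∷ [])
    ∷ (0ℤ ∷ 0ℤ ∷ 5ℤ ∷ 0ℤ ∷ 0ℤ ∷ [])
    ∷ (0ℤ ∷ 5ℤ ∷ 5ℤ ∷ 0ℤ ∷ 0ℤ ∷ [])
    ∷ (0ℤ ∷ 0ℤ ∷ 0ℤ ∷ 5ℤ ∷ 5ℤ ∷ [])
    ∷ (0ℤ ∷ 0ℤ ∷ 0ℤ ∷ 5ℤ ∷ 0ℤ ∷ []) ∷ [])

bilinear-122 : Bilinear
bilinear-122 = (5ℤ , g₂ , g₂) ∷ (5ℤ , g₁ , g₂) ∷ (5ℤ , g₂ , g₁) ∷ []

κ-122 t-122 : Linear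
κ-122 = []
t-122 = (1ℤ , d₁) ∷ (2ℤ , d₂) ∷ (-1ℤ , g₁) ∷ (-[1+ 3 ] , g₂) ∷ []

identity-122 : bilinear bilinear-122 ⊕ linear (θ ∘ series) κ-122 ≐ linear series t-122
identity-122 = bilinear-identity table-122 bilinear-122 κ-122 t-122 (toWitness {a? = valid? table-122 bilinear-122 κ-122 t-122} _)

table-θV : Table
table-θV = linearTable
    ( ( 0ℤ ∷ -3ℤ ∷ -1ℤ ∷  1ℤ ∷  3ℤ ∷ [])
    ∷ (-6ℤ ∷  6ℤ ∷  3ℤ ∷  0ℤ ∷ -3ℤ ∷ [])
    ∷ (-2ℤ ∷  0ℤ ∷ -3ℤ ∷ -1ℤ ∷  6ℤ ∷ [])
    ∷ ( 2ℤ ∷ -6ℤ ∷  1ℤ ∷  3ℤ ∷  0ℤ ∷ [])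
    ∷ ( 6ℤ ∷  3ℤ ∷  0ℤ ∷ -3ℤ ∷ -6ℤ ∷ []) ∷ [])

-- Symmetrisation of (3g₁ + g₂)(3d₁ - 2d₂ - 2d₀), that is, 2(V - 1) `GV`. With κ giving -2θV and t
-- giving -2 `GV`, the relation is twice the equation `GV` V = θV.
bilinear-θV : Bilinear
bilinear-θV =
    (ℤ.+ 9 , g₁ , d₁) ∷ (-6ℤ , g₁ , d₂) ∷ (-6ℤ , g₁ , d₀) ∷ (3ℤ , g₂ , d₁) ∷ (-2ℤ , g₂ , d₂) ∷
    (-2ℤ , g₂ , d₀) ∷ (ℤ.+ 9 , d₁ , g₁) ∷ (3ℤ , d₁ , g₂) ∷ (-6ℤ , d₂ , g₁) ∷ (-2ℤ , d₂ , g₂) ∷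
    (-6ℤ , d₀ , g₁) ∷ (-2ℤ , d₀ , g₂) ∷ []

κ-θV t-θV : Linear
κ-θV = (-6ℤ , g₁) ∷ (-2ℤ , g₂) ∷ []
t-θV = (-6ℤ , d₁) ∷ (ℤ.+ 4 , d₂) ∷ (ℤ.+ 4 , d₀) ∷ []

identity-θV : bilinear bilinear-θV ⊕ linear (θ ∘ series) κ-θV ≐ linear series t-θV
identity-θV = bilinear-identity table-θV bilinear-θV κ-θV t-θV (toWitness {a? = valid? table-θV bilinear-θV κ-θV t-θV} _)

table-θU : Table
table-θU = linearTable
    ( ( 0ℤ ∷ -1ℤ ∷  3ℤ ∷ -3ℤ ∷  1ℤ ∷ [])
    ∷ (-2ℤ ∷ -3ℤ ∷  6ℤ ∷  0ℤ ∷ -1ℤ ∷ [])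
    ∷ ( 6ℤ ∷  0ℤ ∷ -6ℤ ∷  3ℤ ∷ -3ℤ ∷ [])
    ∷ (-6ℤ ∷  3ℤ ∷ -3ℤ ∷  6ℤ ∷  0ℤ ∷ [])
    ∷ ( 2ℤ ∷  1ℤ ∷  0ℤ ∷ -6ℤ ∷  3ℤ ∷ []) ∷ [])

-- Symmetrisation of (g₁ - 3g₂)(3d₂ - 2d₁ - 2d₀), that is, 2U(`GU` - 1). Both κ and t stand for -2U;
-- the right-hand side supplies the summand 1 of `GU`.
bilinear-θU : Bilinear
bilinear-θU =
    (-2ℤ , g₁ , d₁) ∷ (3ℤ , g₁ , d₂) ∷ (-2ℤ , g₁ , d₀) ∷ (6ℤ , g₂ , d₁) ∷ (-[1+ 8 ] , g₂ , d₂) ∷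
    (6ℤ , g₂ , d₀) ∷ (-2ℤ , d₁ , g₁) ∷ (6ℤ , d₁ , g₂) ∷ (3ℤ , d₂ , g₁) ∷ (-[1+ 8 ] , d₂ , g₂) ∷
    (-2ℤ , d₀ , g₁) ∷ (6ℤ , d₀ , g₂) ∷ []

κ-θU t-θU : Linear
κ-θU = (-2ℤ , g₁) ∷ (6ℤ , g₂) ∷ []
t-θU = (-2ℤ , g₁) ∷ (6ℤ , g₂) ∷ []

identity-θU : bilinear bilinear-θU ⊕ linear (θ ∘ series) κ-θU ≐ linear series t-θU
identity-θU = bilinear-identity table-θU bilinear-θU κ-θU t-θU (toWitness {a? = valid? table-θU bilinear-θU κ-θU t-θU} _)

-- With c = -a - b this is p = 6(a² + b² + c²), to which is added 50 times the product of the other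
-- two when exactly one of a, b, c is divisible by 5, and 100(ab + bc + ca) when all three are.
table-θℓ : Table
table-θℓ = quadraticTable
    ( (-[1+ 87 ] ∷    ℤ.+ 12 ∷    ℤ.+ 12 ∷    ℤ.+ 12 ∷    ℤ.+ 12 ∷ [])
    ∷ (-[1+ 37 ] ∷    ℤ.+ 12 ∷    ℤ.+ 12 ∷    ℤ.+ 12 ∷    ℤ.+ 12 ∷ [])
    ∷ (-[1+ 37 ] ∷    ℤ.+ 12 ∷    ℤ.+ 12 ∷    ℤ.+ 12 ∷    ℤ.+ 12 ∷ [])
    ∷ (-[1+ 37 ] ∷    ℤ.+ 12 ∷    ℤ.+ 12 ∷    ℤ.+ 12 ∷    ℤ.+ 12 ∷ [])
    ∷ (-[1+ 37 ] ∷    ℤ.+ 12 ∷    ℤ.+ 12 ∷    ℤ.+ 12 ∷    ℤ.+ 12 ∷ []) ∷ [])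
    ( (-[1+ 87 ] ∷ -[1+ 37 ] ∷ -[1+ 37 ] ∷ -[1+ 37 ] ∷ -[1+ 37 ] ∷ [])
    ∷ (-[1+ 37 ] ∷    ℤ.+ 12 ∷    ℤ.+ 12 ∷    ℤ.+ 12 ∷    ℤ.+ 62 ∷ [])
    ∷ (-[1+ 37 ] ∷    ℤ.+ 12 ∷    ℤ.+ 12 ∷    ℤ.+ 62 ∷    ℤ.+ 12 ∷ [])
    ∷ (-[1+ 37 ] ∷    ℤ.+ 12 ∷    ℤ.+ 62 ∷    ℤ.+ 12 ∷    ℤ.+ 12 ∷ [])
    ∷ (-[1+ 37 ] ∷    ℤ.+ 62 ∷    ℤ.+ 12 ∷    ℤ.+ 12 ∷    ℤ.+ 12 ∷ []) ∷ [])

bilinear-θℓ : Bilinear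
bilinear-θℓ =
    (ℤ.+ 74 , d₁ , d₁) ∷ (ℤ.+ 24 , d₁ , d₂) ∷ (ℤ.+ 24 , d₂ , d₁) ∷ (ℤ.+ 74 , d₂ , d₂) ∷ (-[1+ 75 ] , d₀ , d₁) ∷
    (-[1+ 75 ] , d₁ , d₀) ∷ (-[1+ 75 ] , d₀ , d₂) ∷ (-[1+ 75 ] , d₂ , d₀) ∷ (-[1+ 175 ] , d₀ , d₀) ∷ []

κ-θℓ t-θℓ : Linear
κ-θℓ = (-[1+ 37 ] , d₁) ∷ (-[1+ 37 ] , d₂) ∷ (-[1+ 87 ] , d₀) ∷ []
t-θℓ = (-[1+ 37 ] , d₁) ∷ (-[1+ 57 ] , d₂) ∷ (-[1+ 47 ] , d₀) ∷ []

identity-θℓ : bilinear bilinear-θℓ ⊕ linear (θ ∘ series) κ-θℓ ≐ linear series t-θℓ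
identity-θℓ = bilinear-identity table-θℓ bilinear-θℓ κ-θℓ t-θℓ (toWitness {a? = valid? table-θℓ bilinear-θℓ κ-θℓ t-θℓ} _)

-- Logarithmic derivatives of the products

Σ<-single : ∀ n i (f : ℕ → ℚ) → i < n → (∀ k → k ≢ i → f k ≡ 0ℚ) → Σ< n f ≡ f i
Σ<-single (suc n) zero    f _         f≡0 = begin
  Σ< (suc n) f            ≡⟨ Σ<-suc n f ⟩
  f 0 + Σ< n (f ∘ suc)    ≡⟨ cong (f 0 +_) (Σ<-0 n λ k _ → f≡0 (suc k) λ ()) ⟩
  f 0 + 0ℚ                ≡⟨ ℚₚ.+-identityʳ (f 0) ⟩
  f 0 ∎
Σ<-single (suc n) (suc i) f (s≤s i<n) f≡0 = begin
  Σ< (suc n) f            ≡⟨ Σ<-suc n f ⟩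
  f 0 + Σ< n (f ∘ suc)    ≡⟨ cong₂ _+_ (f≡0 0 λ ()) (Σ<-single n i (f ∘ suc) i<n λ k k≢i → f≡0 (suc k) (k≢i ∘ ℕₚ.suc-injective)) ⟩
  0ℚ + f (suc i)          ≡⟨ ℚₚ.+-identityˡ (f (suc i)) ⟩
  f (suc i) ∎

Σ<-progression : ∀ n (i : Fin 5) (f : ℕ → ℚ) → (∀ a → res a ≢ i → f a ≡ 0ℚ)
  → Σ< (n ℕ.* 5) f ≡ Σ< n (λ j → f (toℕ i ℕ.+ j ℕ.* 5))
Σ<-progression zero    i f f≡0 = trans (Σ<-zero f) (sym (Σ<-zero _))
Σ<-progression (suc n) i f f≡0 = begin
  Σ< (5 ℕ.+ n ℕ.* 5) f
    ≡⟨ Σ<-++ 5 (n ℕ.* 5) f ⟩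
  Σ< 5 f + Σ< (n ℕ.* 5) (λ k → f (5 ℕ.+ k))
    ≡⟨ cong₂ _+_ first (Σ<-progression n i (λ k → f (5 ℕ.+ k)) (λ a → f≡0 (5 ℕ.+ a))) ⟩
  f (toℕ i ℕ.+ 0) + Σ< n (λ j → f (5 ℕ.+ (toℕ i ℕ.+ j ℕ.* 5)))
    ≡⟨ cong (f (toℕ i ℕ.+ 0) +_) (Σ<-cong n λ j _ → cong f (swap (toℕ i) j)) ⟩
  f (toℕ i ℕ.+ 0) + Σ< n (λ j → f (toℕ i ℕ.+ suc j ℕ.* 5))
    ≡⟨ Σ<-suc n _ ⟨
  Σ< (suc n) (λ j → f (toℕ i ℕ.+ j ℕ.* 5)) ∎
  where
  swap : ∀ i j → 5 ℕ.+ (i ℕ.+ j ℕ.* 5) ≡ i ℕ.+ suc j ℕ.* 5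
  swap = ℕSolver.solve-∀
  res-toℕ : ∀ (k : Fin 5) → res (toℕ k) ≡ k
  res-toℕ 0F = refl
  res-toℕ 1F = refl
  res-toℕ 2F = refl
  res-toℕ 3F = refl
  res-toℕ 4F = refl
  first : Σ< 5 f ≡ f (toℕ i ℕ.+ 0)
  first = begin
    Σ< 5 f                              ≡⟨ Σ<-cong 5 mask-< ⟩
    Σ< 5 mask                           ≡⟨ Σ<-single 5 (toℕ i) mask (Finₚ.toℕ<n i) mask-≢ ⟩
    mask (toℕ i)                        ≡⟨ mask-< (toℕ i) (Finₚ.toℕ<n i) ⟨
    f (toℕ i)                           ≡⟨ cong f (ℕₚ.+-identityʳ (toℕ i)) ⟨
    f (toℕ i ℕ.+ 0) ∎
    where
    mask : ℕ → ℚ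
    mask k with k ℕₚ.≟ toℕ i
    ... | yes _ = f k
    ... | no _  = 0ℚ
    mask-< : ∀ k → k < 5 → f k ≡ mask k
    mask-< k k<5 with k ℕₚ.≟ toℕ i
    ... | yes _  = refl
    ... | no k≢i = f≡0 k λ resk≡i → k≢i (begin
      k                       ≡⟨ Finₚ.toℕ-fromℕ< k<5 ⟨
      toℕ (fromℕ< k<5)        ≡⟨ cong toℕ (res-toℕ (fromℕ< k<5)) ⟨
      toℕ (res (toℕ (fromℕ< k<5))) ≡⟨ cong (toℕ ∘ res) (Finₚ.toℕ-fromℕ< k<5) ⟩
      toℕ (res k)             ≡⟨ cong toℕ resk≡i ⟩
      toℕ i ∎)
    mask-≢ : ∀ k → k ≢ toℕ i → mask k ≡ 0ℚ
    mask-≢ k k≢i with k ℕₚ.≟ toℕ i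
    ... | yes k≡i = contradiction k≡i k≢i
    ... | no _    = refl

-- The series q^d / (1 - q^d) for d ≥ 1, characterised without division by `geometric-unfold`.
geometric : ℕ → FPS
geometric d n = Σ< n (λ x → qpow (d ℕ.* suc x) n)

geometric-extend : ∀ d n N → n ≤ N → geometric (suc d) n ≡ Σ< N (λ x → qpow (suc d ℕ.* suc x) n)
geometric-extend d n N n≤N = sym (Σ<-extend _ n≤N λ x n≤x →
  qpow-≢ _ n λ eq → ℕₚ.<-irrefl (sym eq) (<suc*suc d x (inj₂ n≤x)))

geometric-unfold : ∀ d → geometric (suc d) ≐ qpow (suc d) ⊕ qpow (suc d) ⊛ geometric (suc d)
geometric-unfold d n = begin
  geometric D n
    ≡⟨ geometric-extend d n (suc n) (ℕₚ.n≤1+n n) ⟩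
  Σ< (suc n) (λ x → qpow (D ℕ.* suc x) n)
    ≡⟨ Σ<-suc n _ ⟩
  qpow (D ℕ.* 1) n + Σ< n (λ x → qpow (D ℕ.* suc (suc x)) n)
    ≡⟨ cong₂ _+_ (cong (λ k → qpow k n) (ℕₚ.*-identityʳ D)) (Σ<-cong n λ x _ →
         trans (cong (λ k → qpow k n) (ℕₚ.*-suc D (suc x))) (sym (qpow-+ D (D ℕ.* suc x) n))) ⟩
  qpow D n + Σ< n (λ x → (qpow D ⊛ qpow (D ℕ.* suc x)) n)
    ≡⟨ cong (qpow D n +_) (⊛-Σ< n (qpow D) (λ x → qpow (D ℕ.* suc x)) n) ⟨
  qpow D n + (qpow D ⊛ (λ k → Σ< n (λ x → qpow (D ℕ.* suc x) k))) n
    ≡⟨ cong (qpow D n +_) (⊛-congₙ {qpow D} n (λ _ _ → refl) (λ k k≤n → geometric-extend d k n k≤n)) ⟨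
  qpow D n + (qpow D ⊛ geometric D) n ∎
  where
  D : ℕ
  D = suc d

-- The equation θf / f = g freed of the quotient; it therefore also covers f = q and f = U, which
-- have no inverse.
LogDerivative : FPS → FPS → Set
LogDerivative f g = θ f ≐ g ⊛ f

logDerivative-⊛ : ∀ {f f′ g g′} → LogDerivative f g → LogDerivative f′ g′ → LogDerivative (f ⊛ f′) (g ⊕ g′)
logDerivative-⊛ {f} {f′} {g} {g′} θf θf′ = ≐begin
    θ (f ⊛ f′)                        ≈⟨ θ-⊛ f f′ ⟩
    θ f ⊛ f′ ⊕ f ⊛ θ f′               ≈⟨ FPSRing.+-cong (FPSRing.*-congʳ {f′} θf) (FPSRing.*-congˡ {f} θf′) ⟩
    (g ⊛ f) ⊛ f′ ⊕ f ⊛ (g′ ⊛ f′)      ≈⟨ F.solve 4 (λ f f′ g g′ → ((g F.:* f) F.:* f′ F.:+ f F.:* (g′ F.:* f′))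
                                           F.:= ((g F.:+ g′) F.:* (f F.:* f′))) (λ _ → refl) f f′ g g′ ⟩
    (g ⊕ g′) ⊛ (f ⊛ f′) ≐∎

factor : ℕ → FPS
factor d = one ⊕ ((- 1ℚ) · qpow d)

logDerivative-factor : ∀ d → LogDerivative (factor (suc d)) ((- ℕ→ℚ (suc d)) · geometric (suc d))
logDerivative-factor d = ≐begin
    θ (factor D)
      ≈⟨ (λ n → trans (θ-⊕ one ((- 1ℚ) · qpow D) n) (cong₂ _+_ (θ-one n) (trans (θ-· (- 1ℚ) (qpow D) n) (cong ((- 1ℚ) *_) (θ-qpow D n))))) ⟩
    𝟘 ⊕ (- 1ℚ) · (ℕ→ℚ D · qpow D)
      ≈⟨ (λ n → solve 2 (λ c x → con 0ℚ :+ con (- 1ℚ) :* (c :* x) := (:- c) :* x) refl (ℕ→ℚ D) (qpow D n)) ⟩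
    (- ℕ→ℚ D) · qpow D
      ≈⟨ (λ n → cong ((- ℕ→ℚ D) *_) (collapse n)) ⟩
    (- ℕ→ℚ D) · (geometric D ⊛ factor D)
      ≈⟨ FPSRing.sym (·-⊛ (- ℕ→ℚ D) (geometric D) (factor D)) ⟩
    ((- ℕ→ℚ D) · geometric D) ⊛ factor D ≐∎
  where
  D : ℕ
  D = suc d
  collapse : qpow D ≐ geometric D ⊛ factor D
  collapse = ≐begin
    qpow D
      ≈⟨ F.solve 2 (λ q g → q F.:= ((q F.:+ q F.:* g) F.:- q F.:* g)) (λ _ → refl) (qpow D) (geometric D) ⟩
    (qpow D ⊕ qpow D ⊛ geometric D) ⊕ ⊝ (qpow D ⊛ geometric D)
      ≈⟨ FPSRing.+-congʳ (FPSRing.sym (geometric-unfold d)) ⟩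
    geometric D ⊕ ⊝ (qpow D ⊛ geometric D)
      ≈⟨ F.solve 2 (λ q g → (g F.:- q F.:* g) F.:= (g F.:* (F.con 1ℚ F.:+ F.con (- 1ℚ) F.:* q))) (λ _ → refl) (qpow D) (geometric D) ⟩
    geometric D ⊛ (constant 1ℚ ⊕ constant (- 1ℚ) ⊛ qpow D)
      ≈⟨ FPSRing.*-congˡ {geometric D} (λ n → cong₂ _+_ (ℚₚ.*-identityˡ (one n)) (sym (·≐constant-⊛ (- 1ℚ) (qpow D) n))) ⟩
    geometric D ⊛ factor D ≐∎

partialSum : ℕ → ℕ → ℕ → FPS
partialSum r m N n = Σ< N (λ j → ℕ→ℚ (m ℕ.* j ℕ.+ r) * geometric (m ℕ.* j ℕ.+ r) n)

logDerivative-pochFin : ∀ r m N → LogDerivative (pochFin (suc r) m N) (⊝ partialSum (suc r) m N)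
logDerivative-pochFin r m zero n = begin
  ℕ→ℚ n * one n                   ≡⟨ θ-one n ⟩
  0ℚ                              ≡⟨ 𝟘-⊛ one n ⟨
  (𝟘 ⊛ one) n                     ≡⟨ ⊛-cong {g = one} {one} (λ k → cong -_ (sym (Σ<-zero _))) (λ _ → refl) n ⟩
  ((⊝ partialSum (suc r) m 0) ⊛ one) n ∎
logDerivative-pochFin r m (suc N) n = trans
  (logDerivative-⊛ {pochFin (suc r) m N} {factor D} {⊝ partialSum (suc r) m N} {(- ℕ→ℚ D) · geometric D}
    (logDerivative-pochFin r m N) at-D n)
  (⊛-cong {g = pochFin (suc r) m (suc N)} {pochFin (suc r) m (suc N)} extend (λ _ → refl) n)
  where
  D : ℕ
  D = m ℕ.* N ℕ.+ suc r
  at-D : LogDerivative (factor D) ((- ℕ→ℚ D) · geometric D)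
  at-D = subst (λ d → LogDerivative (factor d) ((- ℕ→ℚ d) · geometric d)) (sym (ℕₚ.+-suc (m ℕ.* N) r)) (logDerivative-factor (m ℕ.* N ℕ.+ r))
  extend : (⊝ partialSum (suc r) m N) ⊕ ((- ℕ→ℚ D) · geometric D) ≐ ⊝ partialSum (suc r) m (suc N)
  extend k = trans
    (solve 3 (λ s c g → :- s :+ (:- c) :* g := :- (s :+ c :* g)) refl (partialSum (suc r) m N k) (ℕ→ℚ D) (geometric D k))
    (cong -_ (sym (Σ<-snoc N (λ j → ℕ→ℚ (m ℕ.* j ℕ.+ suc r) * geometric (m ℕ.* j ℕ.+ suc r) k))))

-- The additional factor is 1 up to a power of q beyond q^n.
pochFin-stable : ∀ r m N n → n < suc m ℕ.* N ℕ.+ r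
  → pochFin r (suc m) (suc N) n ≡ pochFin r (suc m) N n
pochFin-stable r m N n n<D = trans
  (⊛-congₙ {pochFin r (suc m) N} n (λ _ _ → refl) λ k k≤n → trans
    (cong (λ x → one k + (- 1ℚ) * x) (qpow-≢ _ k λ D≡k → ℕₚ.<⇒≢ (ℕₚ.≤-<-trans k≤n n<D) (sym D≡k)))
    (trans (cong (one k +_) (ℚₚ.*-zeroʳ (- 1ℚ))) (ℚₚ.+-identityʳ (one k))))
  (⊛-identityʳ (pochFin r (suc m) N) n)

pochFin-qPoch : ∀ r m n k → k ≤ n → pochFin (suc r) (suc m) (suc n) k ≡ qPoch (suc r) (suc m) k
pochFin-qPoch r m n k k≤n with ℕₚ.m≤n⇒∃[o]m+o≡n k≤n
... | o , refl = go o
  where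
  go : ∀ o → pochFin (suc r) (suc m) (suc (k ℕ.+ o)) k ≡ qPoch (suc r) (suc m) k
  go zero    = cong (λ i → pochFin (suc r) (suc m) (suc i) k) (ℕₚ.+-identityʳ k)
  go (suc o) = trans (cong (λ i → pochFin (suc r) (suc m) (suc i) k) (ℕₚ.+-suc k o)) (trans
    (pochFin-stable (suc r) m (suc (k ℕ.+ o)) k (ℕₚ.≤-trans (s≤s (ℕₚ.m≤m+n k o))
      (ℕₚ.≤-trans (ℕₚ.m≤n*m (suc (k ℕ.+ o)) (suc m)) (ℕₚ.m≤m+n _ (suc r)))))
    (go o))

-- Each coefficient of the infinite product belongs to a different finite product. To compare
-- coefficients of q^n, the finite product with n + 1 factors is used for all lower coefficients as
-- well, and both it and its partial sum have already stabilised there.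
logDerivative-qPoch : ∀ r m s
  → (∀ n k → k ≤ n → partialSum (suc r) (suc m) (suc n) k ≡ s k)
  → LogDerivative (qPoch (suc r) (suc m)) (⊝ s)
logDerivative-qPoch r m s s-stable n = trans
  (logDerivative-pochFin r (suc m) (suc n) n)
  (⊛-congₙ n (λ k k≤n → cong -_ (s-stable n k k≤n)) (λ k k≤n → pochFin-qPoch r m n k k≤n))

onClass : Fin 5 → ℕ → ℚ
onClass r d = if does (res d Finₚ.≟ r) then ℕ→ℚ d else 0ℚ

onClass-≡ : ∀ r d → res d ≡ r → onClass r d ≡ ℕ→ℚ d
onClass-≡ r d eq with res d Finₚ.≟ r
... | yes _ = refl
... | no ¬eq = contradiction eq ¬eq

onClass-≢ : ∀ r d → res d ≢ r → onClass r d ≡ 0ℚ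
onClass-≢ r d ¬eq with res d Finₚ.≟ r
... | yes eq = contradiction eq ¬eq
... | no _ = refl

Lam-geometric : ∀ w n N → n ≤ N → Lam w n ≡ Σ< N (λ a → w (suc a) * geometric (suc a) n)
Lam-geometric w n N n≤N = trans (Lam-extend w n N n n≤N ℕₚ.≤-refl) (Σ<-cong N λ a _ → Σ<-*ˡ n (w (suc a)) _)

res-i+5j : ∀ i j → res (i ℕ.+ j ℕ.* 5) ≡ res i
res-i+5j i zero    = cong res (ℕₚ.+-identityʳ i)
res-i+5j i (suc j) = trans (cong res (swap i j)) (res-i+5j i j)
  where
  swap : ∀ i j → i ℕ.+ suc j ℕ.* 5 ≡ 5 ℕ.+ (i ℕ.+ j ℕ.* 5)
  swap = ℕSolver.solve-∀

-- In `Lam` the index a stands for the divisor a + 1. Adding 4 to its class recovers the class of a.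
res-suc-injective : ∀ a (i : Fin 5) → res (suc a) ≡ res (suc (toℕ i)) → res a ≡ i
res-suc-injective a i eq = trans (pred′ a) (trans (cong (λ x → res (4 ℕ.+ toℕ x)) eq) (check i))
  where
  pred′ : ∀ a → res a ≡ res (4 ℕ.+ toℕ (res (suc a)))
  pred′ 0 = refl
  pred′ 1 = refl
  pred′ 2 = refl
  pred′ 3 = refl
  pred′ 4 = refl
  pred′ (suc (suc (suc (suc (suc a))))) = pred′ a
  check : ∀ (i : Fin 5) → res (4 ℕ.+ toℕ (res (suc (toℕ i)))) ≡ i
  check 0F = refl
  check 1F = refl
  check 2F = refl
  check 3F = refl
  check 4F = refl

logDerivative-qPoch-5 : ∀ (i : Fin 5)
  → LogDerivative (qPoch (suc (toℕ i)) 5) (⊝ Lam (onClass (res (suc (toℕ i)))))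
logDerivative-qPoch-5 i n = logDerivative-qPoch (toℕ i) 4 (Lam w) partial n
  where
  r : Fin 5
  r = res (suc (toℕ i))
  w : ℕ → ℚ
  w = onClass r
  partial : ∀ n k → k ≤ n → partialSum (suc (toℕ i)) 5 (suc n) k ≡ Lam w k
  partial n k k≤n = sym (begin
    Lam w k
      ≡⟨ Lam-geometric w k (suc n ℕ.* 5) (ℕₚ.≤-trans k≤n (ℕₚ.≤-trans (ℕₚ.n≤1+n n) (ℕₚ.m≤m*n (suc n) 5))) ⟩
    Σ< (suc n ℕ.* 5) (λ a → w (suc a) * geometric (suc a) k)
      ≡⟨ Σ<-progression (suc n) i _ (λ a res≢ → trans
           (cong (_* geometric (suc a) k) (onClass-≢ r (suc a) (res≢ ∘ res-suc-injective a i)))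
           (ℚₚ.*-zeroˡ (geometric (suc a) k))) ⟩
    Σ< (suc n) (λ j → w (suc (toℕ i ℕ.+ j ℕ.* 5)) * geometric (suc (toℕ i ℕ.+ j ℕ.* 5)) k)
      ≡⟨ (Σ<-cong (suc n) λ j _ → trans
           (cong (_* geometric (suc (toℕ i ℕ.+ j ℕ.* 5)) k) (onClass-≡ r (suc (toℕ i ℕ.+ j ℕ.* 5)) (res-i+5j (suc (toℕ i)) j)))
           (cong (λ d → ℕ→ℚ d * geometric d k) (swap (toℕ i) j))) ⟩
    partialSum (suc (toℕ i)) 5 (suc n) k ∎)
    where
    swap : ∀ i j → suc (i ℕ.+ j ℕ.* 5) ≡ 5 ℕ.* j ℕ.+ suc i
    swap = ℕSolver.solve-∀

logDerivative-qPoch-1 : LogDerivative (qPoch 1 1) (⊝ Lam ℕ→ℚ)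
logDerivative-qPoch-1 n = logDerivative-qPoch 0 0 (Lam ℕ→ℚ) partial n
  where
  partial : ∀ n k → k ≤ n → partialSum 1 1 (suc n) k ≡ Lam ℕ→ℚ k
  partial n k k≤n = sym (trans (Lam-geometric ℕ→ℚ k (suc n) (ℕₚ.m≤n⇒m≤1+n k≤n))
    (Σ<-cong (suc n) λ j _ → cong (λ d → ℕ→ℚ d * geometric d k) (swap j)))
    where
    swap : ∀ j → suc j ≡ 1 ℕ.* j ℕ.+ 1
    swap = ℕSolver.solve-∀

-- `lambert` sums a function local to its definition; unification recovers it.
summand : ∀ {n x} {f : ℕ → ℚ} → x ≡ sumTo n f → ℕ → ℚ
summand {f = f} _ = f

lambertTerm : ℕ → ℕ → ℚ
lambertTerm n = summand {n} {lambert n} refl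

lambertTerm-geometric : ∀ n a → lambertTerm (suc n) (suc a) ≡ ℕ→ℚ (suc a) * geometric (suc a) (suc n)
lambertTerm-geometric n a with suc a ∣? suc n
... | no a∤n = sym (trans (cong (ℕ→ℚ (suc a) *_) (Σ<-0 (suc n) λ x _ → qpow-≢ _ (suc n) λ eq →
    a∤n (divides (suc x) (trans (sym eq) (ℕₚ.*-comm (suc a) (suc x))))))
  (ℚₚ.*-zeroʳ (ℕ→ℚ (suc a))))
... | yes (divides (suc x) eq) = sym (trans (cong (ℕ→ℚ (suc a) *_) (begin
    geometric (suc a) (suc n)
      ≡⟨ Σ<-single (suc n) x _ x<n (λ k k≢x → qpow-≢ _ (suc n) λ eq′ → k≢x (ℕₚ.suc-injective
           (ℕₚ.*-cancelˡ-≡ (suc k) (suc x) (suc a) (trans eq′ (trans eq (ℕₚ.*-comm (suc x) (suc a))))))) ⟩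
    qpow (suc a ℕ.* suc x) (suc n)
      ≡⟨ cong (λ m → qpow m (suc n)) (trans (ℕₚ.*-comm (suc a) (suc x)) (sym eq)) ⟩
    qpow (suc n) (suc n)
      ≡⟨ qpow-refl (suc n) ⟩
    1ℚ ∎)) (ℚₚ.*-identityʳ (ℕ→ℚ (suc a))))
  where
  x<n : x < suc n
  x<n = subst (x <_) (sym eq) (ℕₚ.m≤m*n (suc x) (suc a))

lambert≐Lam : lambert ≐ Lam ℕ→ℚ
lambert≐Lam zero    = sym (Σ<-zero _)
lambert≐Lam (suc n) = begin
  lambert (suc n)
    ≡⟨ sumTo≡Σ< (suc n) (lambertTerm (suc n)) ⟩
  Σ< (suc (suc n)) (lambertTerm (suc n))
    ≡⟨ Σ<-suc (suc n) (lambertTerm (suc n)) ⟩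
  0ℚ + Σ< (suc n) (λ a → lambertTerm (suc n) (suc a))
    ≡⟨ ℚₚ.+-identityˡ _ ⟩
  Σ< (suc n) (λ a → lambertTerm (suc n) (suc a))
    ≡⟨ Σ<-cong (suc n) (λ a _ → lambertTerm-geometric n a) ⟩
  Σ< (suc n) (λ a → ℕ→ℚ (suc a) * geometric (suc a) (suc n))
    ≡⟨ Lam-geometric ℕ→ℚ (suc n) (suc n) ℕₚ.≤-refl ⟨
  Lam ℕ→ℚ (suc n) ∎

5ℚ : ℚ
5ℚ = ℕ→ℚ 5

Lam-multiples-of-5 : ∀ n
  → Lam (onClass 0F) n ≡ Σ< n (λ j → Σ< n (λ x → 5ℚ * (ℕ→ℚ (suc j) * qpow (suc j ℕ.* suc x ℕ.* 5) n)))
Lam-multiples-of-5 n = begin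
  Lam w n
    ≡⟨ Lam-extend w n (n ℕ.* 5) n (ℕₚ.m≤m*n n 5) ℕₚ.≤-refl ⟩
  Σ< (n ℕ.* 5) (λ a → Σ< n (λ x → w (suc a) * qpow (suc a ℕ.* suc x) n))
    ≡⟨ Σ<-progression n 4F _ (λ a res≢ → Σ<-0 n λ x _ → trans
         (cong (_* qpow (suc a ℕ.* suc x) n) (onClass-≢ 0F (suc a) (res≢ ∘ res-suc-injective a 4F)))
         (ℚₚ.*-zeroˡ (qpow (suc a ℕ.* suc x) n))) ⟩
  Σ< n (λ j → Σ< n (λ x → w (suc j ℕ.* 5) * qpow (suc j ℕ.* 5 ℕ.* suc x) n))
    ≡⟨ (Σ<-cong n λ j _ → Σ<-cong n λ x _ → trans
         (cong₂ (λ c k → c * qpow k n)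
           (trans (onClass-≡ 0F (suc j ℕ.* 5) (res-i+5j 0 (suc j))) (ℕ→ℚ-* (suc j) 5)) (swap j x))
         (solve 3 (λ a b c → a :* b :* c := b :* (a :* c)) refl (ℕ→ℚ (suc j)) 5ℚ _)) ⟩
  Σ< n (λ j → Σ< n (λ x → 5ℚ * (ℕ→ℚ (suc j) * qpow (suc j ℕ.* suc x ℕ.* 5) n))) ∎
  where
  w : ℕ → ℚ
  w = onClass 0F
  swap : ∀ j x → suc j ℕ.* 5 ℕ.* suc x ≡ suc j ℕ.* suc x ℕ.* 5
  swap = ℕSolver.solve-∀

Lam-onClass-0-∣ : ∀ m → Lam (onClass 0F) (m ℕ.* 5) ≡ 5ℚ * Lam ℕ→ℚ m
Lam-onClass-0-∣ m = begin
  Lam (onClass 0F) n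
    ≡⟨ Lam-multiples-of-5 n ⟩
  Σ< n (λ j → Σ< n (λ x → 5ℚ * (ℕ→ℚ (suc j) * qpow (suc j ℕ.* suc x ℕ.* 5) n)))
    ≡⟨ (Σ<-cong n λ j _ → Σ<-cong n λ x _ → cong (λ q → 5ℚ * (ℕ→ℚ (suc j) * q)) (qpow-*5 (suc j ℕ.* suc x))) ⟩
  Σ< n (λ j → Σ< n (λ x → 5ℚ * (ℕ→ℚ (suc j) * qpow (suc j ℕ.* suc x) m)))
    ≡⟨ (Σ<-cong n λ j _ → Σ<-*ˡ n 5ℚ (λ x → ℕ→ℚ (suc j) * qpow (suc j ℕ.* suc x) m)) ⟩
  Σ< n (λ j → 5ℚ * Σ< n (λ x → ℕ→ℚ (suc j) * qpow (suc j ℕ.* suc x) m))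
    ≡⟨ Σ<-*ˡ n 5ℚ (λ j → Σ< n (λ x → ℕ→ℚ (suc j) * qpow (suc j ℕ.* suc x) m)) ⟩
  5ℚ * Σ< n (λ j → Σ< n (λ x → ℕ→ℚ (suc j) * qpow (suc j ℕ.* suc x) m))
    ≡⟨ cong (5ℚ *_) (Lam-extend ℕ→ℚ m n n (ℕₚ.m≤m*n m 5) (ℕₚ.m≤m*n m 5)) ⟨
  5ℚ * Lam ℕ→ℚ m ∎
  where
  n : ℕ
  n = m ℕ.* 5
  qpow-*5 : ∀ k → qpow (k ℕ.* 5) n ≡ qpow k m
  qpow-*5 k with k ℕₚ.≟ m
  ... | yes refl = trans (qpow-refl n) (sym (qpow-refl m))
  ... | no k≢m   = trans (qpow-≢ (k ℕ.* 5) n (k≢m ∘ ℕₚ.*-cancelʳ-≡ k m 5)) (sym (qpow-≢ k m k≢m))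

Lam-onClass-0-∤ : ∀ n → ¬ 5 ∣ n → Lam (onClass 0F) n ≡ 0ℚ
Lam-onClass-0-∤ n 5∤n = trans (Lam-multiples-of-5 n) (Σ<-0 n λ j _ → Σ<-0 n λ x _ → begin
  5ℚ * (ℕ→ℚ (suc j) * qpow (suc j ℕ.* suc x ℕ.* 5) n)
    ≡⟨ cong (λ q → 5ℚ * (ℕ→ℚ (suc j) * q)) (qpow-≢ _ n λ eq → 5∤n (divides (suc j ℕ.* suc x) (sym eq))) ⟩
  5ℚ * (ℕ→ℚ (suc j) * 0ℚ)
    ≡⟨ cong (5ℚ *_) (ℚₚ.*-zeroʳ (ℕ→ℚ (suc j))) ⟩
  0ℚ ∎)

-- A divisor 5j carries the weight 5j, so the divisors divisible by 5 contribute five times the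
-- Lambert series at q⁵. The factor 5 on the left clears the resulting denominator.
5𝒫 : 5ℚ · 𝒫 ≐ 5ℚ · one ⊕ (- ℕ→ℚ 24) · Lam (onClass 0F)
5𝒫 n with 5 ∣? n
... | yes (divides m refl) = begin
    5ℚ * E₂ (m ℕ.* 5 ℕ./ 5)
      ≡⟨ cong (λ k → 5ℚ * E₂ k) (ℕₘ.m*n/n≡m m 5) ⟩
    5ℚ * (one m + (- ℕ→ℚ 24) * lambert m)
      ≡⟨ cong₂ (λ x y → 5ℚ * (x + (- ℕ→ℚ 24) * y)) (one-*5 m) (lambert≐Lam m) ⟩
    5ℚ * (one (m ℕ.* 5) + (- ℕ→ℚ 24) * Lam ℕ→ℚ m)
      ≡⟨ solve 4 (λ f o c l → f :* (o :+ c :* l) := f :* o :+ c :* (f :* l)) refl 5ℚ (one (m ℕ.* 5)) (- ℕ→ℚ 24) (Lam ℕ→ℚ m) ⟩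
    5ℚ * one (m ℕ.* 5) + (- ℕ→ℚ 24) * (5ℚ * Lam ℕ→ℚ m)
      ≡⟨ cong (λ x → 5ℚ * one (m ℕ.* 5) + (- ℕ→ℚ 24) * x) (Lam-onClass-0-∣ m) ⟨
    5ℚ * one (m ℕ.* 5) + (- ℕ→ℚ 24) * Lam (onClass 0F) (m ℕ.* 5) ∎
  where
  one-*5 : ∀ m → one m ≡ one (m ℕ.* 5)
  one-*5 zero    = refl
  one-*5 (suc m) = refl
... | no 5∤n = sym (trans (cong₂ (λ x y → 5ℚ * x + (- ℕ→ℚ 24) * y) (one-∤ n 5∤n) (Lam-onClass-0-∤ n 5∤n)) refl)
  where
  one-∤ : ∀ n → ¬ 5 ∣ n → one n ≡ 0ℚ
  one-∤ zero    5∤0 = contradiction (divides 0 refl) 5∤0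
  one-∤ (suc n) _   = refl

-- The relations between U, V and 𝒫

infix 9 #_ #⁻_
#_ #⁻_ : ℕ → FPS
# n = constant (ℕ→ℚ n)
#⁻ n = constant (- ℕ→ℚ n)

affine-id : ∀ d → ℤ→ℚ (0ℤ ℤ.+ 1ℤ ℤ.* ℤ.+ d) ≡ ℕ→ℚ d
affine-id d = cong ℤ→ℚ (trans (ℤₚ.+-identityˡ (1ℤ ℤ.* ℤ.+ d)) (ℤₚ.*-identityˡ (ℤ.+ d)))

series-d₀ : series d₀ ≐ Lam (onClass 0F)
series-d₀ = Lam-cong (ℤ→ℚ ∘ weight d₀) (onClass 0F) (λ d → pointwise (suc d))
  where
  pointwise : ∀ d → ℤ→ℚ (weight d₀ d) ≡ onClass 0F d
  pointwise d with res d
  ... | 0F = affine-id d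
  ... | 1F = refl
  ... | 2F = refl
  ... | 3F = refl
  ... | 4F = refl

series-d₁ : series d₁ ≐ Lam (onClass 1F) ⊕ Lam (onClass 4F)
series-d₁ n = trans (Lam-cong (ℤ→ℚ ∘ weight d₁) (λ d → onClass 1F d + onClass 4F d) (λ d → pointwise (suc d)) n)
  (Lam-+ (onClass 1F) (onClass 4F) n)
  where
  pointwise : ∀ d → ℤ→ℚ (weight d₁ d) ≡ onClass 1F d + onClass 4F d
  pointwise d with res d
  ... | 0F = refl
  ... | 1F = trans (affine-id d) (sym (ℚₚ.+-identityʳ (ℕ→ℚ d)))
  ... | 2F = refl
  ... | 3F = refl
  ... | 4F = trans (affine-id d) (sym (ℚₚ.+-identityˡ (ℕ→ℚ d)))

series-d₂ : series d₂ ≐ Lam (onClass 2F) ⊕ Lam (onClass 3F)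
series-d₂ n = trans (Lam-cong (ℤ→ℚ ∘ weight d₂) (λ d → onClass 2F d + onClass 3F d) (λ d → pointwise (suc d)) n)
  (Lam-+ (onClass 2F) (onClass 3F) n)
  where
  pointwise : ∀ d → ℤ→ℚ (weight d₂ d) ≡ onClass 2F d + onClass 3F d
  pointwise d with res d
  ... | 0F = refl
  ... | 1F = refl
  ... | 2F = trans (affine-id d) (sym (ℚₚ.+-identityʳ (ℕ→ℚ d)))
  ... | 3F = trans (affine-id d) (sym (ℚₚ.+-identityˡ (ℕ→ℚ d)))
  ... | 4F = refl

series-all : Lam ℕ→ℚ ≐ series d₀ ⊕ (series d₁ ⊕ series d₂)
series-all n = begin
  Lam ℕ→ℚ n
    ≡⟨ Lam-cong ℕ→ℚ (λ d → w d₀ d + (w d₁ d + w d₂ d)) (λ d → pointwise (suc d)) n ⟩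
  Lam (λ d → w d₀ d + (w d₁ d + w d₂ d)) n
    ≡⟨ Lam-+ (w d₀) (λ d → w d₁ d + w d₂ d) n ⟩
  Lam (w d₀) n + Lam (λ d → w d₁ d + w d₂ d) n
    ≡⟨ cong (Lam (w d₀) n +_) (Lam-+ (w d₁) (w d₂) n) ⟩
  series d₀ n + (series d₁ n + series d₂ n) ∎
  where
  w : Weight → ℕ → ℚ
  w v = ℤ→ℚ ∘ weight v
  pointwise : ∀ d → ℕ→ℚ d ≡ w d₀ d + (w d₁ d + w d₂ d)
  pointwise d with res d
  ... | 0F = sym (trans (ℚₚ.+-identityʳ _) (affine-id d))
  ... | 1F = sym (trans (ℚₚ.+-identityˡ _) (trans (ℚₚ.+-identityʳ _) (affine-id d)))
  ... | 2F = sym (trans (ℚₚ.+-identityˡ _) (trans (ℚₚ.+-identityˡ _) (affine-id d)))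
  ... | 3F = sym (trans (ℚₚ.+-identityˡ _) (trans (ℚₚ.+-identityˡ _) (affine-id d)))
  ... | 4F = sym (trans (ℚₚ.+-identityˡ _) (trans (ℚₚ.+-identityʳ _) (affine-id d)))

-- To be used with the ring solver, which checks x = y + c (l - r).
modulo : ∀ {x y} c {l r} → l ≐ r → x ≐ y ⊕ c ⊛ (l ⊕ ⊝ r) → x ≐ y
modulo {x} {y} c {l} {r} l≐r x≐ = ≐begin
  x                       ≈⟨ x≐ ⟩
  y ⊕ c ⊛ (l ⊕ ⊝ r)       ≈⟨ FPSRing.+-congˡ {y} (FPSRing.*-congˡ {c} (FPSRing.+-congʳ {⊝ r} l≐r)) ⟩
  y ⊕ c ⊛ (r ⊕ ⊝ r)       ≈⟨ F.solve 3 (λ y c r → (y F.:+ c F.:* (r F.:- r)) F.:= y) (λ _ → refl) y c r ⟩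
  y ≐∎

-- U = A⁵ and V = B⁵.
f₁ f₂ ℓ₀ ℓ₁ ℓ₂ U V : FPS
f₁ = series g₁
f₂ = series g₂
ℓ₀ = series d₀
ℓ₁ = series d₁
ℓ₂ = series d₂
U = f₁ ⊕ #⁻ 3 ⊛ f₂
V = # 1 ⊕ # 3 ⊛ f₁ ⊕ f₂

module _ {n : ℕ} where
  open F using (Polynomial)

  num num⁻ : ℕ → Polynomial n
  num k  = F.con (ℕ→ℚ k)
  num⁻ k = F.con (- ℕ→ℚ k)

  Uₚ Vₚ : (Weight → Polynomial n) → Polynomial n
  Uₚ φ = φ g₁ F.:+ num⁻ 3 F.:* φ g₂
  Vₚ φ = num 1 F.:+ num 3 F.:* φ g₁ F.:+ φ g₂

  GUₚ GVₚ : (Weight → Polynomial n) → Polynomial n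
  GUₚ φ = num 1 F.:+ (num 3 F.:* φ d₂ F.:+ (num⁻ 2 F.:* φ d₁ F.:+ num⁻ 2 F.:* φ d₀))
  GVₚ φ = num 3 F.:* φ d₁ F.:+ (num⁻ 2 F.:* φ d₂ F.:+ num⁻ 2 F.:* φ d₀)

  linearₚ : (Weight → Polynomial n) → Linear → Polynomial n
  linearₚ φ []            = F.con 0ℚ
  linearₚ φ ((c , w) ∷ l) = F.con (ℤ→ℚ c) F.:* φ w F.:+ linearₚ φ l

  bilinearₚ : (Weight → Polynomial n) → Bilinear → Polynomial n
  bilinearₚ φ []                = F.con 0ℚ
  bilinearₚ φ ((c , v , w) ∷ l) = F.con (ℤ→ℚ c) F.:* (φ v F.:* φ w) F.:+ bilinearₚ φ l

  relationₚ : (φ θφ : Weight → Polynomial n) → Bilinear → Linear → Linear → Polynomial n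
  relationₚ φ θφ l κ t = bilinearₚ φ l F.:+ linearₚ θφ κ F.:- linearₚ φ t

  weights : (p₁ p₂ p₃ p₄ p₅ : Polynomial n) → Weight → Polynomial n
  weights p₁ p₂ p₃ p₄ p₅ g₁ = p₁
  weights p₁ p₂ p₃ p₄ p₅ g₂ = p₂
  weights p₁ p₂ p₃ p₄ p₅ d₀ = p₃
  weights p₁ p₂ p₃ p₄ p₅ d₁ = p₄
  weights p₁ p₂ p₃ p₄ p₅ d₂ = p₅

-- The derivatives enter as five further indeterminates: all that the ring solver knows of `θ` comes
-- from the relations added by `modulo`.
solve-weights : (lhs rhs : (φ θφ : Weight → F.Polynomial 10) → F.Polynomial 10) → _
solve-weights lhs rhs = F.solve 10 λ f₁ f₂ ℓ₀ ℓ₁ ℓ₂ θf₁ θf₂ θℓ₀ θℓ₁ θℓ₂ →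
  let φ = weights f₁ f₂ ℓ₀ ℓ₁ ℓ₂; θφ = weights θf₁ θf₂ θℓ₀ θℓ₁ θℓ₂ in lhs φ θφ F.:= rhs φ θφ

-- The sum of the two degree-zero relations is free of f₁ f₂, and so is 10(f₁² + f₂²), the quadratic
-- part of U² + V².
U²+V² : U ⊛ U ⊕ V ⊛ V ≐ # 1 ⊕ # 6 ⊛ (ℓ₁ ⊕ ℓ₂)
U²+V² = modulo (# 2) identity-113 (modulo (# 2) identity-122 (solve-weights
  (λ φ θφ → Uₚ φ F.:* Uₚ φ F.:+ Vₚ φ F.:* Vₚ φ)
  (λ φ θφ → num 1 F.:+ num 6 F.:* (φ d₁ F.:+ φ d₂)
    F.:+ num 2 F.:* relationₚ φ θφ bilinear-113 κ-113 t-113 F.:+ num 2 F.:* relationₚ φ θφ bilinear-122 κ-122 t-122)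
  (λ _ → refl) f₁ f₂ ℓ₀ ℓ₁ ℓ₂ (θ f₁) (θ f₂) (θ ℓ₀) (θ ℓ₁) (θ ℓ₂)))

-- The right-hand side is the Lambert series of (q;q)⁵ / (q⁵;q⁵), its weight being d times the
-- Legendre symbol mod 5. The left-hand side is UV (1/R⁵ - 11 - R⁵) for the Rogers-Ramanujan
-- continued fraction R, with R⁵ = U/V.
V²-U²-11UV : V ⊛ V ⊕ #⁻ 1 ⊛ (U ⊛ U) ⊕ #⁻ 11 ⊛ (U ⊛ V) ≐ # 1 ⊕ #⁻ 5 ⊛ ℓ₁ ⊕ # 5 ⊛ ℓ₂
V²-U²-11UV = modulo (#⁻ 5) identity-113 (modulo (# 5) identity-122 (solve-weights
  (λ φ θφ → Vₚ φ F.:* Vₚ φ F.:+ num⁻ 1 F.:* (Uₚ φ F.:* Uₚ φ) F.:+ num⁻ 11 F.:* (Uₚ φ F.:* Vₚ φ))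
  (λ φ θφ → num 1 F.:+ num⁻ 5 F.:* φ d₁ F.:+ num 5 F.:* φ d₂
    F.:+ num⁻ 5 F.:* relationₚ φ θφ bilinear-113 κ-113 t-113 F.:+ num 5 F.:* relationₚ φ θφ bilinear-122 κ-122 t-122)
  (λ _ → refl) f₁ f₂ ℓ₀ ℓ₁ ℓ₂ (θ f₁) (θ f₂) (θ ℓ₀) (θ ℓ₁) (θ ℓ₂)))

-- Read off the products: (q;q)² contributes -2(ℓ₀ + ℓ₁ + ℓ₂), the fifth powers in the denominator
-- contribute 5ℓ₂ for U and 5ℓ₁ for V, and the factor q of U contributes 1.
GU GV : FPS
GU = # 1 ⊕ (# 3 ⊛ ℓ₂ ⊕ (#⁻ 2 ⊛ ℓ₁ ⊕ #⁻ 2 ⊛ ℓ₀))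
GV = # 3 ⊛ ℓ₁ ⊕ (#⁻ 2 ⊛ ℓ₂ ⊕ #⁻ 2 ⊛ ℓ₀)

-- Both degree-one relations, brought to one side, have the form -2(θX - G X).
−½ : FPS
−½ = constant (- (ℤ.+ 1 / 2))

θU : LogDerivative U GU
θU = FPSRing.trans (λ n → trans (θ-⊕ f₁ (#⁻ 3 ⊛ f₂) n) (cong (θ f₁ n +_) (θ-constant-⊛ (- ℕ→ℚ 3) f₂ n)))
  (modulo −½ identity-θU (solve-weights
    (λ φ θφ → Uₚ θφ)
    (λ φ θφ → GUₚ φ F.:* Uₚ φ F.:+ F.con (- (ℤ.+ 1 / 2)) F.:* relationₚ φ θφ bilinear-θU κ-θU t-θU)
    (λ _ → refl) f₁ f₂ ℓ₀ ℓ₁ ℓ₂ (θ f₁) (θ f₂) (θ ℓ₀) (θ ℓ₁) (θ ℓ₂)))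

θV : LogDerivative V GV
θV = FPSRing.trans (λ n → trans (θ-⊕ (# 1 ⊕ # 3 ⊛ f₁) f₂ n) (cong (_+ θ f₂ n) (trans (θ-⊕ (# 1) (# 3 ⊛ f₁) n)
    (cong₂ _+_ (θ-constant (ℕ→ℚ 1) n) (θ-constant-⊛ (ℕ→ℚ 3) f₁ n)))))
  (FPSRing.trans (FPSRing.+-congʳ {θ f₂} (FPSRing.+-congʳ {# 3 ⊛ θ f₁} constant-0))
  (modulo −½ identity-θV (solve-weights
    (λ φ θφ → num 0 F.:+ num 3 F.:* θφ g₁ F.:+ θφ g₂)
    (λ φ θφ → GVₚ φ F.:* Vₚ φ F.:+ F.con (- (ℤ.+ 1 / 2)) F.:* relationₚ φ θφ bilinear-θV κ-θV t-θV)
    (λ _ → refl) f₁ f₂ ℓ₀ ℓ₁ ℓ₂ (θ f₁) (θ f₂) (θ ℓ₀) (θ ℓ₁) (θ ℓ₂))))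

𝒫-ℓ₀ : # 5 ⊛ 𝒫 ≐ # 5 ⊕ #⁻ 24 ⊛ ℓ₀
𝒫-ℓ₀ n = begin
  (# 5 ⊛ 𝒫) n                                     ≡⟨ ·≐constant-⊛ (ℕ→ℚ 5) 𝒫 n ⟨
  5ℚ * 𝒫 n                                        ≡⟨ 5𝒫 n ⟩
  (# 5) n + (- ℕ→ℚ 24) * Lam (onClass 0F) n       ≡⟨ cong (λ x → (# 5) n + (- ℕ→ℚ 24) * x) (series-d₀ n) ⟨
  (# 5) n + (- ℕ→ℚ 24) * ℓ₀ n                     ≡⟨ cong ((# 5) n +_) (·≐constant-⊛ (- ℕ→ℚ 24) ℓ₀ n) ⟩
  (# 5 ⊕ #⁻ 24 ⊛ ℓ₀) n ∎

QU QV : FPS → FPS → FPS → FPS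
QU u v p = #⁻ 5 ⊛ (u ⊛ u) ⊕ #⁻ 66 ⊛ (u ⊛ v) ⊕ # 7 ⊛ (v ⊛ v) ⊕ # 5 ⊛ p
QV u v p = #⁻ 5 ⊛ (v ⊛ v) ⊕ # 66 ⊛ (u ⊛ v) ⊕ # 7 ⊛ (u ⊛ u) ⊕ # 5 ⊛ p

module _ {n : ℕ} where
  open F using (Polynomial)

  QUₚ QVₚ Σₚ Δₚ : (u v p : Polynomial n) → Polynomial n
  QUₚ u v p = num⁻ 5 F.:* (u F.:* u) F.:+ num⁻ 66 F.:* (u F.:* v) F.:+ num 7 F.:* (v F.:* v) F.:+ num 5 F.:* p
  QVₚ u v p = num⁻ 5 F.:* (v F.:* v) F.:+ num 66 F.:* (u F.:* v) F.:+ num 7 F.:* (u F.:* u) F.:+ num 5 F.:* p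
  Σₚ u v l = u F.:* u F.:+ v F.:* v F.:- l
  Δₚ u v l = v F.:* v F.:+ num⁻ 1 F.:* (u F.:* u) F.:+ num⁻ 11 F.:* (u F.:* v) F.:- l

  ℓΣₚ ℓΔₚ ℓPₚ gUₚ gVₚ : (ℓ₀ ℓ₁ ℓ₂ : Polynomial n) → Polynomial n
  ℓΣₚ ℓ₀ ℓ₁ ℓ₂ = num 1 F.:+ num 6 F.:* (ℓ₁ F.:+ ℓ₂)
  ℓΔₚ ℓ₀ ℓ₁ ℓ₂ = num 1 F.:+ num⁻ 5 F.:* ℓ₁ F.:+ num 5 F.:* ℓ₂
  ℓPₚ ℓ₀ ℓ₁ ℓ₂ = num 5 F.:+ num⁻ 24 F.:* ℓ₀
  gUₚ ℓ₀ ℓ₁ ℓ₂ = num 1 F.:+ (num 3 F.:* ℓ₂ F.:+ (num⁻ 2 F.:* ℓ₁ F.:+ num⁻ 2 F.:* ℓ₀))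
  gVₚ ℓ₀ ℓ₁ ℓ₂ = num 3 F.:* ℓ₁ F.:+ (num⁻ 2 F.:* ℓ₂ F.:+ num⁻ 2 F.:* ℓ₀)

-- The coefficients -5, -66, 7, 5 arise from the combination (U² + V²) + 6(V² - U² - 11UV) + 5𝒫, the
-- one in which ℓ₀, ℓ₁, ℓ₂ occur as in 12 `GU`. For V the sign of the middle term is reversed.
12GU : # 12 ⊛ GU ≐ QU U V 𝒫
12GU = modulo (#⁻ 1) U²+V² (modulo (#⁻ 6) V²-U²-11UV (modulo (#⁻ 1) 𝒫-ℓ₀ (F.solve 6 (λ u v p ℓ₀ ℓ₁ ℓ₂ →
  (num 12 F.:* gUₚ ℓ₀ ℓ₁ ℓ₂) F.:= (QUₚ u v p
    F.:+ num⁻ 1 F.:* Σₚ u v (ℓΣₚ ℓ₀ ℓ₁ ℓ₂) F.:+ num⁻ 6 F.:* Δₚ u v (ℓΔₚ ℓ₀ ℓ₁ ℓ₂)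
    F.:+ num⁻ 1 F.:* (num 5 F.:* p F.:- ℓPₚ ℓ₀ ℓ₁ ℓ₂)))
  (λ _ → refl) U V 𝒫 ℓ₀ ℓ₁ ℓ₂)))

12GV : # 12 ⊛ GV ≐ QV U V 𝒫
12GV = modulo (#⁻ 1) U²+V² (modulo (# 6) V²-U²-11UV (modulo (#⁻ 1) 𝒫-ℓ₀ (F.solve 6 (λ u v p ℓ₀ ℓ₁ ℓ₂ →
  (num 12 F.:* gVₚ ℓ₀ ℓ₁ ℓ₂) F.:= (QVₚ u v p
    F.:+ num⁻ 1 F.:* Σₚ u v (ℓΣₚ ℓ₀ ℓ₁ ℓ₂) F.:+ num 6 F.:* Δₚ u v (ℓΔₚ ℓ₀ ℓ₁ ℓ₂)
    F.:+ num⁻ 1 F.:* (num 5 F.:* p F.:- ℓPₚ ℓ₀ ℓ₁ ℓ₂)))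
  (λ _ → refl) U V 𝒫 ℓ₀ ℓ₁ ℓ₂)))

-- Logarithmic derivatives of powers, quotients and roots

logDerivative-cong : ∀ {f g g′} → g ≐ g′ → LogDerivative f g → LogDerivative f g′
logDerivative-cong {f} {g} {g′} g≐g′ θf = FPSRing.trans θf (FPSRing.*-congʳ {f} {g} {g′} g≐g′)

logDerivative-pow : ∀ {f g} k → LogDerivative f g → LogDerivative (pow f k) (# k ⊛ g)
logDerivative-pow {f} {g} zero θf = ≐begin
  θ one             ≈⟨ θ-cong (λ n → sym (ℚₚ.*-identityˡ (one n))) ⟩
  θ (constant 1ℚ)   ≈⟨ θ-constant 1ℚ ⟩
  𝟘                 ≈⟨ constant-0 ⟩
  # 0               ≈⟨ F.solve 2 (λ g o → num 0 F.:= (num 0 F.:* g F.:* o)) (λ _ → refl) g one ⟩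
  # 0 ⊛ g ⊛ one ≐∎
logDerivative-pow {f} {g} (suc k) θf = logDerivative-cong
  {pow f (suc k)} {g ⊕ # k ⊛ g} {# (suc k) ⊛ g}
  (≐begin
    g ⊕ # k ⊛ g              ≈⟨ F.solve 2 (λ g k → (g F.:+ k F.:* g) F.:= ((num 1 F.:+ k) F.:* g)) (λ _ → refl) g (# k) ⟩
    (# 1 ⊕ # k) ⊛ g          ≈⟨ FPSRing.*-congʳ {g} (λ n → trans (sym (ℚₚ.*-distribʳ-+ (one n) 1ℚ (ℕ→ℚ k)))
                                  (cong (_* one n) (sym (ℕ→ℚ-+ 1 k)))) ⟩
    # (suc k) ⊛ g ≐∎)
  (logDerivative-⊛ {f} {pow f k} {g} {# k ⊛ g} θf (logDerivative-pow {f} {g} k θf))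

-- The product rule for f k = h, solved for θf by cancelling k. The defining equations of a and b
-- are of this form, with the Pochhammer products not yet divided out.
logDerivative-quotient : ∀ {f k h s t} → k 0 ≡ 1ℚ → f ⊛ k ≐ h
  → LogDerivative k s → LogDerivative h t → LogDerivative f (t ⊕ ⊝ s)
logDerivative-quotient {f} {k} {h} {s} {t} k₀≡1 fk≐h θk θh = ⊛-cancelʳ (θ f) ((t ⊕ ⊝ s) ⊛ f) k k₀≡1 (≐begin
  θ f ⊛ k
    ≈⟨ F.solve 4 (λ f k df dk → (df F.:* k) F.:= (df F.:* k F.:+ f F.:* dk F.:- f F.:* dk)) (λ _ → refl) f k (θ f) (θ k) ⟩
  (θ f ⊛ k ⊕ f ⊛ θ k) ⊕ ⊝ (f ⊛ θ k)
    ≈⟨ FPSRing.+-cong (FPSRing.sym (θ-⊛ f k)) (FPSRing.-‿cong (FPSRing.*-congˡ {f} θk)) ⟩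
  θ (f ⊛ k) ⊕ ⊝ (f ⊛ (s ⊛ k))
    ≈⟨ FPSRing.+-congʳ {⊝ (f ⊛ (s ⊛ k))} (FPSRing.trans (θ-cong fk≐h) (FPSRing.trans θh (FPSRing.*-congˡ {t} (FPSRing.sym fk≐h)))) ⟩
  t ⊛ (f ⊛ k) ⊕ ⊝ (f ⊛ (s ⊛ k))
    ≈⟨ F.solve 4 (λ f k s t → (t F.:* (f F.:* k) F.:- f F.:* (s F.:* k)) F.:= ((t F.:- s) F.:* f F.:* k)) (λ _ → refl) f k s t ⟩
  ((t ⊕ ⊝ s) ⊛ f) ⊛ k ≐∎)

pow-0 : ∀ {f} k → f 0 ≡ 1ℚ → pow f k 0 ≡ 1ℚ
pow-0 zero    f₀≡1 = refl
pow-0 {f} (suc k) f₀≡1 = cong₂ _*_ f₀≡1 (pow-0 {f} k f₀≡1)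

θ-pow : ∀ f k → θ (pow f (suc k)) ≐ # (suc k) ⊛ (pow f k ⊛ θ f)
θ-pow f zero = ≐begin
  θ (f ⊛ one)                   ≈⟨ θ-cong (⊛-identityʳ f) ⟩
  θ f                           ≈⟨ FPSRing.sym (one-⊛ (θ f)) ⟩
  one ⊛ θ f                     ≈⟨ F.solve 1 (λ x → x F.:= (num 1 F.:* x)) (λ _ → refl) (one ⊛ θ f) ⟩
  # 1 ⊛ (one ⊛ θ f) ≐∎
θ-pow f (suc k) = ≐begin
  θ (f ⊛ pow f (suc k))
    ≈⟨ θ-⊛ f (pow f (suc k)) ⟩
  θ f ⊛ pow f (suc k) ⊕ f ⊛ θ (pow f (suc k))
    ≈⟨ FPSRing.+-congˡ {θ f ⊛ pow f (suc k)} (FPSRing.*-congˡ {f} (θ-pow f k)) ⟩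
  θ f ⊛ (f ⊛ pow f k) ⊕ f ⊛ (# (suc k) ⊛ (pow f k ⊛ θ f))
    ≈⟨ F.solve 4 (λ f p d c → (d F.:* (f F.:* p) F.:+ f F.:* (c F.:* (p F.:* d))) F.:= ((num 1 F.:+ c) F.:* ((f F.:* p) F.:* d)))
         (λ _ → refl) f (pow f k) (θ f) (# (suc k)) ⟩
  (# 1 ⊕ # (suc k)) ⊛ (pow f (suc k) ⊛ θ f)
    ≈⟨ FPSRing.*-congʳ {pow f (suc k) ⊛ θ f} (λ n → trans (sym (ℚₚ.*-distribʳ-+ (one n) 1ℚ (ℕ→ℚ (suc k))))
         (cong (_* one n) (sym (ℕ→ℚ-+ 1 (suc k))))) ⟩
  # (suc (suc k)) ⊛ (pow f (suc k) ⊛ θ f) ≐∎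

-- The chain rule exhibits the factor f^k on both sides, and it can be cancelled because f has
-- constant term 1.
logDerivative-root : ∀ f k {s} → f 0 ≡ 1ℚ → LogDerivative (pow f (suc k)) s → # (suc k) ⊛ θ f ≐ s ⊛ f
logDerivative-root f k {s} f₀≡1 θfᵏ = ⊛-cancelʳ (# (suc k) ⊛ θ f) (s ⊛ f) (pow f k) (pow-0 {f} k f₀≡1) (≐begin
  # (suc k) ⊛ θ f ⊛ pow f k
    ≈⟨ F.solve 3 (λ c d p → (c F.:* d F.:* p) F.:= (c F.:* (p F.:* d))) (λ _ → refl) (# (suc k)) (θ f) (pow f k) ⟩
  # (suc k) ⊛ (pow f k ⊛ θ f)
    ≈⟨ FPSRing.trans (FPSRing.sym (θ-pow f k)) θfᵏ ⟩
  s ⊛ (f ⊛ pow f k)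
    ≈⟨ FPSRing.sym (⊛-assoc s f (pow f k)) ⟩
  s ⊛ f ⊛ pow f k ≐∎)

qPoch-0 : ∀ r m → qPoch (suc r) m 0 ≡ 1ℚ
qPoch-0 r m = cong (λ x → 1ℚ * (1ℚ + (- 1ℚ) * x)) (qpow-≢ (m ℕ.* 0 ℕ.+ suc r) 0 λ eq →
  ℕₚ.1+n≢0 (trans (sym (ℕₚ.+-suc (m ℕ.* 0) r)) eq))

logDerivative-quintic : ∀ f (i j : Fin 5)
  → pow f 5 ⊛ pow (qPoch (suc (toℕ i)) 5) 5 ⊛ pow (qPoch (suc (toℕ j)) 5) 5 ≐ pow (qPoch 1 1) 2
  → LogDerivative (pow f 5) (#⁻ 2 ⊛ (ℓ₀ ⊕ (ℓ₁ ⊕ ℓ₂))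
      ⊕ # 5 ⊛ (Lam (onClass (res (suc (toℕ i)))) ⊕ Lam (onClass (res (suc (toℕ j))))))
logDerivative-quintic f i j eq = logDerivative-cong
  {pow f 5} {# 2 ⊛ ⊝ Lam ℕ→ℚ ⊕ ⊝ (# 5 ⊛ ⊝ Lᵢ ⊕ # 5 ⊛ ⊝ Lⱼ)} {#⁻ 2 ⊛ (ℓ₀ ⊕ (ℓ₁ ⊕ ℓ₂)) ⊕ # 5 ⊛ (Lᵢ ⊕ Lⱼ)}
  (modulo (#⁻ 2) series-all (F.solve 4 (λ all l x y →
    (num 2 F.:* (F.:- all) F.:- (num 5 F.:* (F.:- x) F.:+ num 5 F.:* (F.:- y))) F.:=
    ((num⁻ 2 F.:* l F.:+ num 5 F.:* (x F.:+ y)) F.:+ num⁻ 2 F.:* (all F.:- l)))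
    (λ _ → refl) (Lam ℕ→ℚ) (ℓ₀ ⊕ (ℓ₁ ⊕ ℓ₂)) Lᵢ Lⱼ))
  (logDerivative-quotient {pow f 5} {pow Qᵢ 5 ⊛ pow Qⱼ 5} {pow (qPoch 1 1) 2} {# 5 ⊛ ⊝ Lᵢ ⊕ # 5 ⊛ ⊝ Lⱼ} {# 2 ⊛ ⊝ Lam ℕ→ℚ}
    (cong₂ _*_ (pow-0 {Qᵢ} 5 (qPoch-0 (toℕ i) 5)) (pow-0 {Qⱼ} 5 (qPoch-0 (toℕ j) 5)))
    (FPSRing.trans (FPSRing.sym (⊛-assoc (pow f 5) (pow Qᵢ 5) (pow Qⱼ 5))) eq)
    (logDerivative-⊛ {pow Qᵢ 5} {pow Qⱼ 5} {# 5 ⊛ ⊝ Lᵢ} {# 5 ⊛ ⊝ Lⱼ}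
      (logDerivative-pow {Qᵢ} {⊝ Lᵢ} 5 (logDerivative-qPoch-5 i)) (logDerivative-pow {Qⱼ} {⊝ Lⱼ} 5 (logDerivative-qPoch-5 j)))
    (logDerivative-pow {qPoch 1 1} {⊝ Lam ℕ→ℚ} 2 logDerivative-qPoch-1))
  where
  Qᵢ Qⱼ Lᵢ Lⱼ : FPS
  Qᵢ = qPoch (suc (toℕ i)) 5
  Qⱼ = qPoch (suc (toℕ j)) 5
  Lᵢ = Lam (onClass (res (suc (toℕ i))))
  Lⱼ = Lam (onClass (res (suc (toℕ j))))

series-0 : ∀ w → series w 0 ≡ 0ℚ
series-0 w = Σ<-zero _

series-1 : ∀ w → series w 1 ≡ ℤ→ℚ (weight w 1) * 1ℚ
series-1 w = trans (Σ<-1 _) (Σ<-1 _)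

GV-0 : GV 0 ≡ ℕ→ℚ 0
GV-0 = trans (cong₂ (λ x y → x + y) (cong (ℕ→ℚ 3 * 1ℚ *_) (series-0 d₁))
  (cong₂ _+_ (cong ((- ℕ→ℚ 2) * 1ℚ *_) (series-0 d₂)) (cong ((- ℕ→ℚ 2) * 1ℚ *_) (series-0 d₀)))) refl

GU-0 : GU 0 ≡ ℕ→ℚ 1
GU-0 = trans (cong (1ℚ +_) (cong₂ (λ x y → x + y) (cong (ℕ→ℚ 3 * 1ℚ *_) (series-0 d₂))
  (cong₂ _+_ (cong ((- ℕ→ℚ 2) * 1ℚ *_) (series-0 d₁)) (cong ((- ℕ→ℚ 2) * 1ℚ *_) (series-0 d₀))))) refl

V-0 : V 0 ≡ 1ℚ
V-0 = trans (cong₂ (λ x y → 1ℚ + ℕ→ℚ 3 * 1ℚ * x + y) (series-0 g₁) (series-0 g₂)) refl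

U-0 : U 0 ≡ 0ℚ
U-0 = trans (cong₂ (λ x y → x + (- ℕ→ℚ 3) * 1ℚ * y) (series-0 g₁) (series-0 g₂)) refl

U-1 : U 1 ≡ 1ℚ
U-1 = trans (cong (f₁ 1 +_) (sym (·≐constant-⊛ (- ℕ→ℚ 3) f₂ 1)))
  (trans (cong₂ (λ x y → x + (- ℕ→ℚ 3) * y) (series-1 g₁) (series-1 g₂)) refl)

θ𝒫-ℓ₀ : # 5 ⊛ θ 𝒫 ≐ #⁻ 24 ⊛ θ ℓ₀
θ𝒫-ℓ₀ = ≐begin
  # 5 ⊛ θ 𝒫                       ≈⟨ FPSRing.sym (θ-constant-⊛ (ℕ→ℚ 5) 𝒫) ⟩
  θ (# 5 ⊛ 𝒫)                     ≈⟨ θ-cong 𝒫-ℓ₀ ⟩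
  θ (# 5 ⊕ #⁻ 24 ⊛ ℓ₀)            ≈⟨ θ-⊕ (# 5) (#⁻ 24 ⊛ ℓ₀) ⟩
  θ (# 5) ⊕ θ (#⁻ 24 ⊛ ℓ₀)        ≈⟨ FPSRing.+-cong (θ-constant (ℕ→ℚ 5)) (θ-constant-⊛ (- ℕ→ℚ 24) ℓ₀) ⟩
  𝟘 ⊕ #⁻ 24 ⊛ θ ℓ₀                ≈⟨ FPSRing.+-identityˡ (#⁻ 24 ⊛ θ ℓ₀) ⟩
  #⁻ 24 ⊛ θ ℓ₀ ≐∎

θ-square : ∀ {f g} → LogDerivative f g → θ (f ⊛ f) ≐ # 2 ⊛ g ⊛ (f ⊛ f)
θ-square {f} {g} θf = FPSRing.trans (logDerivative-⊛ {f} {f} {g} {g} θf θf)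
  (F.solve 2 (λ f g → ((g F.:+ g) F.:* (f F.:* f)) F.:= (num 2 F.:* g F.:* (f F.:* f))) (λ _ → refl) f g)

-- The derivative of `U²+V²`. It suffices for the degree-two relation, where `κ-θℓ` gives θℓ₁ and
-- θℓ₂ the same coefficient.
θℓ₁+θℓ₂ : # 6 ⊛ (θ ℓ₁ ⊕ θ ℓ₂) ≐ # 2 ⊛ GU ⊛ (U ⊛ U) ⊕ # 2 ⊛ GV ⊛ (V ⊛ V)
θℓ₁+θℓ₂ = ≐begin
  # 6 ⊛ (θ ℓ₁ ⊕ θ ℓ₂)
    ≈⟨ FPSRing.*-congˡ {# 6} (FPSRing.sym (θ-⊕ ℓ₁ ℓ₂)) ⟩
  # 6 ⊛ θ (ℓ₁ ⊕ ℓ₂)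
    ≈⟨ FPSRing.sym (θ-constant-⊛ (ℕ→ℚ 6) (ℓ₁ ⊕ ℓ₂)) ⟩
  θ (# 6 ⊛ (ℓ₁ ⊕ ℓ₂))
    ≈⟨ FPSRing.sym (FPSRing.+-identityˡ (θ (# 6 ⊛ (ℓ₁ ⊕ ℓ₂)))) ⟩
  𝟘 ⊕ θ (# 6 ⊛ (ℓ₁ ⊕ ℓ₂))
    ≈⟨ FPSRing.+-congʳ {θ (# 6 ⊛ (ℓ₁ ⊕ ℓ₂))} (FPSRing.sym (θ-constant (ℕ→ℚ 1))) ⟩
  θ (# 1) ⊕ θ (# 6 ⊛ (ℓ₁ ⊕ ℓ₂))
    ≈⟨ FPSRing.sym (θ-⊕ (# 1) (# 6 ⊛ (ℓ₁ ⊕ ℓ₂))) ⟩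
  θ (# 1 ⊕ # 6 ⊛ (ℓ₁ ⊕ ℓ₂))
    ≈⟨ θ-cong (FPSRing.sym U²+V²) ⟩
  θ (U ⊛ U ⊕ V ⊛ V)
    ≈⟨ θ-⊕ (U ⊛ U) (V ⊛ V) ⟩
  θ (U ⊛ U) ⊕ θ (V ⊛ V)
    ≈⟨ FPSRing.+-cong (θ-square {U} {GU} θU) (θ-square {V} {GV} θV) ⟩
  # 2 ⊛ GU ⊛ (U ⊛ U) ⊕ # 2 ⊛ GV ⊛ (V ⊛ V) ≐∎

-- E₄(q⁵) as a polynomial in U and V.
E₄ : FPS → FPS → FPS
E₄ u v = v ⊛ v ⊛ (v ⊛ v) ⊕ #⁻ 12 ⊛ (u ⊛ v ⊛ (v ⊛ v)) ⊕ # 14 ⊛ (u ⊛ u ⊛ (v ⊛ v))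
  ⊕ # 12 ⊛ (u ⊛ u ⊛ (u ⊛ v)) ⊕ u ⊛ u ⊛ (u ⊛ u)

E₄ₚ : ∀ {n} → (u v : F.Polynomial n) → F.Polynomial n
E₄ₚ u v = v F.:* v F.:* (v F.:* v) F.:+ num⁻ 12 F.:* (u F.:* v F.:* (v F.:* v))
  F.:+ num 14 F.:* (u F.:* u F.:* (v F.:* v))
  F.:+ num 12 F.:* (u F.:* u F.:* (u F.:* v)) F.:+ u F.:* u F.:* (u F.:* u)

-- σ, δ and π express ℓ₁ + ℓ₂, ℓ₁ - ℓ₂ and ℓ₀ in terms of U, V and 𝒫.
θ𝒫 : θ 𝒫 ≐ constant (ℤ.+ 5 / 12) ⊛ (𝒫 ⊛ 𝒫 ⊕ ⊝ E₄ U V)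
θ𝒫 =
  modulo (constant (ℤ.+ 1 / 5)) θ𝒫-ℓ₀
  -- This relation contains -88 θℓ₀ and -38 (θℓ₁ + θℓ₂). The factor 3/55 turns 88 into 24/5,
  -- matching `θ𝒫-ℓ₀`; then 38 · 3/55 = 6 · 19/55 gives the next multiplier, and 19/330 is 2/12 of
  -- that one.
  (modulo (constant (ℤ.+ 3 / 55)) identity-θℓ
  (modulo (constant (ℤ.+ 19 / 55)) θℓ₁+θℓ₂
  (modulo (constant (ℤ.+ 19 / 330) ⊛ (U ⊛ U)) 12GU
  (modulo (constant (ℤ.+ 19 / 330) ⊛ (V ⊛ V)) 12GV
  -- Apart from derivatives, `identity-θℓ` is 49s² + 25t² - 152ℓ₀s - 176ℓ₀² + 48s - 10t + 48ℓ₀ with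
  -- s = ℓ₁ + ℓ₂ and t = ℓ₁ - ℓ₂. The last three multipliers are its divided differences when s, t,
  -- ℓ₀ are replaced in turn by σ, δ, π; the prefactors are, up to sign, 3/55 divided by 6, 5 and
  -- 24.
  (modulo (constant (ℤ.+ 1 / 110) ⊛ (# 49 ⊛ (ℓ₁ ⊕ ℓ₂ ⊕ σ) ⊕ #⁻ 152 ⊛ ℓ₀ ⊕ # 48)) U²+V²
  (modulo (constant (- (ℤ.+ 3 / 275)) ⊛ (# 25 ⊛ (ℓ₁ ⊕ ⊝ ℓ₂ ⊕ δ) ⊕ #⁻ 10)) V²-U²-11UV
  (modulo (constant (- (ℤ.+ 1 / 440)) ⊛ (#⁻ 152 ⊛ σ ⊕ #⁻ 176 ⊛ (ℓ₀ ⊕ π) ⊕ # 48)) 𝒫-ℓ₀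
  (F.solve 10 (λ u v p ℓ₀ ℓ₁ ℓ₂ θp θℓ₀ θℓ₁ θℓ₂ →
    let φ = weights (num 0) (num 0) ℓ₀ ℓ₁ ℓ₂
        θφ = weights (num 0) (num 0) θℓ₀ θℓ₁ θℓ₂
        σ = F.con (ℤ.+ 1 / 6) F.:* (u F.:* u F.:+ v F.:* v F.:- num 1)
        δ = F.con (ℤ.+ 1 / 5) F.:* (num 1 F.:- (v F.:* v F.:+ num⁻ 1 F.:* (u F.:* u) F.:+ num⁻ 11 F.:* (u F.:* v)))
        π = F.con (ℤ.+ 5 / 24) F.:* (num 1 F.:- p)
    in θp F.:= (F.con (ℤ.+ 5 / 12) F.:* (p F.:* p F.:- E₄ₚ u v)
      F.:+ F.con (ℤ.+ 1 / 5) F.:* (num 5 F.:* θp F.:- num⁻ 24 F.:* θℓ₀)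
      F.:+ F.con (ℤ.+ 3 / 55) F.:* relationₚ φ θφ bilinear-θℓ κ-θℓ t-θℓ
      F.:+ F.con (ℤ.+ 19 / 55) F.:* (num 6 F.:* (θℓ₁ F.:+ θℓ₂)
        F.:- (num 2 F.:* gUₚ ℓ₀ ℓ₁ ℓ₂ F.:* (u F.:* u) F.:+ num 2 F.:* gVₚ ℓ₀ ℓ₁ ℓ₂ F.:* (v F.:* v)))
      F.:+ F.con (ℤ.+ 19 / 330) F.:* (u F.:* u) F.:* (num 12 F.:* gUₚ ℓ₀ ℓ₁ ℓ₂ F.:- QUₚ u v p)
      F.:+ F.con (ℤ.+ 19 / 330) F.:* (v F.:* v) F.:* (num 12 F.:* gVₚ ℓ₀ ℓ₁ ℓ₂ F.:- QVₚ u v p)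
      F.:+ F.con (ℤ.+ 1 / 110) F.:* (num 49 F.:* (ℓ₁ F.:+ ℓ₂ F.:+ σ) F.:+ num⁻ 152 F.:* ℓ₀ F.:+ num 48)
        F.:* Σₚ u v (ℓΣₚ ℓ₀ ℓ₁ ℓ₂)
      F.:+ F.con (- (ℤ.+ 3 / 275)) F.:* (num 25 F.:* (ℓ₁ F.:- ℓ₂ F.:+ δ) F.:+ num⁻ 10) F.:* Δₚ u v (ℓΔₚ ℓ₀ ℓ₁ ℓ₂)
      F.:+ F.con (- (ℤ.+ 1 / 440)) F.:* (num⁻ 152 F.:* σ F.:+ num⁻ 176 F.:* (ℓ₀ F.:+ π) F.:+ num 48)
        F.:* (num 5 F.:* p F.:- ℓPₚ ℓ₀ ℓ₁ ℓ₂)))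
   (λ _ → refl) U V 𝒫 ℓ₀ ℓ₁ ℓ₂ (θ 𝒫) (θ ℓ₀) (θ ℓ₁) (θ ℓ₂)))))))))
  where
  σ δ π : FPS
  σ = constant (ℤ.+ 1 / 6) ⊛ (U ⊛ U ⊕ V ⊛ V ⊕ ⊝ # 1)
  δ = constant (ℤ.+ 1 / 5) ⊛ (# 1 ⊕ ⊝ (V ⊛ V ⊕ #⁻ 1 ⊛ (U ⊛ U) ⊕ #⁻ 11 ⊛ (U ⊛ V)))
  π = constant (ℤ.+ 5 / 24) ⊛ (# 1 ⊕ ⊝ 𝒫)

-- Return from U and V to the fifth roots

GA : FPS
GA = # 3 ⊛ ℓ₂ ⊕ (#⁻ 2 ⊛ ℓ₁ ⊕ #⁻ 2 ⊛ ℓ₀)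

pow-cong : ∀ {f g} k → f ≐ g → pow f k ≐ pow g k
pow-cong zero    f≐g = FPSRing.refl {one}
pow-cong {f} {g} (suc k) f≐g = ⊛-cong {f} {g} {pow f k} {pow g k} f≐g (pow-cong {f} {g} k f≐g)

pow-⊛ : ∀ f g k → pow f k ⊛ pow g k ≐ pow (f ⊛ g) k
pow-⊛ f g zero    = one-⊛ one
pow-⊛ f g (suc k) = FPSRing.trans
  (F.solve 4 (λ f g p q → (f F.:* p F.:* (g F.:* q)) F.:= (f F.:* g F.:* (p F.:* q))) (λ _ → refl) f g (pow f k) (pow g k))
  (FPSRing.*-congˡ {f ⊛ g} (pow-⊛ f g k))

pow-* : ∀ f k l → pow f (k ℕ.* l) ≐ pow (pow f l) k
pow-* f zero    l = FPSRing.refl {one}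
pow-* f (suc k) l = FPSRing.trans (pow-+ f l (k ℕ.* l)) (FPSRing.*-congˡ {pow f l} (pow-* f k l))

qpow-pow : ∀ k → qpow k ≐ pow (qpow 1) k
qpow-pow zero    = qpow-zero
qpow-pow (suc k) = FPSRing.trans (FPSRing.sym (qpow-+ 1 k)) (FPSRing.*-congˡ {qpow 1} (qpow-pow k))

scale : ∀ c {f g} → f ≐ g → c · f ≐ constant c ⊛ g
scale c {f} {g} f≐g n = trans (cong (c *_) (f≐g n)) (·≐constant-⊛ c g n)

module Solution (a b : FPS) (a₀≡1 : a 0 ≡ 1ℚ) (b₀≡1 : b 0 ≡ 1ℚ)
  (a⁵ : pow a 5 ⊛ pow (qPoch 2 5) 5 ⊛ pow (qPoch 3 5) 5 ≐ pow (qPoch 1 1) 2)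
  (b⁵ : pow b 5 ⊛ pow (qPoch 1 5) 5 ⊛ pow (qPoch 4 5) 5 ≐ pow (qPoch 1 1) 2)
  where

  logDerivative-b⁵ : LogDerivative (pow b 5) GV
  logDerivative-b⁵ = logDerivative-cong {pow b 5} {#⁻ 2 ⊛ (ℓ₀ ⊕ (ℓ₁ ⊕ ℓ₂)) ⊕ # 5 ⊛ (Lam (onClass 1F) ⊕ Lam (onClass 4F))} {GV}
    (modulo (#⁻ 5) series-d₁ (F.solve 4 (λ l₀ l₁ l₂ s →
      (num⁻ 2 F.:* (l₀ F.:+ (l₁ F.:+ l₂)) F.:+ num 5 F.:* s) F.:= (gVₚ l₀ l₁ l₂ F.:+ num⁻ 5 F.:* (l₁ F.:- s)))
      (λ _ → refl) ℓ₀ ℓ₁ ℓ₂ (Lam (onClass 1F) ⊕ Lam (onClass 4F))))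
    (logDerivative-quintic b 0F 3F b⁵)

  -- `GA` is `GU` without the summand 1, which belongs to the factor q in q a⁵.
  logDerivative-a⁵ : LogDerivative (pow a 5) GA
  logDerivative-a⁵ = logDerivative-cong {pow a 5} {#⁻ 2 ⊛ (ℓ₀ ⊕ (ℓ₁ ⊕ ℓ₂)) ⊕ # 5 ⊛ (Lam (onClass 2F) ⊕ Lam (onClass 3F))} {GA}
    (modulo (#⁻ 5) series-d₂ (F.solve 4 (λ l₀ l₁ l₂ s →
      (num⁻ 2 F.:* (l₀ F.:+ (l₁ F.:+ l₂)) F.:+ num 5 F.:* s)
      F.:= ((num 3 F.:* l₂ F.:+ (num⁻ 2 F.:* l₁ F.:+ num⁻ 2 F.:* l₀)) F.:+ num⁻ 5 F.:* (l₂ F.:- s)))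
      (λ _ → refl) ℓ₀ ℓ₁ ℓ₂ (Lam (onClass 2F) ⊕ Lam (onClass 3F))))
    (logDerivative-quintic a 1F 2F a⁵)

  logDerivative-qa⁵ : LogDerivative (qpow 1 ⊛ pow a 5) GU
  logDerivative-qa⁵ = logDerivative-⊛ {qpow 1} {pow a 5} {# 1} {GA}
    (λ n → trans (θ-qpow 1 n) (·≐constant-⊛ (ℕ→ℚ 1) (qpow 1) n)) logDerivative-a⁵

  V≐b⁵ : pow b 5 ≐ V
  V≐b⁵ = linearODE-unique GV (pow b 5) V 0 GV-0
    (λ { zero _ → trans (pow-0 {b} 5 b₀≡1) (sym V-0) }) logDerivative-b⁵ θV

  U≐qa⁵ : qpow 1 ⊛ pow a 5 ≐ U
  U≐qa⁵ = linearODE-unique GU (qpow 1 ⊛ pow a 5) U 1 GU-0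
    -- As `GU` has constant term 1, the coefficient of q is not determined by the equation and has
    -- to be compared as well.
    (λ { zero _       → trans (ℚₚ.*-zeroˡ (pow a 5 0)) (sym U-0)
       ; (suc zero) _ → trans (qpow-suc-⊛ 0 (pow a 5) 0) (trans (ℚₚ.*-identityˡ (pow a 5 0)) (trans (pow-0 {a} 5 a₀≡1) (sym U-1)))
       ; (suc (suc _)) (s≤s ()) }) logDerivative-qa⁵ θU

  qⁱa⁵ⁱ : ∀ i → qpow i ⊛ pow a (i ℕ.* 5) ≐ pow U i
  qⁱa⁵ⁱ i = ≐begin
    qpow i ⊛ pow a (i ℕ.* 5)             ≈⟨ ⊛-cong (qpow-pow i) (pow-* a i 5) ⟩
    pow (qpow 1) i ⊛ pow (pow a 5) i     ≈⟨ pow-⊛ (qpow 1) (pow a 5) i ⟩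
    pow (qpow 1 ⊛ pow a 5) i             ≈⟨ pow-cong {qpow 1 ⊛ pow a 5} {U} i U≐qa⁵ ⟩
    pow U i ≐∎

  b⁵ʲ : ∀ j → pow b (j ℕ.* 5) ≐ pow V j
  b⁵ʲ j = FPSRing.trans (pow-* b j 5) (pow-cong {pow b 5} {V} j V≐b⁵)

  qⁱb⁵ʲa⁵ⁱ : ∀ i j → qpow i ⊛ pow b (j ℕ.* 5) ⊛ pow a (i ℕ.* 5) ≐ pow U i ⊛ pow V j
  qⁱb⁵ʲa⁵ⁱ i j = FPSRing.trans
    (F.solve 3 (λ q a b → (q F.:* b F.:* a) F.:= (q F.:* a F.:* b)) (λ _ → refl) (qpow i) (pow a (i ℕ.* 5)) (pow b (j ℕ.* 5)))
    (⊛-cong (qⁱa⁵ⁱ i) (b⁵ʲ j))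

  square : ∀ f → pow f 2 ≐ f ⊛ f
  square f = F.solve 1 (λ f → (f F.:^ 2) F.:= (f F.:* f)) (λ _ → refl) f

  q²a¹⁰ : qpow 2 ⊛ pow a 10 ≐ U ⊛ U
  q²a¹⁰ = FPSRing.trans (qⁱa⁵ⁱ 2) (square U)

  b¹⁰ : pow b 10 ≐ V ⊛ V
  b¹⁰ = FPSRing.trans (b⁵ʲ 2) (square V)

  qa⁵b⁵ : qpow 1 ⊛ pow a 5 ⊛ pow b 5 ≐ U ⊛ V
  qa⁵b⁵ = ⊛-cong U≐qa⁵ V≐b⁵

  θa : (ℤ.+ 1 / 5) · a ⊕ θ a
    ≐ (ℤ.+ 1 / 60) · (a ⊛ ( ℤ→ℚ -[1+ 4 ] · (qpow 2 ⊛ pow a 10)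
                          ⊕ ℤ→ℚ -[1+ 65 ] · (qpow 1 ⊛ pow a 5 ⊛ pow b 5)
                          ⊕ ℤ→ℚ (ℤ.+ 7) · pow b 10
                          ⊕ ℤ→ℚ (ℤ.+ 5) · 𝒫))
  θa = ≐begin
    (ℤ.+ 1 / 5) · a ⊕ θ a
      ≈⟨ FPSRing.+-congʳ {θ a} (·≐constant-⊛ (ℤ.+ 1 / 5) a) ⟩
    constant (ℤ.+ 1 / 5) ⊛ a ⊕ θ a
      -- From 5θa = `GA` a, the summand a/5 supplies the 1 in `GU` = 1 + `GA`, so that 60 times the
      -- left side is 12 `GU` a.
      ≈⟨ modulo (constant (ℤ.+ 1 / 5)) (logDerivative-root a 4 {GA} a₀≡1 logDerivative-a⁵)
           (modulo (constant (ℤ.+ 1 / 60) ⊛ a) 12GU (F.solve 4 (λ a θa g q →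
             (F.con (ℤ.+ 1 / 5) F.:* a F.:+ θa) F.:= (F.con (ℤ.+ 1 / 60) F.:* (a F.:* q)
               F.:+ F.con (ℤ.+ 1 / 5) F.:* (num 5 F.:* θa F.:- g F.:* a)
               F.:+ F.con (ℤ.+ 1 / 60) F.:* a F.:* (num 12 F.:* (num 1 F.:+ g) F.:- q)))
             (λ _ → refl) a (θ a) GA (QU U V 𝒫))) ⟩
    constant (ℤ.+ 1 / 60) ⊛ (a ⊛ QU U V 𝒫)
      ≈⟨ FPSRing.sym (scale (ℤ.+ 1 / 60) (FPSRing.*-congˡ {a} (FPSRing.+-cong (FPSRing.+-cong (FPSRing.+-cong
           (scale (ℤ→ℚ -[1+ 4 ]) q²a¹⁰) (scale (ℤ→ℚ -[1+ 65 ]) qa⁵b⁵))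
           (scale (ℤ→ℚ (ℤ.+ 7)) b¹⁰)) (·≐constant-⊛ (ℤ→ℚ (ℤ.+ 5)) 𝒫)))) ⟩
    _ ≐∎

  θb : θ b
    ≐ (ℤ.+ 1 / 60) · (b ⊛ ( ℤ→ℚ -[1+ 4 ] · pow b 10
                          ⊕ ℤ→ℚ (ℤ.+ 66) · (qpow 1 ⊛ pow a 5 ⊛ pow b 5)
                          ⊕ ℤ→ℚ (ℤ.+ 7) · (qpow 2 ⊛ pow a 10)
                          ⊕ ℤ→ℚ (ℤ.+ 5) · 𝒫))
  θb = ≐begin
    θ b
      ≈⟨ modulo (constant (ℤ.+ 1 / 5)) (logDerivative-root b 4 {GV} b₀≡1 logDerivative-b⁵)
           (modulo (constant (ℤ.+ 1 / 60) ⊛ b) 12GV (F.solve 4 (λ b θb g q →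
             θb F.:= (F.con (ℤ.+ 1 / 60) F.:* (b F.:* q)
               F.:+ F.con (ℤ.+ 1 / 5) F.:* (num 5 F.:* θb F.:- g F.:* b)
               F.:+ F.con (ℤ.+ 1 / 60) F.:* b F.:* (num 12 F.:* g F.:- q)))
             (λ _ → refl) b (θ b) GV (QV U V 𝒫))) ⟩
    constant (ℤ.+ 1 / 60) ⊛ (b ⊛ QV U V 𝒫)
      ≈⟨ FPSRing.sym (scale (ℤ.+ 1 / 60) (FPSRing.*-congˡ {b} (FPSRing.+-cong (FPSRing.+-cong (FPSRing.+-cong
           (scale (ℤ→ℚ -[1+ 4 ]) b¹⁰) (scale (ℤ→ℚ (ℤ.+ 66)) qa⁵b⁵))
           (scale (ℤ→ℚ (ℤ.+ 7)) q²a¹⁰)) (·≐constant-⊛ (ℤ→ℚ (ℤ.+ 5)) 𝒫)))) ⟩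
    _ ≐∎

  θ𝒫′ : θ 𝒫
    ≐ (ℤ.+ 5 / 12) · ( pow 𝒫 2
                     ⊕ ℤ→ℚ -[1+ 0 ] · pow b 20
                     ⊕ ℤ→ℚ (ℤ.+ 12) · (qpow 1 ⊛ pow b 15 ⊛ pow a 5)
                     ⊕ ℤ→ℚ -[1+ 13 ] · (qpow 2 ⊛ pow b 10 ⊛ pow a 10)
                     ⊕ ℤ→ℚ -[1+ 11 ] · (qpow 3 ⊛ pow b 5 ⊛ pow a 15)
                     ⊕ ℤ→ℚ -[1+ 0 ] · (qpow 4 ⊛ pow a 20))
  θ𝒫′ = FPSRing.trans θ𝒫 (FPSRing.sym (scale (ℤ.+ 5 / 12) (≐begin
    _
      ≈⟨ FPSRing.+-cong (FPSRing.+-cong (FPSRing.+-cong (FPSRing.+-cong (FPSRing.+-congˡ {pow 𝒫 2}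
           (scale (ℤ→ℚ -[1+ 0 ]) (b⁵ʲ 4))) (scale (ℤ→ℚ (ℤ.+ 12)) (qⁱb⁵ʲa⁵ⁱ 1 3)))
           (scale (ℤ→ℚ -[1+ 13 ]) (qⁱb⁵ʲa⁵ⁱ 2 2))) (scale (ℤ→ℚ -[1+ 11 ]) (qⁱb⁵ʲa⁵ⁱ 3 1)))
           (scale (ℤ→ℚ -[1+ 0 ]) (qⁱa⁵ⁱ 4)) ⟩
    pow 𝒫 2 ⊕ #⁻ 1 ⊛ pow V 4 ⊕ # 12 ⊛ (pow U 1 ⊛ pow V 3) ⊕ #⁻ 14 ⊛ (pow U 2 ⊛ pow V 2)
      ⊕ #⁻ 12 ⊛ (pow U 3 ⊛ pow V 1) ⊕ #⁻ 1 ⊛ pow U 4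
      ≈⟨ F.solve 3 (λ u v p → (p F.:^ 2 F.:+ num⁻ 1 F.:* v F.:^ 4 F.:+ num 12 F.:* (u F.:^ 1 F.:* v F.:^ 3)
           F.:+ num⁻ 14 F.:* (u F.:^ 2 F.:* v F.:^ 2) F.:+ num⁻ 12 F.:* (u F.:^ 3 F.:* v F.:^ 1) F.:+ num⁻ 1 F.:* u F.:^ 4)
           F.:= (p F.:* p F.:- E₄ₚ u v)) (λ _ → refl) U V 𝒫 ⟩
    𝒫 ⊛ 𝒫 ⊕ ⊝ E₄ U V ≐∎)))

open import Data.Integer using (+_)

theorem1p3 : (a b : FPS) → a 0 ≡ 1ℚ → b 0 ≡ 1ℚ
    → pow a 5 ⊛ pow (qPoch 2 5) 5 ⊛ pow (qPoch 3 5) 5 ≐ pow (qPoch 1 1) 2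
    → pow b 5 ⊛ pow (qPoch 1 5) 5 ⊛ pow (qPoch 4 5) 5 ≐ pow (qPoch 1 1) 2
    → ((+ 1 / 5) · a ⊕ θ a
    ≐ (+ 1 / 60) · (a ⊛ ( ℤ→ℚ -[1+ 4 ] · (qpow 2 ⊛ pow a 10)
    ⊕ ℤ→ℚ -[1+ 65 ] · (qpow 1 ⊛ pow a 5 ⊛ pow b 5)
    ⊕ ℤ→ℚ (+ 7) · pow b 10
    ⊕ ℤ→ℚ (+ 5) · 𝒫)))
    × (θ b
    ≐ (+ 1 / 60) · (b ⊛ ( ℤ→ℚ -[1+ 4 ] · pow b 10
    ⊕ ℤ→ℚ (+ 66) · (qpow 1 ⊛ pow a 5 ⊛ pow b 5)
    ⊕ ℤ→ℚ (+ 7) · (qpow 2 ⊛ pow a 10)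
    ⊕ ℤ→ℚ (+ 5) · 𝒫)))
    × (θ 𝒫
    ≐ (+ 5 / 12) · ( pow 𝒫 2
    ⊕ ℤ→ℚ -[1+ 0 ] · pow b 20
    ⊕ ℤ→ℚ (+ 12) · (qpow 1 ⊛ pow b 15 ⊛ pow a 5)
    ⊕ ℤ→ℚ -[1+ 13 ] · (qpow 2 ⊛ pow b 10 ⊛ pow a 10)
    ⊕ ℤ→ℚ -[1+ 11 ] · (qpow 3 ⊛ pow b 5 ⊛ pow a 15)
    ⊕ ℤ→ℚ -[1+ 0 ] · (qpow 4 ⊛ pow a 20)))
theorem1p3 a b a₀≡1 b₀≡1 a⁵ b⁵ = θa , θb , θ𝒫′
  where open Solution a b a₀≡1 b₀≡1 a⁵ b⁵
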